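{- Let $q=2$ and let $m\ge 2$ be an integer. Then there exists a simple $q$-PBD$(ml,K,42s)$ (with $q=2$) if one of the following holds: (i) $K=\{3,4\}$ and one of: $l=7$ and $s\in\{1,2,3\}$; $l=8$ and $1\le s\le 17$; $l=9$ and $1\le s\le 66$ with $s\ne 33$; (ii) $K=\{3,4,5\}$ and one of: $l=6$ and $s=1$; $l=7$ and $s\in\{3,4,5,6\}$. Here $s$ is an integer.
   Context: A $q$-PBD$(v,K,\lambda)$ ($q$-analog of a pairwise balanced design) is a pair $(V,\mathcal B)$ where $V$ is a $v$-dimensional vector space over $\mathrm{GF}(q)$ and $\mathcal B$ is a collection of subspaces of $V$ (blocks) with dimensions in $K$, such that every $2$-dimensional subspace of $V$ is contained in exactly $\lambda$ blocks. It is simple if there are no repeated blocks. -}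

module Defs where

open import Algebra.Bundles using (CommutativeRing)
open import Algebra.Module.Bundles using (Module)
import Algebra.Definitions.RawMonoid as RawMonoidDefs
open import Data.Bool.Base using (true; false)
open import Data.Bool.Properties using (xor-∧-commutativeRing)
open import Data.Empty using (⊥-elim)
open import Data.Fin.Base using (Fin)
open import Data.Fin.Properties using (2↔Bool)
open import Data.Fin.Subset using (Subset; ∣_∣) renaming (_∈_ to _∈ₛ_)
open import Data.List.Base using (List)
open import Data.List.Membership.Propositional using (_∈_)
open import Data.Nat.Base using (ℕ)
open import Data.Product.Base using (∃; ∃-syntax; _×_; _,_)
open import Data.Vec.Functional using (Vector)
open import Function.Bundles using (Inverse; _⇔_)
open import Level using (0ℓ)
open import Relation.Binary.PropositionalEquality using (_≡_; refl; setoid)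
open import Relation.Nullary.Negation using (¬_)
open import Relation.Unary using (Pred; _⊆_; _≐_; U)

record FiniteField (q : ℕ) : Set₁ where
  field
    commutativeRing : CommutativeRing 0ℓ 0ℓ
  open CommutativeRing commutativeRing public
    using (Carrier; _≈_; _*_; 0#; 1#) renaming (setoid to carrierSetoid)
  field
    1≉0         : ¬ (1# ≈ 0#)
    invertible  : ∀ x → ¬ (x ≈ 0#) → ∃[ y ] x * y ≈ 1#
    enumeration : Inverse (setoid (Fin q)) carrierSetoid

GF2 : FiniteField 2
GF2 = record
  { commutativeRing = xor-∧-commutativeRing
  ; 1≉0             = λ ()
  ; invertible      = λ { true _ → true , refl ; false f≢f → ⊥-elim (f≢f refl) }
  ; enumeration     = 2↔Bool
  }

VectorSpace : ∀ {q} → FiniteField q → Set₁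
VectorSpace F = Module (FiniteField.commutativeRing F) 0ℓ 0ℓ

module _ {R : CommutativeRing 0ℓ 0ℓ} (V : Module R 0ℓ 0ℓ) where
  private module R = CommutativeRing R
  open Module V

  linearCombination : ∀ {k} → Vector R.Carrier k → Vector Carrierᴹ k → Carrierᴹ
  linearCombination c b = RawMonoidDefs.sum +ᴹ-rawMonoid (λ i → c i *ₗ b i)

  record Subspace : Set₁ where
    field
      Member    : Pred Carrierᴹ 0ℓ
      resp      : ∀ {x y} → x ≈ᴹ y → Member x → Member y
      0-closed  : Member 0ᴹ
      +-closed  : ∀ {x y} → Member x → Member y → Member (x +ᴹ y)
      *ₗ-closed : ∀ a {x} → Member x → Member (a *ₗ x)

  LinearlyIndependent : ∀ {k} → Vector Carrierᴹ k → Set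
  LinearlyIndependent b =
    ∀ c → linearCombination c b ≈ᴹ 0ᴹ → ∀ i → c i R.≈ R.0#

  record IsBasis {k} (P : Pred Carrierᴹ 0ℓ) (b : Vector Carrierᴹ k) : Set where
    field
      member      : ∀ i → P (b i)
      independent : LinearlyIndependent b
      spanning    : ∀ {x} → P x → ∃[ c ] x ≈ᴹ linearCombination c b

  HasDimension : Pred Carrierᴹ 0ℓ → ℕ → Set
  HasDimension P k = ∃[ b ] IsBasis {k} P b

-- "Exactly n of the indices satisfy P", without assuming P decidable.
ExactlyMany : ∀ {b} → ℕ → Pred (Fin b) 0ℓ → Set
ExactlyMany {b} n P = ∃[ S ] (∣ S ∣ ≡ n × (∀ (i : Fin b) → i ∈ₛ S ⇔ P i))

-- The collection of blocks is a finite family, so blocks may be repeated;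
-- `Simple` below excludes this.
record PBD {q} (F : FiniteField q) (v : ℕ) (K : List ℕ) (index : ℕ) : Set₁ where
  open Subspace using (Member)
  field
    V         : VectorSpace F
    dimension : HasDimension V U v
    size      : ℕ
    block     : Fin size → Subspace V
    blockDim  : ∀ i → ∃[ k ] (k ∈ K × HasDimension V (Member (block i)) k)
    balanced  : ∀ (T : Subspace V) → HasDimension V (Member T) 2 →
                ExactlyMany index (λ i → Member T ⊆ Member (block i))

-- Subspaces are compared by extensional equality of their sets of vectors.
Simple : ∀ {q} {F : FiniteField q} {v K index} → PBD F v K index → Set
Simple D = ∀ i j → Member (block i) ≐ Member (block j) → i ≡ j
  where
    open PBD D
    open Subspace using (Member)

-- Let F be the field with 2ˡ elements and V = Fᵐ, seen as a vector space over F₂. A line (a subspace of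
-- dimension 2 over F₂) either lies in a one-dimensional F-space or is spanned by p, q independent over F.
--
-- Lines of the second kind are covered by the blocks {z u + z² v : z ∈ U}, where u, v are independent
-- over F and U runs through s three-dimensional subspaces of F that are inequivalent under F* and have
-- trivial stabilizers. Two distinct nonzero vectors of such a block are independent over F, and for each
-- of the 42 ordered pairs of distinct nonzero x, y ∈ U the equations p = x u + x² v, q = y u + y² v have
-- exactly one solution (u , v); so p and q lie together in exactly 42 s of these blocks.
--
-- Lines of the first kind are covered by the blocks B v with 0 ≠ v ∈ V and B in an F*-invariant design on
-- F of index 42 s. Such a design is a union of orbits of base blocks, and the line spanned by 1 and t lies
-- in as many blocks as there are pairs of a base block B and x ∈ B, x ≠ 0, with t x ∈ B. Explicit base
-- blocks are checked by evaluation: a histogram of the ratios of their elements, and power sums Σ bᵉ over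
-- b ∈ B, which are multiplied by cᵉ when B is replaced by c B and thus show that the orbits are distinct
-- and regular. The base blocks come in disjoint batches, whose weights add up to every required s.

module Submission where

open import Defs
open import Algebra.Bundles using (CommutativeRing)
open import Algebra.Core using (Op₁; Op₂)
open import Algebra.Module.Bundles using (Module)
import Algebra.Module.Structures.Biased as Biased
import Algebra.Properties.CommutativeSemigroup as CommutativeSemigroup
import Algebra.Solver.Ring as RingSolver
open import Algebra.Solver.Ring.AlmostCommutativeRing using (fromCommutativeRing; _-Raw-AlmostCommutative⟶_)
open import Algebra.Structures using (IsAbelianGroup; IsCommutativeMonoid; IsCommutativeRing)
open import Data.Bool.Base using (Bool; true; false; _xor_; _∧_; if_then_else_)
import Data.Bool.Properties as Bool
open import Data.Empty using (⊥)
open import Data.Fin.Base using (Fin; zero; suc)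
open import Data.Fin.Properties using (injective⇒≤)
open import Data.Fin.Subset using (∣_∣)
open import Data.List.Base as List
  using (List; []; _∷_; _++_; length; map; filter; foldr; concatMap; cartesianProduct; cartesianProductWith; deduplicate; upTo)
open import Data.List.Membership.Propositional using (_∈_; find; lose)
open import Data.List.Membership.Propositional.Properties
  using (∈-lookup; ∈-filter⁺; ∈-filter⁻; ∈-cartesianProduct⁺; ∈-cartesianProduct⁻; ∈-cartesianProductWith⁺; ∈-concatMap⁺; ∈-concatMap⁻;
         ∈-++⁺ˡ; ∈-++⁺ʳ; ∈-++⁻; ∈-map⁺; ∈-map⁻; ∈-upTo⁺; ∈-deduplicate⁻)
open import Data.List.Membership.Propositional.Properties.WithK using (unique∧set⇒bag)
open import Data.List.Properties
  using (map-++; map-∘; map-cong; map-cong-local; filter-++; filter-accept; filter-reject; length-++; length-map; length-take; concatMap-++; concatMap-cong; map-concatMap)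
open import Data.List.Relation.Binary.BagAndSetEquality using (∼bag⇒↭)
open import Data.List.Relation.Binary.Permutation.Propositional as Permutation using (_↭_)
import Data.List.Relation.Binary.Permutation.Propositional.Properties as Permutation
open import Data.List.Relation.Binary.Sublist.Propositional as Sublist using ([]; _∷ʳ_; _∷_) renaming (_⊆_ to _⊑_)
import Data.List.Relation.Binary.Sublist.Propositional.Properties as Sublist
open import Data.List.Relation.Unary.All as All using (All; []; _∷_)
import Data.List.Relation.Unary.All.Properties as All
open import Data.List.Relation.Unary.AllPairs as AllPairs using (AllPairs; []; _∷_)
import Data.List.Relation.Unary.AllPairs.Properties as AllPairs
open import Data.List.Relation.Unary.Any as Any using (Any; here; there)
import Data.List.Relation.Unary.Any.Properties as Any
import Data.List.Relation.Unary.Unique.DecSetoid.Properties as UniqueDec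
open import Data.List.Relation.Unary.Unique.Propositional using (Unique)
import Data.List.Relation.Unary.Unique.Propositional.Properties as Unique
open import Data.Nat.Base as ℕ using (ℕ; zero; suc)
open import Data.Nat.ListAction using (sum)
import Data.Nat.Properties as ℕ
open import Data.List.Membership.DecPropositional ℕ._≟_ using (_∈?_)
open import Data.Product.Base using (Σ; ∃; ∃₂; _×_; _,_; proj₁; proj₂; uncurry)
open import Data.Sum.Base as Sum using (_⊎_; inj₁; inj₂; [_,_]′)
open import Data.Vec.Base as Vec using (Vec; []; _∷_; lookup; tabulate; zipWith; replicate)
import Data.Vec.Membership.Propositional as VecMembership
import Data.Vec.Properties as Vec
open import Data.Vec.Relation.Unary.All as VecAll using ([]; _∷_)
import Data.Vec.Relation.Unary.All.Properties as VecAll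
import Data.Vec.Relation.Unary.Any as VecAny
open import Function.Base using (id; flip; _∘_)
open import Function.Bundles using (_⇔_; mk⇔; Equivalence)
open import Function.Strict using (_$!_; force-≡)
open import Level using (0ℓ)
open import Relation.Binary.Bundles using (DecSetoid)
open import Relation.Binary.Definitions using (DecidableEquality)
open import Relation.Binary.PropositionalEquality
open import Relation.Binary.PropositionalEquality.Algebra using (isMagma)
open import Relation.Nullary using (¬_; Dec; yes; no; does; contradiction)
open import Relation.Nullary.Decidable using (map′; _×-dec_; _⊎-dec_; _→-dec_; ¬?; dec-true; dec⇒maybe; toWitness)
open import Relation.Unary using (Pred; Decidable; _⊆_; _≐_; U)

-- Squaring is additive but not F-linear. Hence the set of all z u + z² v is an F₂-space, and the
-- points of parameters x, y have determinant x y (x + y), which is nonzero for distinct nonzero x,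
-- y: this gives both the independence over F and the unique solution (u , v). The danger is
-- repetition, since one block could arise from several (U, u, v). Writing u, v in terms of another
-- pair u′, v′ gives a polynomial with terms X⁴, X², X only, which vanishes on the 8 elements of U
-- and so is zero. What remains is the substitution (U, u, v) ↦ (c U, c⁻¹ u, c⁻² v), and this is
-- what inequivalence and trivial stabilizers of the U exclude. The other obstacle is the cost of
-- evaluation. Base blocks are stored up to Frobenius conjugation and their ratios are counted for
-- representatives only. Orbits are compared by power sums with exponents e prime to the order of
-- F*: then c ↦ cᵉ is a bijection, so a block with a nonzero power sum has exactly one multiple
-- whose first nonzero power sum is 1, and for blocks normalized in this way different power sums
-- mean different orbits.

-- Vector spaces over F₂ and subspaces given by generators.

Bits : ℕ → Set
Bits = Vec Bool

infixl 6 _⊕_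
_⊕_ : ∀ {n} → Bits n → Bits n → Bits n
[]       ⊕ []       = []
(a ∷ as) ⊕ (b ∷ bs) = (a xor b) ∷ (as ⊕ bs)

𝟘 : ∀ {n} → Bits n
𝟘 = replicate _ false

allBits : ∀ n → List (Bits n)
allBits zero    = [] ∷ []
allBits (suc n) = map (false ∷_) (allBits n) ++ map (true ∷_) (allBits n)

∈-allBits : ∀ {n} (c : Bits n) → c ∈ allBits n
∈-allBits []          = here refl
∈-allBits (false ∷ c) = ∈-++⁺ˡ (∈-map⁺ _ (∈-allBits c))
∈-allBits (true ∷ c)  = ∈-++⁺ʳ _ (∈-map⁺ _ (∈-allBits c))

allBits-unique : ∀ n → Unique (allBits n)
allBits-unique zero    = [] ∷ []
allBits-unique (suc n) = Unique.++⁺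
  (Unique.map⁺ Vec.∷-injectiveʳ (allBits-unique n))
  (Unique.map⁺ Vec.∷-injectiveʳ (allBits-unique n))
  (λ (f , t) → false≢true (∈-map⁻ _ f) (∈-map⁻ _ t))
  where
  false≢true : ∀ {n} {v : Bits (suc n)} {P Q : Bits n → Set} →
               ∃ (λ c → P c × v ≡ false ∷ c) → ¬ ∃ (λ c → Q c × v ≡ true ∷ c)
  false≢true (_ , _ , refl) (_ , _ , ())

-- The group inverse is `id`, so that `inverseʳ` reads x + x = 0. This alone encodes characteristic
-- two, and with it the action `_∙_` of F₂.
record BinarySpace : Set₁ where
  infixl 6 _+_
  infix 4 _≟_
  field
    Carrier        : Set
    _+_            : Op₂ Carrier
    0#             : Carrier
    isAbelianGroup : IsAbelianGroup _≡_ _+_ 0# id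
    _≟_            : DecidableEquality Carrier

  open IsAbelianGroup isAbelianGroup public
    using () renaming
    ( assoc to +-assoc ; comm to +-comm ; identityˡ to +-identityˡ
    ; identityʳ to +-identityʳ ; inverseʳ to x+x≡0 ; isCommutativeMonoid to +-isCommutativeMonoid)

  +-interchange : ∀ w x y z → (w + x) + (y + z) ≡ (w + y) + (x + z)
  +-interchange = CommutativeSemigroup.interchange
    (record { isCommutativeSemigroup = IsCommutativeMonoid.isCommutativeSemigroup +-isCommutativeMonoid })

  +-cancelʳ : ∀ x y → x + y + y ≡ x
  +-cancelʳ x y = trans (+-assoc x y y) (trans (cong (x +_) (x+x≡0 y)) (+-identityʳ x))

  x+y≡0⇒x≡y : ∀ {x y} → x + y ≡ 0# → x ≡ y
  x+y≡0⇒x≡y {x} {y} eq = trans (sym (+-cancelʳ x y)) (trans (cong (_+ y) eq) (+-identityˡ y))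

-- Subspaces are carried as tuples of generators, which keeps membership, inclusion and equality
-- (`_≑_`) decidable. They become predicates only through `toSubspace`.
Frame : Set → Set
Frame A = ∃ (Vec A)

mapFrame : ∀ {A B : Set} → (A → B) → Frame A → Frame B
mapFrame f (k , vs) = k , Vec.map f vs

module Span (E : BinarySpace) where
  open BinarySpace E

  infixr 7 _∙_
  _∙_ : Bool → Carrier → Carrier
  true  ∙ x = x
  false ∙ x = 0#

  ∙-zeroʳ : ∀ b → b ∙ 0# ≡ 0#
  ∙-zeroʳ true  = refl
  ∙-zeroʳ false = refl

  ∙-distribˡ : ∀ b x y → b ∙ (x + y) ≡ b ∙ x + b ∙ y
  ∙-distribˡ true  x y = refl
  ∙-distribˡ false x y = sym (+-identityˡ 0#)

  ∙-distribʳ : ∀ x a b → (a xor b) ∙ x ≡ a ∙ x + b ∙ x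
  ∙-distribʳ x true  true  = sym (x+x≡0 x)
  ∙-distribʳ x true  false = sym (+-identityʳ x)
  ∙-distribʳ x false b     = sym (+-identityˡ _)

  ∙-assoc : ∀ a b x → (a ∧ b) ∙ x ≡ a ∙ (b ∙ x)
  ∙-assoc true  b x = refl
  ∙-assoc false b x = refl

  comb : ∀ {k} → Bits k → Vec Carrier k → Carrier
  comb []       []       = 0#
  comb (c ∷ cs) (v ∷ vs) = c ∙ v + comb cs vs

  comb-⊕ : ∀ {k} (c d : Bits k) vs → comb (c ⊕ d) vs ≡ comb c vs + comb d vs
  comb-⊕ []       []       []       = sym (+-identityˡ 0#)
  comb-⊕ (c ∷ cs) (d ∷ ds) (v ∷ vs) = trans
    (cong₂ _+_ (∙-distribʳ v c d) (comb-⊕ cs ds vs)) (+-interchange _ _ _ _)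

  comb-𝟘 : ∀ {k} (vs : Vec Carrier k) → comb 𝟘 vs ≡ 0#
  comb-𝟘 []       = refl
  comb-𝟘 (v ∷ vs) = trans (+-identityˡ _) (comb-𝟘 vs)

  infix 4 _∈⟨_⟩ _≑_
  _∈⟨_⟩ : Carrier → Frame Carrier → Set
  x ∈⟨ k , vs ⟩ = ∃ λ c → comb c vs ≡ x

  _≑_ : Frame Carrier → Frame Carrier → Set
  B ≑ B′ = (_∈⟨ B ⟩) ≐ (_∈⟨ B′ ⟩)

  ≑-refl : ∀ {B} → B ≑ B
  ≑-refl = id , id

  ≑-sym : ∀ {B B′} → B ≑ B′ → B′ ≑ B
  ≑-sym (f , g) = g , f

  ≑-trans : ∀ {A B C} → A ≑ B → B ≑ C → A ≑ C
  ≑-trans (f , g) (f′ , g′) = (λ x → f′ (f x)) , (λ x → g (g′ x))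

  Independent : Frame Carrier → Set
  Independent (k , vs) = ∀ c → comb c vs ≡ 0# → c ≡ 𝟘

  0∈⟨⟩ : ∀ B → 0# ∈⟨ B ⟩
  0∈⟨⟩ (k , vs) = 𝟘 , comb-𝟘 vs

  +∈⟨⟩ : ∀ B {x y} → x ∈⟨ B ⟩ → y ∈⟨ B ⟩ → x + y ∈⟨ B ⟩
  +∈⟨⟩ (k , vs) (c , refl) (d , refl) = c ⊕ d , comb-⊕ c d vs

  ∙∈⟨⟩ : ∀ B b {x} → x ∈⟨ B ⟩ → b ∙ x ∈⟨ B ⟩
  ∙∈⟨⟩ B true  x∈ = x∈
  ∙∈⟨⟩ B false x∈ = 0∈⟨⟩ B

  ⊕-self : ∀ {n} (c d : Bits n) → c ⊕ d ≡ 𝟘 → c ≡ d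
  ⊕-self []          []          eq = refl
  ⊕-self (false ∷ c) (false ∷ d) eq = cong (false ∷_) (⊕-self c d (Vec.∷-injectiveʳ eq))
  ⊕-self (true ∷ c)  (true ∷ d)  eq = cong (true ∷_) (⊕-self c d (Vec.∷-injectiveʳ eq))

  comb-injective : ∀ {B} → Independent B → ∀ {c d} → comb c (proj₂ B) ≡ comb d (proj₂ B) → c ≡ d
  comb-injective {k , vs} ind {c} {d} eq = ⊕-self c d (ind (c ⊕ d)
    (trans (comb-⊕ c d vs) (trans (cong (_+ comb d vs) eq) (x+x≡0 _))))

  span : ∀ {k} → Vec Carrier k → List Carrier
  span []       = 0# ∷ []
  span (v ∷ vs) = span vs ++ map (v +_) (span vs)

  span≡map-comb : ∀ {k} (vs : Vec Carrier k) → span vs ≡ map (λ c → comb c vs) (allBits k)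
  span≡map-comb []       = refl
  span≡map-comb {suc k} (v ∷ vs) = begin
    span vs ++ map (v +_) (span vs)
      ≡⟨ cong (λ l → l ++ map (v +_) l) (span≡map-comb vs) ⟩
    map g (allBits k) ++ map (v +_) (map g (allBits k))
      ≡⟨ cong₂ _++_ (trans (map-cong (λ c → sym (+-identityˡ (g c))) (allBits k))
          (map-∘ {g = f} {f = false ∷_} (allBits k)))
                    (trans (sym (map-∘ {g = v +_} {f = g} (allBits k)))
                        (map-∘ {g = f} {f = true ∷_} (allBits k))) ⟩
    map f (map (false ∷_) (allBits k)) ++ map f (map (true ∷_) (allBits k))
      ≡⟨ map-++ f (map (false ∷_) (allBits k)) (map (true ∷_) (allBits k)) ⟨
    map f (allBits (suc k)) ∎
    where
    open ≡-Reasoning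
    g = λ c → comb c vs
    f = λ c → comb c (v ∷ vs)

  ∈-span⁺ : ∀ B {x} → x ∈⟨ B ⟩ → x ∈ span (proj₂ B)
  ∈-span⁺ (k , vs) (c , refl) = subst (comb c vs ∈_) (sym (span≡map-comb vs))
      (∈-map⁺ (λ d → comb d vs) (∈-allBits c))

  ∈-span⁻ : ∀ B {x} → x ∈ span (proj₂ B) → x ∈⟨ B ⟩
  ∈-span⁻ (k , vs) {x} x∈ with ∈-map⁻ (λ c → comb c vs) (subst (x ∈_) (span≡map-comb vs) x∈)
  ... | c , _ , eq = c , sym eq

  span-unique : ∀ B → Independent B → Unique (span (proj₂ B))
  span-unique B ind = subst Unique (sym (span≡map-comb _))
    (Unique.map⁺ (comb-injective {B} ind) (allBits-unique _))

  ∈⟨⟩-dec : ∀ B → Decidable (_∈⟨ B ⟩)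
  ∈⟨⟩-dec B x = map′ (∈-span⁻ B) (∈-span⁺ B) (Any.any? (x ≟_) (span (proj₂ B)))

  comb∈⟨⟩ : ∀ B {k} {vs : Vec Carrier k} → VecAll.All (_∈⟨ B ⟩) vs → ∀ c → comb c vs ∈⟨ B ⟩
  comb∈⟨⟩ B VecAll.[]         []      = 0∈⟨⟩ B
  comb∈⟨⟩ B (v∈ VecAll.∷ vs∈) (c ∷ cs) = +∈⟨⟩ B (∙∈⟨⟩ B c v∈) (comb∈⟨⟩ B vs∈ cs)

  generators∈ : ∀ {k} (vs : Vec Carrier k) → VecAll.All (_∈⟨ k , vs ⟩) vs
  generators∈ []       = VecAll.[]
  generators∈ (v ∷ vs) =
    (true ∷ 𝟘 , trans (cong (v +_) (comb-𝟘 vs)) (+-identityʳ v)) VecAll.∷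
    VecAll.map (λ (c , eq) → false ∷ c , trans (+-identityˡ _) eq) (generators∈ vs)

  ⊆-dec : ∀ B B′ → Dec ((_∈⟨ B ⟩) ⊆ (_∈⟨ B′ ⟩))
  ⊆-dec (k , vs) B′ = map′ (λ all (c , eq) → subst (_∈⟨ B′ ⟩) eq (comb∈⟨⟩ B′ all c))
    (λ sub → VecAll.map sub (generators∈ vs)) (VecAll.all? (∈⟨⟩-dec B′) vs)

  ≑-dec : ∀ B B′ → Dec (B ≑ B′)
  ≑-dec B B′ = ⊆-dec B B′ ×-dec ⊆-dec B′ B

  ≑-decSetoid : DecSetoid 0ℓ 0ℓ
  ≑-decSetoid = record
    { Carrier = Frame Carrier
    ; _≈_ = _≑_
    ; isDecEquivalence = record
      { isEquivalence = record
        { refl = λ {B} → ≑-refl {B}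
        ; sym = λ {B} {B′} → ≑-sym {B} {B′}
        ; trans = λ {A} {B} {C} → ≑-trans {A} {B} {C}
        }
      ; _≟_ = ≑-dec
      }
    }

  asModule : Module Bool.xor-∧-commutativeRing 0ℓ 0ℓ
  asModule = record
    { Carrierᴹ = Carrier ; _≈ᴹ_ = _≡_ ; _+ᴹ_ = _+_ ; _*ₗ_ = _∙_ ; _*ᵣ_ = flip _∙_ ; 0ᴹ = 0# ; -ᴹ_ = id
    ; isModule = Biased.IsModuleFromLeft.isModule {commutativeRing = Bool.xor-∧-commutativeRing} (record
      { isLeftModule = record
        { isLeftSemimodule = record
          { +ᴹ-isCommutativeMonoid = +-isCommutativeMonoid
          ; isPreleftSemimodule = record
            { *ₗ-cong = cong₂ _∙_ ; *ₗ-zeroˡ = λ _ → refl ; *ₗ-distribʳ = ∙-distribʳ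
            ; *ₗ-identityˡ = λ _ → refl ; *ₗ-assoc = ∙-assoc ; *ₗ-zeroʳ = ∙-zeroʳ
            ; *ₗ-distribˡ = ∙-distribˡ }
          }
        ; -ᴹ‿cong = id
        ; -ᴹ‿inverse = x+x≡0 , x+x≡0
        }
      })
    }

  linearCombination≡comb : ∀ {k} c (vs : Vec Carrier k) →
    linearCombination asModule c (lookup vs) ≡ comb (tabulate c) vs
  linearCombination≡comb c []       = refl
  linearCombination≡comb c (v ∷ vs) = cong (c zero ∙ v +_) (linearCombination≡comb (c ∘ suc) vs)

  toSubspace : Frame Carrier → Subspace asModule
  toSubspace B = record
    { Member = _∈⟨ B ⟩ ; resp = λ { refl x∈ → x∈ } ; 0-closed = 0∈⟨⟩ B
    ; +-closed = +∈⟨⟩ B ; *ₗ-closed = ∙∈⟨⟩ B }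

  lookup∘tabulate≡0 : ∀ {k} (c : Fin k → Bool) → tabulate c ≡ 𝟘 → ∀ i → c i ≡ false
  lookup∘tabulate≡0 c eq i = trans (sym (Vec.lookup∘tabulate c i))
    (trans (cong (λ v → lookup v i) eq) (Vec.lookup-replicate i false))

  frame-dimension : ∀ B (P : Pred Carrier 0ℓ) → P ≐ (_∈⟨ B ⟩) → Independent B →
                    HasDimension asModule P (proj₁ B)
  frame-dimension (k , vs) P (P⊆ , ⊆P) ind = lookup vs , record
    { member = λ i → ⊆P (VecAll.lookup⁺ (generators∈ vs) i)
    ; independent = λ c eq → lookup∘tabulate≡0 c
        (ind (tabulate c) (trans (sym (linearCombination≡comb c vs)) eq))
    ; spanning = λ Px → let c , eq = P⊆ Px in lookup c ,
        trans (sym eq) (trans (cong (λ d → comb d vs) (sym (Vec.tabulate∘lookup c)))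
                              (sym (linearCombination≡comb (lookup c) vs)))
    }

-- Counting in lists up to an equivalence.

module _ {A : Set} {_≈_ : A → A → Set} (≈-sym : ∀ {x y} → x ≈ y → y ≈ x)
         (≈-trans : ∀ {x y z} → x ≈ y → y ≈ z → x ≈ z) where

  private
    Distinct : List A → Set
    Distinct = AllPairs (λ x y → ¬ x ≈ y)

  lookup-distinct : ∀ {xs} → Distinct xs → ∀ {i j} → List.lookup xs i ≈ List.lookup xs j → i ≡ j
  lookup-distinct (x∉ ∷ d) {zero}  {zero}  eq = refl
  lookup-distinct (x∉ ∷ d) {zero}  {suc j} eq = contradiction eq (All.lookup x∉ (∈-lookup j))
  lookup-distinct (x∉ ∷ d) {suc i} {zero}  eq = contradiction (≈-sym eq) (All.lookup x∉ (∈-lookup i))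
  lookup-distinct (x∉ ∷ d) {suc i} {suc j} eq = cong suc (lookup-distinct d eq)

  -- Pigeonhole: each position of `xs` is sent to the position of a companion in `ys`, and two
  -- positions with the same companion would hold equivalent members.
  distinct-length-≤ : ∀ {xs ys} → Distinct xs → (∀ {x} → x ∈ xs → Any (x ≈_) ys) → length xs ℕ.≤ length ys
  distinct-length-≤ {xs} {ys} d sub = injective⇒≤ {f = index} λ {i} {j} eq →
    lookup-distinct d (≈-trans (found i) (≈-sym (subst (λ k → List.lookup xs j ≈ List.lookup ys k) (sym eq)
        (found j))))
    where
    index = λ i → Any.index (sub (∈-lookup {xs = xs} i))
    found : ∀ i → List.lookup xs i ≈ List.lookup ys (index i)
    found i = Any.lookup-index (sub (∈-lookup i))

∣tabulate∣≡length-filter : ∀ {A : Set} {P : Pred A 0ℓ} (P? : Decidable P) xs →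
  ∣ tabulate (λ i → does (P? (List.lookup xs i))) ∣ ≡ length (filter P? xs)
∣tabulate∣≡length-filter P? []       = refl
∣tabulate∣≡length-filter P? (x ∷ xs) with P? x
... | yes _ = cong suc (∣tabulate∣≡length-filter P? xs)
... | no _  = ∣tabulate∣≡length-filter P? xs

filter-exactlyMany : ∀ {A : Set} {P : Pred A 0ℓ} (P? : Decidable P) xs {n} → length (filter P? xs) ≡ n →
                     ExactlyMany n (λ i → P (List.lookup xs i))
filter-exactlyMany P? xs len =
  tabulate P?ₗ , trans (∣tabulate∣≡length-filter P? xs) len , λ i → mk⇔
    (λ i∈ → toP i (trans (sym (Vec.lookup∘tabulate P?ₗ i)) (Vec.[]=⇒lookup i∈)))
    (λ p → Vec.lookup⇒[]= i _ (trans (Vec.lookup∘tabulate P?ₗ i) (dec-true (P? _) p)))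
  where
  P?ₗ = λ i → does (P? (List.lookup xs i))
  toP : ∀ i → P?ₗ i ≡ true → _
  toP i eq with P? (List.lookup xs i)
  ... | yes p = p

exactlyMany-resp : ∀ {b n} {P Q : Pred (Fin b) 0ℓ} → (∀ i → P i ⇔ Q i) → ExactlyMany n P → ExactlyMany n Q
exactlyMany-resp P⇔Q (S , len , eqv) = S , len , λ i → mk⇔
  (Equivalence.to (P⇔Q i) ∘ Equivalence.to (eqv i)) (Equivalence.from (eqv i) ∘ Equivalence.from (P⇔Q i))

-- A simple design is specified by consistent lists of all blocks through each line.
module FromPencils
  (E : BinarySpace)
  (elements : List (BinarySpace.Carrier E)) (complete : ∀ x → x ∈ elements)
  (basis : Frame (BinarySpace.Carrier E)) (basis-independent : Span.Independent E basis)
  (basis-spanning : ∀ x → Span._∈⟨_⟩ E x basis)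
  (K : List ℕ) (index : ℕ)
  (through : BinarySpace.Carrier E → BinarySpace.Carrier E → List (Frame (BinarySpace.Carrier E)))
  where
  open BinarySpace E
  open Span E

  Line : Carrier → Carrier → Set
  Line p q = p ≢ 0# × q ≢ 0# × p ≢ q

  private
    line? : ∀ p q → Dec (Line p q)
    line? p q = ¬? (p ≟ 0#) ×-dec ¬? (q ≟ 0#) ×-dec ¬? (p ≟ q)

    lines : List (Carrier × Carrier)
    lines = filter (uncurry line?) (cartesianProduct elements elements)

    -- A block turns up once for every ordered pair that spans one of its lines, possibly with
    -- another frame each time; deduplication up to `_≑_` leaves one copy and yields simplicity.
    candidates blocks : List (Frame Carrier)
    candidates = concatMap (uncurry through) lines
    blocks = deduplicate ≑-dec candidates

    basis-line : (T : Subspace asModule) → HasDimension asModule (Subspace.Member T) 2 →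
                 ∃₂ λ p q → Line p q × (∀ B → (p ∈⟨ B ⟩ × q ∈⟨ B ⟩) ⇔ (Subspace.Member T ⊆ (_∈⟨ B ⟩)))
    basis-line T (b , isBasis) = b zero , b (suc zero) ,
      -- The coefficient vectors 10, 01 and 11 are the relations that p = 0, q = 0 and p = q would
      -- produce.
      ( (λ p≡0 → false≢true (independent (lookup (true ∷ false ∷ []))
                  (trans (cong₂ _+_ p≡0 (+-identityʳ 0#)) (+-identityʳ 0#)) zero))
      , (λ q≡0 → false≢true (independent (lookup (false ∷ true ∷ []))
                  (trans (+-identityˡ _) (trans (+-identityʳ _) q≡0)) (suc zero)))
      , (λ p≡q → false≢true (independent (lookup (true ∷ true ∷ []))
                  (trans (cong₂ _+_ p≡q (+-identityʳ _)) (x+x≡0 _)) zero))) ,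
      λ B → mk⇔
        (λ (p∈ , q∈) x∈T → let c , eq = spanning x∈T in subst (_∈⟨ B ⟩) (sym eq)
           (+∈⟨⟩ B (∙∈⟨⟩ B (c zero) p∈) (+∈⟨⟩ B (∙∈⟨⟩ B (c (suc zero)) q∈) (0∈⟨⟩ B))))
        (λ (T⊆B : Subspace.Member T ⊆ (_∈⟨ B ⟩)) → T⊆B (member zero) , T⊆B (member (suc zero)))
      where
      open IsBasis isBasis
      false≢true : true ≢ false
      false≢true ()

  module _
    (valid : ∀ {p q} → Line p q → ∀ {B} → B ∈ through p q → proj₁ B ∈ K × Independent B)
    (contains : ∀ {p q} → Line p q → ∀ {B} → B ∈ through p q → p ∈⟨ B ⟩ × q ∈⟨ B ⟩)
    (distinct : ∀ {p q} → Line p q → AllPairs (λ B B′ → ¬ B ≑ B′) (through p q))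
    (many : ∀ {p q} → Line p q → length (through p q) ≡ index)
    (consistent : ∀ {p q p′ q′ B} → Line p q → Line p′ q′ → B ∈ through p q →
                  p′ ∈⟨ B ⟩ → q′ ∈⟨ B ⟩ → Any (B ≑_) (through p′ q′))
    where

    private
      origin : ∀ {B} → B ∈ blocks → ∃₂ λ p q → Line p q × B ∈ through p q
      origin B∈ with find (∈-concatMap⁻ (uncurry through) {xs = lines} (∈-deduplicate⁻ ≑-dec candidates B∈))
      ... | (p , q) , pq∈ , B∈pq = p , q , proj₂ (∈-filter⁻
          (uncurry line?) {xs = cartesianProduct elements elements} pq∈) , B∈pq

      present : ∀ {p q B} → Line p q → B ∈ through p q → Any (B ≑_) blocks
      present {p} {q} {B} l B∈ = Any.deduplicate⁺ ≑-dec
        (λ {C} {D} D≑C B≑C → ≑-trans {B} {C} {D} B≑C (≑-sym {D} {C} D≑C))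
        (Any.map (λ { refl → ≑-refl {B} }) (∈-concatMap⁺ (uncurry through) {xs = lines}
          (lose (∈-filter⁺ (uncurry line?) (∈-cartesianProduct⁺ (complete p) (complete q)) l) B∈)))

      S : ∀ p q → Decidable (λ B → p ∈⟨ B ⟩ × q ∈⟨ B ⟩)
      S p q B = ∈⟨⟩-dec B p ×-dec ∈⟨⟩-dec B q

      blocks-distinct : AllPairs (λ B B′ → ¬ B ≑ B′) blocks
      blocks-distinct = UniqueDec.deduplicate-! ≑-decSetoid candidates

      -- Two pigeonholes. A block containing p and q comes from some line, and `consistent` finds it
      -- again in `through p q`; conversely each member of `through p q` has a representative among
      -- `blocks`, which contains p and q as well.
      through-length : ∀ {p q} → Line p q → length (filter (S p q) blocks) ≡ index
      through-length {p} {q} l = trans (ℕ.≤-antisym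
        (distinct-length-≤ (λ {x} {y} → ≑-sym {x} {y}) (λ {x} {y} {z} → ≑-trans {x} {y} {z})
            (AllPairs.filter⁺ (S p q) blocks-distinct) λ B∈ →
          let B∈b , p∈ , q∈ = ∈-filter⁻ (S p q) B∈
              _ , _ , l′ , B∈t = origin B∈b
          in consistent l′ l B∈t p∈ q∈)
        (distinct-length-≤ (λ {x} {y} → ≑-sym {x} {y}) (λ {x} {y} {z} → ≑-trans {x} {y} {z})
            (distinct l) λ {B} B∈ →
          let B′ , B′∈ , B≑B′ = find (present l B∈)
              p∈ , q∈ = contains l B∈
          in Any.map (λ { refl → B≑B′ })
               (∈-filter⁺ (S p q) B′∈ (proj₁ B≑B′ p∈ , proj₁ B≑B′ q∈)))) (many l)

    simpleDesign : Σ (PBD GF2 (proj₁ basis) K index) Simple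
    simpleDesign = record
      { V = asModule
      ; dimension = frame-dimension basis U ((λ {x} _ → basis-spanning x) , _) basis-independent
      ; size = length blocks
      ; block = λ i → toSubspace (List.lookup blocks i)
      ; blockDim = λ i → let B = List.lookup blocks i
                             _ , _ , l , B∈ = origin (∈-lookup i)
                             k∈K , ind = valid l B∈
                         in proj₁ B , k∈K , frame-dimension B _ (id , id) ind
      ; balanced = λ T dim → let p , q , l , eqv = basis-line T dim in
          exactlyMany-resp (λ i → eqv (List.lookup blocks i))
            (filter-exactlyMany (S p q) blocks (through-length l))
      } , λ i j eq → lookup-distinct (λ {x} {y} → ≑-sym {x} {y})
          (λ {x} {y} {z} → ≑-trans {x} {y} {z}) blocks-distinct eq

-- Additive, that is F₂-linear, maps and their action on frames.

Additive : (E E′ : BinarySpace) → (BinarySpace.Carrier E → BinarySpace.Carrier E′) → Set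
Additive E E′ f = ∀ x y → f (x E.+ y) ≡ f x E′.+ f y
  where
  module E = BinarySpace E
  module E′ = BinarySpace E′

module MapFrame {E E′ : BinarySpace} {f} (f-+ : Additive E E′ f) where
  private
    module E = BinarySpace E
    module E′ = BinarySpace E′
  open Span

  f-0 : f E.0# ≡ E′.0#
  f-0 = trans (cong f (sym (E.+-identityˡ E.0#))) (trans (f-+ E.0# E.0#) (E′.x+x≡0 _))

  f-comb : ∀ {k} c (vs : Vec E.Carrier k) → comb E′ c (Vec.map f vs) ≡ f (comb E c vs)
  f-comb []           []       = sym f-0
  f-comb (true ∷ cs)  (v ∷ vs) = trans (cong (f v E′.+_) (f-comb cs vs)) (sym (f-+ _ _))
  f-comb (false ∷ cs) (v ∷ vs) =
    trans (E′.+-identityˡ _) (trans (f-comb cs vs) (cong f (sym (E.+-identityˡ _))))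

  ∈-mapFrame⁺ : ∀ B {x} → _∈⟨_⟩ E x B → _∈⟨_⟩ E′ (f x) (mapFrame f B)
  ∈-mapFrame⁺ (k , vs) (c , refl) = c , f-comb c vs

  ∈-mapFrame⁻ : ∀ B {y} → _∈⟨_⟩ E′ y (mapFrame f B) → ∃ λ x → _∈⟨_⟩ E x B × y ≡ f x
  ∈-mapFrame⁻ (k , vs) (c , refl) = comb E c vs , (c , refl) , f-comb c vs

  mapFrame-≑ : ∀ {B B′} → _≑_ E B B′ → _≑_ E′ (mapFrame f B) (mapFrame f B′)
  mapFrame-≑ {B} {B′} (⊆ , ⊇) = half B B′ ⊆ , half B′ B ⊇
    where
    half : ∀ B B′ → (∀ {x} → _∈⟨_⟩ E x B → _∈⟨_⟩ E x B′) →
           ∀ {y} → _∈⟨_⟩ E′ y (mapFrame f B) → _∈⟨_⟩ E′ y (mapFrame f B′)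
    half B B′ sub y∈ with ∈-mapFrame⁻ B y∈
    ... | x , x∈ , refl = ∈-mapFrame⁺ B′ (sub x∈)

  module _ (f-kernel : ∀ {x} → f x ≡ E′.0# → x ≡ E.0#) where

    f-injective : ∀ {x y} → f x ≡ f y → x ≡ y
    f-injective {x} {y} eq = E.x+y≡0⇒x≡y (f-kernel (trans (f-+ x y)
      (trans (cong (E′._+ f y) eq) (E′.x+x≡0 _))))

    mapFrame-independent : ∀ {B} → Independent E B → Independent E′ (mapFrame f B)
    mapFrame-independent {k , vs} ind c eq = ind c (f-kernel (trans (sym (f-comb c vs)) eq))

    mapFrame-≑⁻ : ∀ {B B′} → _≑_ E′ (mapFrame f B) (mapFrame f B′) → _≑_ E B B′
    mapFrame-≑⁻ {B} {B′} (⊆ , ⊇) = half B B′ ⊆ , half B′ B ⊇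
      where
      half : ∀ B B′ → (∀ {y} → _∈⟨_⟩ E′ y (mapFrame f B) → _∈⟨_⟩ E′ y (mapFrame f B′)) →
             ∀ {x} → _∈⟨_⟩ E x B → _∈⟨_⟩ E x B′
      half B B′ sub x∈ with ∈-mapFrame⁻ B′ (sub (∈-mapFrame⁺ B x∈))
      ... | x′ , x′∈ , eq = subst (λ z → _∈⟨_⟩ E z B′) (sym (f-injective eq)) x′∈

map-distinct : ∀ {A B : Set} (_≈_ : B → B → Set) {f : A → B} {xs} →
  (∀ {x y} → x ∈ xs → y ∈ xs → f x ≈ f y → x ≡ y) → Unique xs → AllPairs (λ x y → ¬ x ≈ y) (map f xs)
map-distinct _≈_ inj []                   = []
map-distinct _≈_ {f} {x ∷ xs} inj (x∉ ∷ u) =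
  All.tabulate (λ y∈ eq → let _ , y′∈ , y≡ = ∈-map⁻ f y∈ in
    All.lookup x∉ y′∈ (inj (here refl) (there y′∈) (subst (f x ≈_) y≡ eq)))
  ∷ map-distinct _≈_ (λ x∈ y∈ → inj (there x∈) (there y∈)) u

-- Finite fields of characteristic two and vector spaces over them.

record BinaryField : Set₁ where
  infix 8 _⁻¹
  infixl 7 _*_
  infixl 6 _+_
  infix 4 _≟_
  field
    Carrier           : Set
    _+_ _*_           : Op₂ Carrier
    0# 1#             : Carrier
    isCommutativeRing : IsCommutativeRing _≡_ _+_ _*_ id 0# 1#
    1≢0               : 1# ≢ 0#
    _⁻¹               : Op₁ Carrier
    inverseʳ          : ∀ {x} → x ≢ 0# → x * x ⁻¹ ≡ 1#
    _≟_               : DecidableEquality Carrier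
    elements          : List Carrier
    complete          : ∀ x → x ∈ elements

  open IsCommutativeRing isCommutativeRing public
    using (*-assoc; *-comm; *-identityˡ; *-identityʳ; distribˡ; distribʳ; zeroˡ; zeroʳ; +-isAbelianGroup)

  space : BinarySpace
  space = record { isAbelianGroup = +-isAbelianGroup ; _≟_ = _≟_ }

  open BinarySpace space public
    using (+-assoc; +-comm; +-identityˡ; +-identityʳ; x+x≡0; +-cancelʳ; x+y≡0⇒x≡y)

  commutativeRing : CommutativeRing 0ℓ 0ℓ
  commutativeRing = record { isCommutativeRing = isCommutativeRing }

  private
    fromBool : Bool → Carrier
    fromBool false = 0#
    fromBool true  = 1#

    -- Taking the coefficients of the ring solver from F₂ makes it cancel equal terms, so that
    -- identities valid only in characteristic two are solved by `refl`.
    coefficients : CommutativeRing.rawRing Bool.xor-∧-commutativeRing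
                   -Raw-AlmostCommutative⟶ fromCommutativeRing commutativeRing
    coefficients = record
      { ⟦_⟧ = fromBool
      ; +-homo = λ { false y → sym (+-identityˡ _) ; true false → sym (+-identityʳ _)
                   ; true true → sym (x+x≡0 _) }
      ; *-homo = λ { false y → sym (zeroˡ _) ; true y → sym (*-identityˡ _) }
      ; -‿homo = λ _ → refl ; 0-homo = refl ; 1-homo = refl }

    fromBool-injective : ∀ {a b} → fromBool a ≡ fromBool b → a ≡ b
    fromBool-injective {false} {false} eq = refl
    fromBool-injective {false} {true}  eq = contradiction (sym eq) 1≢0
    fromBool-injective {true}  {false} eq = contradiction eq 1≢0
    fromBool-injective {true}  {true}  eq = refl

  module Solver = RingSolver (CommutativeRing.rawRing Bool.xor-∧-commutativeRing)
    (fromCommutativeRing commutativeRing) coefficients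
    (λ a b → dec⇒maybe (map′ (cong fromBool) fromBool-injective (a Bool.≟ b)))

  inverseˡ : ∀ {x} → x ≢ 0# → x ⁻¹ * x ≡ 1#
  inverseˡ x≢0 = trans (*-comm _ _) (inverseʳ x≢0)

  *-cancel : ∀ {x y} → x ≢ 0# → x ⁻¹ * (x * y) ≡ y
  *-cancel {x} {y} x≢0 = trans (sym (*-assoc _ _ _)) (trans (cong (_* y) (inverseˡ x≢0)) (*-identityˡ y))

  xy≡0⇒y≡0 : ∀ {x y} → x ≢ 0# → x * y ≡ 0# → y ≡ 0#
  xy≡0⇒y≡0 {x} x≢0 eq = trans (sym (*-cancel x≢0)) (trans (cong (x ⁻¹ *_) eq) (zeroʳ _))

  xy≢0 : ∀ {x y} → x ≢ 0# → y ≢ 0# → x * y ≢ 0#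
  xy≢0 x≢0 y≢0 eq = y≢0 (xy≡0⇒y≡0 x≢0 eq)

  ⁻¹≢0 : ∀ {x} → x ≢ 0# → x ⁻¹ ≢ 0#
  ⁻¹≢0 {x} x≢0 eq = 1≢0 (trans (sym (inverseʳ x≢0)) (trans (cong (x *_) eq) (zeroʳ x)))

  xx≡0⇒x≡0 : ∀ {x} → x * x ≡ 0# → x ≡ 0#
  xx≡0⇒x≡0 {x} eq with x ≟ 0#
  ... | yes x≡0 = x≡0
  ... | no x≢0  = xy≡0⇒y≡0 x≢0 eq

  -- Divided differences. After division by z the cubic `g` has the roots z₁, z₂, z₃, and `h` is its
  -- first divided difference. As `g` has no quadratic term, the second one is a (z₁ + z₂ + z₃); so
  -- a = 0 because the sum of the roots is nonzero, and then b = 0 and c = 0.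
  linearizedRoots : ∀ {a b c z₁ z₂ z₃} →
    z₁ ≢ 0# → z₂ ≢ 0# → z₃ ≢ 0# → z₁ + z₂ ≢ 0# → z₁ + z₃ ≢ 0# → z₂ + z₃ ≢ 0# → z₁ + z₂ + z₃ ≢ 0# →
    (∀ {z} → z ∈ z₁ ∷ z₂ ∷ z₃ ∷ [] → z * (a * (z * z * z) + b * z + c) ≡ 0#) →
    a ≡ 0# × b ≡ 0# × c ≡ 0#
  linearizedRoots {a} {b} {c} {z₁} {z₂} {z₃} n₁ n₂ n₃ n₁₂ n₁₃ n₂₃ n₁₂₃ root = a≡0 , b≡0 , c≡0
    where
    open Solver
    g : Carrier → Carrier
    g z = a * (z * z * z) + b * z + c
    h : Carrier → Carrier → Carrier
    h x y = a * (x * x + x * y + y * y) + b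
    g₁ : g z₁ ≡ 0#
    g₁ = xy≡0⇒y≡0 n₁ (root (here refl))
    g₂ : g z₂ ≡ 0#
    g₂ = xy≡0⇒y≡0 n₂ (root (there (here refl)))
    g₃ : g z₃ ≡ 0#
    g₃ = xy≡0⇒y≡0 n₃ (root (there (there (here refl))))
    difference : ∀ {x y} → x + y ≢ 0# → g x ≡ 0# → g y ≡ 0# → h x y ≡ 0#
    difference {x} {y} n gx gy = xy≡0⇒y≡0 n (trans
      (solve 5 (λ a b c x y → (x :+ y) :* (a :* (x :* x :+ x :* y :+ y :* y) :+ b) :=
        (a :* (x :* x :* x) :+ b :* x :+ c) :+ (a :* (y :* y :* y) :+ b :* y :+ c)) refl a b c x y)
      (trans (cong₂ _+_ gx gy) (+-identityˡ 0#)))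
    a≡0 : a ≡ 0#
    a≡0 = xy≡0⇒y≡0 (xy≢0 n₂₃ n₁₂₃) (trans
      (solve 5 (λ a b x y z → (y :+ z) :* (x :+ y :+ z) :* a :=
        (a :* (x :* x :+ x :* y :+ y :* y) :+ b) :+ (a :* (x :* x :+ x :* z :+ z :* z) :+ b)) refl a b z₁ z₂ z₃)
      (trans (cong₂ _+_ (difference n₁₂ g₁ g₂) (difference n₁₃ g₁ g₃)) (+-identityˡ 0#)))
    vanish : ∀ {x y e} → x ≡ 0# → x * y + e ≡ 0# → e ≡ 0#
    vanish {y = y} {e} refl eq = trans (sym (trans (cong (_+ e) (zeroˡ y)) (+-identityˡ e))) eq
    b≡0 : b ≡ 0#
    b≡0 = vanish a≡0 (difference n₁₂ g₁ g₂)
    c≡0 : c ≡ 0#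
    c≡0 = vanish b≡0 (vanish a≡0 (trans (sym (+-assoc _ _ _)) g₁))

record VectorSpaceOver (F : BinaryField) : Set₁ where
  private module F = BinaryField F
  field
    space : BinarySpace
  open BinarySpace space public
  infixr 7 _·_
  field
    _·_        : F.Carrier → Carrier → Carrier
    ·-distribˡ : ∀ a x y → a · (x + y) ≡ a · x + a · y
    ·-distribʳ : ∀ x a b → (a F.+ b) · x ≡ a · x + b · x
    ·-assoc    : ∀ a b x → (a F.* b) · x ≡ a · (b · x)
    ·-identity : ∀ x → F.1# · x ≡ x
    elements   : List Carrier
    complete   : ∀ x → x ∈ elements

  ·-zeroˡ : ∀ x → F.0# · x ≡ 0#
  ·-zeroˡ x = trans (cong (_· x) (sym (F.x+x≡0 F.0#))) (trans (·-distribʳ x _ _) (x+x≡0 _))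

  ·-zeroʳ : ∀ a → a · 0# ≡ 0#
  ·-zeroʳ a = trans (cong (a ·_) (sym (x+x≡0 0#))) (trans (·-distribˡ a _ _) (x+x≡0 _))

  ·-kernel : ∀ {a x} → x ≢ 0# → a · x ≡ 0# → a ≡ F.0#
  ·-kernel {a} {x} x≢0 eq with a F.≟ F.0#
  ... | yes a≡0 = a≡0
  ... | no a≢0  = contradiction (trans (sym (·-identity x)) (trans (cong (_· x) (sym (F.inverseˡ a≢0)))
          (trans (·-assoc _ _ _) (trans (cong (a F.⁻¹ ·_) eq) (·-zeroʳ _))))) x≢0

  -- The product of the row (a b) with the matrix of rows (c d) and (e f); the passages between the
  -- pairs (u , v) and (p , q) below are reduced to it.
  ·-combine : ∀ a b c d e f u v →
    a · (c · u + d · v) + b · (e · u + f · v) ≡ (a F.* c F.+ b F.* e) · u + (a F.* d F.+ b F.* f) · v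
  ·-combine a b c d e f u v = begin
    a · (c · u + d · v) + b · (e · u + f · v)
      ≡⟨ cong₂ _+_ (expand a c d) (expand b e f) ⟩
    ((a F.* c) · u + (a F.* d) · v) + ((b F.* e) · u + (b F.* f) · v)
      ≡⟨ +-interchange _ _ _ _ ⟩
    ((a F.* c) · u + (b F.* e) · u) + ((a F.* d) · v + (b F.* f) · v)
      ≡⟨ cong₂ _+_ (sym (·-distribʳ u _ _)) (sym (·-distribʳ v _ _)) ⟩
    (a F.* c F.+ b F.* e) · u + (a F.* d F.+ b F.* f) · v ∎
    where
    open ≡-Reasoning
    expand : ∀ a c d → a · (c · u + d · v) ≡ (a F.* c) · u + (a F.* d) · v
    expand a c d = trans (·-distribˡ a _ _) (sym (cong₂ _+_ (·-assoc a c u) (·-assoc a d v)))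

  Independent₂ : Carrier → Carrier → Set
  Independent₂ u v = ∀ {a b} → a · u + b · v ≡ 0# → a ≡ F.0# × b ≡ F.0#

  independent₂-≡ : ∀ {u v a b c d} → Independent₂ u v → a · u + b · v ≡ c · u + d · v → a ≡ c × b ≡ d
  independent₂-≡ {u} {v} {a} {b} {c} {d} ind eq =
    let p , q = ind {a F.+ c} {b F.+ d} (trans (cong₂ _+_ (·-distribʳ u a c) (·-distribʳ v b d))
                  (trans (+-interchange _ _ _ _) (trans (cong (_+ (c · u + d · v)) eq) (x+x≡0 _))))
    in F.x+y≡0⇒x≡y p , F.x+y≡0⇒x≡y q

-- The blocks inside a one-dimensional F-space that contain a fixed vector, described in F itself.
record Pencil (F : BinaryField) (K : List ℕ) (index : ℕ) : Set where
  open BinaryField F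
  open Span space
  field
    members  : List (Frame Carrier)
    valid    : ∀ {B} → B ∈ members → proj₁ B ∈ K × Independent B
    one      : ∀ {B} → B ∈ members → 1# ∈⟨ B ⟩
    distinct : AllPairs (λ B B′ → ¬ B ≑ B′) members
    closed   : ∀ {B y} → B ∈ members → y ∈⟨ B ⟩ → y ≢ 0# → Any (mapFrame (y ⁻¹ *_) B ≑_) members
    many     : ∀ {t} → t ≢ 0# → t ≢ 1# → length (filter (λ B → ∈⟨⟩-dec B t) members) ≡ index

-- The spaces U of the blocks {z u + z² v : z ∈ U} with u, v independent over F.
record Cores (F : BinaryField) (size : ℕ) : Set where
  open BinaryField F
  open Span space
  field
    cores       : List (Vec Carrier 3)
    independent : ∀ {B} → B ∈ cores → Independent (3 , B)
    unique      : Unique cores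
    rigid       : ∀ {B B′ c} → B ∈ cores → B′ ∈ cores → c ≢ 0# →
                  mapFrame (c *_) (3 , B) ≑ (3 , B′) → c ≡ 1# × B ≡ B′
    many        : length cores ≡ size

-- The design on V: blocks through dependent and through independent pairs.

module _ {F : BinaryField} (𝕍 : VectorSpaceOver F) {K : List ℕ} {s : ℕ} (3∈K : 3 ∈ K)
  (pencil : Pencil F K (42 ℕ.* s)) (coreFamily : Cores F s) where

  open BinaryField F
  open VectorSpaceOver 𝕍 using
    (_·_; ·-distribˡ; ·-distribʳ; ·-assoc; ·-identity; ·-zeroˡ; ·-zeroʳ; ·-kernel; ·-combine
    ; Independent₂; independent₂-≡)
  private
    module P = Pencil pencil
    module C = Cores coreFamily
    module V = VectorSpaceOver 𝕍
    module SF = Span space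
    module SV = Span V.space
  open SF using (comb)
  open SV using (_≑_; _∈⟨_⟩)

  private
    scale : V.Carrier → Carrier → V.Carrier
    scale p x = x · p

    module Scale (p : V.Carrier) = MapFrame {space} {V.space} {scale p} (λ a b → ·-distribʳ p a b)

    -- Two elements of this set are F-independent as soon as they are distinct and nonzero.
    curve : V.Carrier → V.Carrier → Carrier → V.Carrier
    curve u v z = z · u V.+ (z * z) · v

    curve-+ : ∀ u v → Additive space V.space (curve u v)
    curve-+ u v x y = trans
      (cong₂ V._+_ (·-distribʳ u x y) (trans (cong (_· v) (solve 2 (λ x y → (x :+ y) :* (x :+ y) := x :* x :+ y :* y) refl x y)) (·-distribʳ v _ _)))
      (V.+-interchange _ _ _ _)
      where open Solver

    module Curve u v = MapFrame {space} {V.space} {curve u v} (curve-+ u v)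

    module _ {u v} (ind : Independent₂ u v) where

      curve-kernel : ∀ {x} → curve u v x ≡ V.0# → x ≡ 0#
      curve-kernel eq = proj₁ (ind eq)

      curve-injective : ∀ {x y} → curve u v x ≡ curve u v y → x ≡ y
      curve-injective = Curve.f-injective u v curve-kernel

    -- The determinant x y² + x² y of the system p = x u + x² v, q = y u + y² v.
    Δ : Carrier → Carrier → Carrier
    Δ x y = x * y * (x + y)

    Δ≢0 : ∀ {x y} → x ≢ 0# → y ≢ 0# → x ≢ y → Δ x y ≢ 0#
    Δ≢0 x≢0 y≢0 x≢y = xy≢0 (xy≢0 x≢0 y≢0) (λ eq → x≢y (x+y≡0⇒x≡y eq))

    -- The unique u and v such that curve u v x ≡ p and curve u v y ≡ q.
    solveᵘ solveᵛ : Carrier → Carrier → V.Carrier → V.Carrier → V.Carrier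
    solveᵘ x y p q = (Δ x y ⁻¹ * (y * y)) · p V.+ (Δ x y ⁻¹ * (x * x)) · q
    solveᵛ x y p q = (Δ x y ⁻¹ * y) · p V.+ (Δ x y ⁻¹ * x) · q

    select₁ : ∀ {a b u v} → a ≡ 1# → b ≡ 0# → a · u V.+ b · v ≡ u
    select₁ {u = u} {v} refl refl =
      trans (cong₂ V._+_ (·-identity u) (·-zeroˡ v)) (V.+-identityʳ u)

    select₂ : ∀ {a b u v} → a ≡ 0# → b ≡ 1# → a · u V.+ b · v ≡ v
    select₂ {u = u} {v} refl refl =
      trans (cong₂ V._+_ (·-zeroˡ u) (·-identity v)) (V.+-identityˡ v)

    module _ {x y} (Δ≢ : Δ x y ≢ 0#) where
      open Solver
      private
        i = Δ x y ⁻¹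

        iΔ : ∀ {e} → e ≡ i * Δ x y → e ≡ 1#
        iΔ eq = trans eq (inverseˡ Δ≢)

      curve-solve-x : ∀ p q → curve (solveᵘ x y p q) (solveᵛ x y p q) x ≡ p
      curve-solve-x p q = trans (·-combine _ _ _ _ _ _ p q) (select₁
        (iΔ (solve 3 (λ i x y → x :* (i :* (y :* y)) :+ x :* x :* (i :* y) := i :* (x :* y :* (x :+ y))) refl i x y))
        (solve 2 (λ i x → x :* (i :* (x :* x)) :+ x :* x :* (i :* x) := con false) refl i x))

      curve-solve-y : ∀ p q → curve (solveᵘ x y p q) (solveᵛ x y p q) y ≡ q
      curve-solve-y p q = trans (·-combine _ _ _ _ _ _ p q) (select₂
        (solve 2 (λ i y → y :* (i :* (y :* y)) :+ y :* y :* (i :* y) := con false) refl i y)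
        (iΔ (solve 3 (λ i x y → y :* (i :* (x :* x)) :+ y :* y :* (i :* x) := i :* (x :* y :* (x :+ y))) refl i x y)))

      solveᵘ-unique : ∀ u v → solveᵘ x y (curve u v x) (curve u v y) ≡ u
      solveᵘ-unique u v = trans (·-combine _ _ _ _ _ _ u v) (select₁
        (iΔ (solve 3 (λ i x y → i :* (y :* y) :* x :+ i :* (x :* x) :* y := i :* (x :* y :* (x :+ y))) refl i x y))
        (solve 3 (λ i x y → i :* (y :* y) :* (x :* x) :+ i :* (x :* x) :* (y :* y) := con false) refl i x y))

      solveᵛ-unique : ∀ u v → solveᵛ x y (curve u v x) (curve u v y) ≡ v
      solveᵛ-unique u v = trans (·-combine _ _ _ _ _ _ u v) (select₂
        (solve 3 (λ i x y → i :* y :* x :+ i :* x :* y := con false) refl i x y)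
        (iΔ (solve 3 (λ i x y → i :* y :* (x :* x) :+ i :* x :* (y :* y) := i :* (x :* y :* (x :+ y))) refl i x y)))

      -- The coordinates α, β of a u + b v with respect to p, q vanish. Multiplying them back, x α +
      -- y β and x² α + y² β are Δ⁻¹ Δ a and Δ⁻¹ Δ b.
      solve-independent : ∀ {p q} → Independent₂ p q → Independent₂ (solveᵘ x y p q) (solveᵛ x y p q)
      solve-independent {p} {q} ind {a} {b} eq =
        let α≡0 , β≡0 = ind (trans (sym (·-combine a b _ _ _ _ p q)) eq) in
        recover {a} (solve 5 (λ a b i x y → x :* (a :* (i :* (y :* y)) :+ b :* (i :* y)) :+ y :* (a :* (i :* (x :* x)) :+ b :* (i :* x))
           := i :* (x :* y :* (x :+ y)) :* a) refl a b i x y) α≡0 β≡0 ,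
        recover {b} (solve 5 (λ a b i x y → x :* x :* (a :* (i :* (y :* y)) :+ b :* (i :* y)) :+ y :* y :* (a :* (i :* (x :* x)) :+ b :* (i :* x))
           := i :* (x :* y :* (x :+ y)) :* b) refl a b i x y) α≡0 β≡0
        where
        recover : ∀ {a x y α β} → x * α + y * β ≡ i * Δ _ _ * a → α ≡ 0# → β ≡ 0# → a ≡ 0#
        recover {a} {x} {y} eq refl refl = trans (sym (*-identityˡ a)) (trans (cong (_* a) (sym (inverseˡ Δ≢)))
          (trans (sym eq) (trans (cong₂ _+_ (zeroʳ x) (zeroʳ y)) (+-identityˡ 0#))))

    curve-⊆ : ∀ {u v u′ v′ A B C D z w} → Independent₂ u′ v′ →
      u ≡ A · u′ V.+ B · v′ → v ≡ C · u′ V.+ D · v′ → curve u v z ≡ curve u′ v′ w →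
      w ≡ z * A + z * z * C × w * w ≡ z * B + z * z * D
    curve-⊆ ind refl refl eq = let f , g = independent₂-≡ ind
                                     (trans (sym (·-combine _ _ _ _ _ _ _ _)) eq) in sym f , sym g

    independent-triple : ∀ {z₁ z₂ z₃} → SF.Independent (3 , z₁ ∷ z₂ ∷ z₃ ∷ []) →
      z₁ ≢ 0# × z₂ ≢ 0# × z₃ ≢ 0# × z₁ + z₂ ≢ 0# × z₁ + z₃ ≢ 0# × z₂ + z₃ ≢ 0# × z₁ + z₂ + z₃ ≢ 0#
    independent-triple {z₁} {z₂} {z₃} ind =
      refute (true ∷ false ∷ false ∷ []) (solve 1 (λ x → x :+ (con false :+ (con false :+ con false)) := x) refl z₁) (λ ()) ,
      refute (false ∷ true ∷ false ∷ []) (solve 1 (λ x → con false :+ (x :+ (con false :+ con false)) := x) refl z₂) (λ ()) ,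
      refute (false ∷ false ∷ true ∷ []) (solve 1 (λ x → con false :+ (con false :+ (x :+ con false)) := x) refl z₃) (λ ()) ,
      refute (true ∷ true ∷ false ∷ []) (solve 2 (λ x y → x :+ (y :+ (con false :+ con false)) := x :+ y) refl z₁ z₂) (λ ()) ,
      refute (true ∷ false ∷ true ∷ []) (solve 2 (λ x z → x :+ (con false :+ (z :+ con false)) := x :+ z) refl z₁ z₃) (λ ()) ,
      refute (false ∷ true ∷ true ∷ []) (solve 2 (λ y z → con false :+ (y :+ (z :+ con false)) := y :+ z) refl z₂ z₃) (λ ()) ,
      refute (true ∷ true ∷ true ∷ []) (solve 3 (λ x y z → x :+ (y :+ (z :+ con false)) := x :+ y :+ z) refl z₁ z₂ z₃) (λ ())
      where
      open Solver
      refute : ∀ c {z} → comb c (z₁ ∷ z₂ ∷ z₃ ∷ []) ≡ z → c ≢ 𝟘 → z ≢ 0#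
      refute c eq c≢0 z≡0 = c≢0 (ind c (trans eq z≡0))

    -- Membership of the points z of U gives w = zA + z²C and w² = zB + z²D with w in U′, so that the
    -- polynomial C²X⁴ + (A² + D)X² + BX vanishes on the three-dimensional space U.
    curve-rigid : ∀ {U U′ u v u′ v′} → U ∈ C.cores → U′ ∈ C.cores → Independent₂ u′ v′ → u ≢ V.0# →
      (∃₂ λ A B → u ≡ A · u′ V.+ B · v′) → (∃₂ λ C D → v ≡ C · u′ V.+ D · v′) →
      mapFrame (curve u v) (3 , U) ≑ mapFrame (curve u′ v′) (3 , U′) → U ≡ U′ × u ≡ u′ × v ≡ v′
    curve-rigid {U@(z₁ ∷ z₂ ∷ z₃ ∷ [])} {U′} {u} {v} {u′} {v′} U∈ U′∈ ind u≢0 (A , B , u≡) (C , D , v≡)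
        (⊆ , ⊇) =
      let A≡1 , U≡U′ = C.rigid U∈ U′∈ A≢0 AU≑U′ in
      U≡U′ , trans u≡ (select₁ A≡1 B≡0) ,
      trans v≡ (select₂ C≡0 (trans D≡A² (trans (cong₂ _*_ A≡1 A≡1) (*-identityˡ 1#))))
      where
      open Solver using (solve; _:+_; _:*_; _:=_)

      image : ∀ {z} → z SF.∈⟨ 3 , U ⟩ → ∃ λ w → w SF.∈⟨ 3 , U′ ⟩ × curve u v z ≡ curve u′ v′ w
      image z∈ = Curve.∈-mapFrame⁻ u′ v′ (3 , U′) (⊆ (Curve.∈-mapFrame⁺ u v (3 , U) z∈))

      root : ∀ {z} → z SF.∈⟨ 3 , U ⟩ → z * (C * C * (z * z * z) + (A * A + D) * z + B) ≡ 0#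
      root {z} z∈ with image z∈
      ... | w , _ , eq with curve-⊆ ind u≡ v≡ eq
      ... | w≡ , ww≡ = begin
        z * (C * C * (z * z * z) + (A * A + D) * z + B)
          ≡⟨ solve 5 (λ z A B C D → z :* (C :* C :* (z :* z :* z) :+ (A :* A :+ D) :* z :+ B)
               := (z :* A :+ z :* z :* C) :* (z :* A :+ z :* z :* C) :+ (z :* B :+ z :* z :* D)) refl z A B C D ⟩
        (z * A + z * z * C) * (z * A + z * z * C) + (z * B + z * z * D)
          ≡⟨ cong₂ _+_ (sym (cong₂ _*_ w≡ w≡)) (sym ww≡) ⟩
        w * w + w * w ≡⟨ x+x≡0 _ ⟩
        0# ∎
        where open ≡-Reasoning

      vanishing : C * C ≡ 0# × A * A + D ≡ 0# × B ≡ 0#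
      vanishing = let n₁ , n₂ , n₃ , n₁₂ , n₁₃ , n₂₃ , n₁₂₃ = independent-triple (C.independent U∈) in
        linearizedRoots n₁ n₂ n₃ n₁₂ n₁₃ n₂₃ n₁₂₃ (λ z∈ → root (VecAll.lookup (SF.generators∈ U) (listed z∈)))
        where
        listed : ∀ {z} → z ∈ z₁ ∷ z₂ ∷ z₃ ∷ [] → z VecMembership.∈ U
        listed (here eq)                  = VecAny.here eq
        listed (there (here eq))          = VecAny.there (VecAny.here eq)
        listed (there (there (here eq)))  = VecAny.there (VecAny.there (VecAny.here eq))

      -- Hence u = A u′ and v = A² v′: the two blocks can agree only through the substitution z ↦ A
      -- z. So A U = U′, and rigidity of the cores leaves A = 1.
      C≡0 : C ≡ 0#
      C≡0 = xx≡0⇒x≡0 (proj₁ vanishing)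
      B≡0 : B ≡ 0#
      B≡0 = proj₂ (proj₂ vanishing)
      D≡A² : D ≡ A * A
      D≡A² = sym (x+y≡0⇒x≡y (proj₁ (proj₂ vanishing)))

      A≢0 : A ≢ 0#
      A≢0 A≡0 = u≢0 (trans u≡ (trans (cong₂ V._+_ (trans (cong (_· u′) A≡0) (·-zeroˡ u′))
        (trans (cong (_· v′) B≡0) (·-zeroˡ v′))) (V.+-identityˡ V.0#)))

      w≡Az : ∀ {z w} → curve u v z ≡ curve u′ v′ w → w ≡ A * z
      w≡Az {z} eq = trans (proj₁ (curve-⊆ ind u≡ v≡ eq)) (trans
        (cong (λ c → z * A + z * z * c) C≡0) (trans (cong (z * A +_) (zeroʳ _))
            (trans (+-identityʳ _) (*-comm z A))))

      module Mult = MapFrame {space} {space} {A *_} (distribˡ A)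

      AU≑U′ : mapFrame (A *_) (3 , U) SF.≑ (3 , U′)
      AU≑U′ = ⊆′ , ⊇′
        where
        ⊆′ : ∀ {x} → x SF.∈⟨ mapFrame (A *_) (3 , U) ⟩ → x SF.∈⟨ 3 , U′ ⟩
        ⊆′ x∈ with Mult.∈-mapFrame⁻ (3 , U) x∈
        ... | z , z∈ , refl = let w , w∈ , eq = image z∈ in subst (SF._∈⟨ 3 , U′ ⟩) (w≡Az eq) w∈
        ⊇′ : ∀ {x} → x SF.∈⟨ 3 , U′ ⟩ → x SF.∈⟨ mapFrame (A *_) (3 , U) ⟩
        ⊇′ w∈ with Curve.∈-mapFrame⁻ u v (3 , U) (⊇ (Curve.∈-mapFrame⁺ u′ v′ (3 , U′) w∈))
        ... | z , z∈ , eq = subst (SF._∈⟨ mapFrame (A *_) (3 , U) ⟩) (sym (w≡Az (sym eq)))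
                              (Mult.∈-mapFrame⁺ (3 , U) z∈)

    flag? : (cd : Bits 3 × Bits 3) → Dec (proj₁ cd ≢ 𝟘 × proj₂ cd ≢ 𝟘 × proj₁ cd ≢ proj₂ cd)
    flag? (c , d) = ¬? (c ≟ᵇ 𝟘) ×-dec ¬? (d ≟ᵇ 𝟘) ×-dec ¬? (c ≟ᵇ d)
      where _≟ᵇ_ = Vec.≡-dec Bool._≟_

    -- The origin of 42 = 7 · 6: the ordered pairs of distinct nonzero elements of a core, written
    -- in coordinates so that one list serves all cores. Its length is found by evaluation in
    -- `many`.
    flags : List (Bits 3 × Bits 3)
    flags = filter flag? (cartesianProduct (allBits 3) (allBits 3))

    -- The block in which p and q have the parameters x and y, the elements of U with coordinates c
    -- and d.
    transversal : V.Carrier → V.Carrier → Vec Carrier 3 × Bits 3 × Bits 3 → Frame V.Carrier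
    transversal p q (U , c , d) = mapFrame (curve (solveᵘ x y p q) (solveᵛ x y p q)) (3 , U)
      where
      x = comb c U
      y = comb d U

    Dependent : V.Carrier → V.Carrier → Set
    Dependent p q = ∃ λ t → q ≡ t · p

    dependent? : ∀ p q → Dec (Dependent p q)
    dependent? p q = map′ (λ any → let t , _ , eq = find any in t , eq) (λ (t , eq) → lose (complete t) eq)
      (Any.any? (λ t → q V.≟ t · p) elements)

    -- The decision is an argument, so that the proofs below can split on it directly. If q = t p,
    -- then D p contains both vectors for exactly those pencil members D that contain t, as each of
    -- them contains 1.
    throughCase : ∀ p q → Dec (Dependent p q) → List (Frame V.Carrier)
    throughCase p q (yes (t , _)) = map (mapFrame (scale p)) (filter (λ B → SF.∈⟨⟩-dec B t) P.members)
    throughCase p q (no _)        = map (transversal p q) (cartesianProduct C.cores flags)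

    through : V.Carrier → V.Carrier → List (Frame V.Carrier)
    through p q = throughCase p q (dependent? p q)

    Line : V.Carrier → V.Carrier → Set
    Line p q = p ≢ V.0# × q ≢ V.0# × p ≢ q

    ratio-proper : ∀ {p q t} → Line p q → q ≡ t · p → t ≢ 0# × t ≢ 1#
    ratio-proper {p} (_ , q≢0 , p≢q) q≡ =
      (λ { refl → q≢0 (trans q≡ (·-zeroˡ p)) }) , (λ { refl → p≢q (sym (trans q≡ (·-identity p))) })

    scale-kernel : ∀ {p} → p ≢ V.0# → ∀ {x} → scale p x ≡ V.0# → x ≡ 0#
    scale-kernel p≢0 = ·-kernel p≢0

    independent-line : ∀ {p q} → p ≢ V.0# → ¬ Dependent p q → Independent₂ p q
    independent-line {p} {q} p≢0 ¬dep {a} {b} eq with b ≟ 0#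
    ... | yes refl = ·-kernel p≢0 (trans (sym (trans (cong (a · p V.+_) (·-zeroˡ q))
        (V.+-identityʳ _))) eq) , refl
    ... | no b≢0   = contradiction (b ⁻¹ * a , (begin
      q                   ≡⟨ ·-identity q ⟨
      1# · q              ≡⟨ cong (_· q) (inverseˡ b≢0) ⟨
      (b ⁻¹ * b) · q      ≡⟨ ·-assoc _ _ _ ⟩
      b ⁻¹ · (b · q)      ≡⟨ cong (b ⁻¹ ·_) (sym (V.x+y≡0⇒x≡y eq)) ⟩
      b ⁻¹ · (a · p)      ≡⟨ ·-assoc _ _ _ ⟨
      (b ⁻¹ * a) · p      ∎)) ¬dep
      where open ≡-Reasoning

    independent₂-≢0 : ∀ {u v} → Independent₂ u v → u ≢ V.0#
    independent₂-≢0 {u} {v} ind refl = 1≢0 (proj₁ (ind {1#} {0#} (trans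
      (cong₂ V._+_ (·-zeroʳ 1#) (·-zeroˡ v)) (V.+-identityˡ V.0#))))

    module Flag {U c d} (U∈ : U ∈ C.cores) (cd∈ : (c , d) ∈ flags) where
      x y : Carrier
      x = comb c U
      y = comb d U

      private
        proper = proj₂ (∈-filter⁻ flag? {xs = cartesianProduct (allBits 3) (allBits 3)} cd∈)

      x≢0 : x ≢ 0#
      x≢0 eq = proj₁ proper (C.independent U∈ c eq)
      y≢0 : y ≢ 0#
      y≢0 eq = proj₁ (proj₂ proper) (C.independent U∈ d eq)
      x≢y : x ≢ y
      x≢y eq = proj₂ (proj₂ proper) (SF.comb-injective {3 , U} (C.independent U∈) eq)

      nonsingular : Δ x y ≢ 0#
      nonsingular = Δ≢0 x≢0 y≢0 x≢y

    flag∈ : ∀ {U c d} → comb c U ≢ 0# → comb d U ≢ 0# → comb c U ≢ comb d U → (c , d) ∈ flags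
    flag∈ {U} {c} {d} x≢0 y≢0 x≢y = ∈-filter⁺ flag? (∈-cartesianProduct⁺ (∈-allBits c) (∈-allBits d))
      ((λ { refl → x≢0 (SF.comb-𝟘 U) }) , (λ { refl → y≢0 (SF.comb-𝟘 U) }) , (λ { refl → x≢y refl }))

    -- Both blocks contain p and q, so u and v, being combinations of p and q, are combinations of
    -- u′ and v′ (`express`). This is the input of `curve-rigid`. Once U, u, v agree, c and d are
    -- the coordinates of the parameters of p and q on a single injective curve.
    transversal-injective : ∀ {p q} → Independent₂ p q → ∀ {ξ ξ′} →
      ξ ∈ cartesianProduct C.cores flags → ξ′ ∈ cartesianProduct C.cores flags →
      transversal p q ξ ≑ transversal p q ξ′ → ξ ≡ ξ′
    transversal-injective {p} {q} ind {U , c , d} {U′ , c′ , d′} ξ∈ ξ′∈ eq =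
      let U∈ , cd∈ = ∈-cartesianProduct⁻ C.cores flags ξ∈
          U′∈ , cd′∈ = ∈-cartesianProduct⁻ C.cores flags ξ′∈
      in go U∈ cd∈ U′∈ cd′∈
      where
      go : U ∈ C.cores → (c , d) ∈ flags → U′ ∈ C.cores → (c′ , d′) ∈ flags → (U , c , d) ≡ (U′ , c′ , d′)
      go U∈ cd∈ U′∈ cd′∈ = conclude (curve-rigid U∈ U′∈ (solve-independent N′.nonsingular ind)
          (independent₂-≢0 (solve-independent N.nonsingular ind))
          (express (Δ N.x N.y ⁻¹ * (N.y * N.y)) (Δ N.x N.y ⁻¹ * (N.x * N.x)))
          (express (Δ N.x N.y ⁻¹ * N.y) (Δ N.x N.y ⁻¹ * N.x)) eq)
        where
        module N = Flag U∈ cd∈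
        module N′ = Flag U′∈ cd′∈
        u′ = solveᵘ N′.x N′.y p q
        v′ = solveᵛ N′.x N′.y p q

        express : ∀ a b → ∃₂ λ e f → a · p V.+ b · q ≡ e · u′ V.+ f · v′
        express a b = _ , _ , trans
          (sym (cong₂ (λ s t → a · s V.+ b · t) (curve-solve-x N′.nonsingular p q)
              (curve-solve-y N′.nonsingular p q)))
          (·-combine a b _ _ _ _ u′ v′)

        conclude : U ≡ U′ × solveᵘ N.x N.y p q ≡ u′ × solveᵛ N.x N.y p q ≡ v′ → (U , c , d) ≡ (U′ , c′ , d′)
        conclude (refl , u≡ , v≡) = cong₂ (λ c d → U , c , d)
          (inj (trans (curve-solve-x N.nonsingular p q)
            (trans (sym (curve-solve-x N′.nonsingular p q)) (sym (same N′.x)))))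
          (inj (trans (curve-solve-y N.nonsingular p q)
            (trans (sym (curve-solve-y N′.nonsingular p q)) (sym (same N′.y)))))
          where
          same : ∀ z → curve (solveᵘ N.x N.y p q) (solveᵛ N.x N.y p q) z ≡ curve u′ v′ z
          same z = cong₂ (λ u v → curve u v z) u≡ v≡
          inj : ∀ {c c′} → curve (solveᵘ N.x N.y p q) (solveᵛ N.x N.y p q) (comb c U) ≡
                           curve (solveᵘ N.x N.y p q) (solveᵛ N.x N.y p q) (comb c′ U) → c ≡ c′
          inj eq = SF.comb-injective {3 , U} (C.independent U∈)
            (curve-injective (solve-independent N.nonsingular ind) eq)

    valid : ∀ {p q} → Line p q → ∀ {B} → B ∈ through p q → proj₁ B ∈ K × SV.Independent B
    valid {p} {q} (p≢0 , _) = go (dependent? p q)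
      where
      go : ∀ d {B} → B ∈ throughCase p q d → proj₁ B ∈ K × SV.Independent B
      go (yes (t , _)) B∈ with ∈-map⁻ _ B∈
      ... | D , D∈ , refl = let k∈K , ind = P.valid (proj₁ (∈-filter⁻ (λ B → SF.∈⟨⟩-dec B t) D∈)) in
        k∈K , Scale.mapFrame-independent p (scale-kernel p≢0) {D} ind
      go (no ¬dep) B∈ with ∈-map⁻ (transversal p q) B∈
      ... | (U , c , d) , ξ∈ , refl = let U∈ , cd∈ = ∈-cartesianProduct⁻ C.cores flags ξ∈ in
        3∈K , Curve.mapFrame-independent _ _
          (curve-kernel (solve-independent (Flag.nonsingular U∈ cd∈) (independent-line p≢0 ¬dep)))
          {3 , U} (C.independent U∈)

    contains : ∀ {p q} → Line p q → ∀ {B} → B ∈ through p q → p ∈⟨ B ⟩ × q ∈⟨ B ⟩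
    contains {p} {q} (p≢0 , _) = go (dependent? p q)
      where
      go : ∀ d {B} → B ∈ throughCase p q d → p ∈⟨ B ⟩ × q ∈⟨ B ⟩
      go (yes (t , q≡)) B∈ with ∈-map⁻ _ B∈
      ... | D , D∈ , refl = let D∈P , t∈ = ∈-filter⁻ (λ B → SF.∈⟨⟩-dec B t) D∈ in
        subst (_∈⟨ mapFrame (scale p) D ⟩) (·-identity p) (Scale.∈-mapFrame⁺ p D (P.one D∈P)) ,
        subst (_∈⟨ mapFrame (scale p) D ⟩) (sym q≡) (Scale.∈-mapFrame⁺ p D t∈)
      go (no ¬dep) B∈ with ∈-map⁻ (transversal p q) B∈
      ... | ξ@(U , c , d) , ξ∈ , refl = let U∈ , cd∈ = ∈-cartesianProduct⁻ C.cores flags ξ∈ in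
        subst (_∈⟨ transversal p q ξ ⟩) (curve-solve-x (Flag.nonsingular U∈ cd∈) p q)
          (Curve.∈-mapFrame⁺ _ _ (3 , U) (c , refl)) ,
        subst (_∈⟨ transversal p q ξ ⟩) (curve-solve-y (Flag.nonsingular U∈ cd∈) p q)
          (Curve.∈-mapFrame⁺ _ _ (3 , U) (d , refl))

    distinct : ∀ {p q} → Line p q → AllPairs (λ B B′ → ¬ B ≑ B′) (through p q)
    distinct {p} {q} (p≢0 , _) = go (dependent? p q)
      where
      go : ∀ d → AllPairs (λ B B′ → ¬ B ≑ B′) (throughCase p q d)
      go (yes (t , _)) = AllPairs.map⁺ (AllPairs.map
        (λ {B} {B′} B≉B′ eq → B≉B′ (Scale.mapFrame-≑⁻ p (scale-kernel p≢0) {B} {B′} eq))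
        (AllPairs.filter⁺ (λ B → SF.∈⟨⟩-dec B t) P.distinct))
      go (no ¬dep) = map-distinct _≑_ (transversal-injective (independent-line p≢0 ¬dep))
        (Unique.cartesianProduct⁺ C.unique
          (Unique.filter⁺ flag? (Unique.cartesianProduct⁺ (allBits-unique 3) (allBits-unique 3))))

    length-cartesianProduct : ∀ {A B : Set} (xs : List A) (ys : List B) →
      length (cartesianProduct xs ys) ≡ length xs ℕ.* length ys
    length-cartesianProduct []       ys = refl
    length-cartesianProduct (x ∷ xs) ys = trans (length-++ (map (x ,_) ys))
      (cong₂ ℕ._+_ (length-map _ ys) (length-cartesianProduct xs ys))

    many : ∀ {p q} → Line p q → length (through p q) ≡ 42 ℕ.* s
    many {p} {q} l@(p≢0 , _) = go (dependent? p q)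
      where
      go : ∀ d → length (throughCase p q d) ≡ 42 ℕ.* s
      go (yes (t , q≡)) = let t≢0 , t≢1 = ratio-proper l q≡ in
        trans (length-map (mapFrame (scale p)) (filter (λ B → SF.∈⟨⟩-dec B t) P.members)) (P.many t≢0 t≢1)
      go (no ¬dep) = trans (length-map _ (cartesianProduct C.cores flags))
          (trans (length-cartesianProduct C.cores flags)
        (trans (cong (ℕ._* 42) C.many) (ℕ.*-comm s 42)))

    consistent : ∀ {p q p′ q′ B} → Line p q → Line p′ q′ → B ∈ through p q →
                 p′ ∈⟨ B ⟩ → q′ ∈⟨ B ⟩ → Any (B ≑_) (through p′ q′)
    consistent {p} {q} {p′} {q′} (p≢0 , _) (p′≢0 , q′≢0 , p′≢q′) = go (dependent? p q) (dependent? p′ q′)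
      where
      go : ∀ d d′ {B} → B ∈ throughCase p q d → p′ ∈⟨ B ⟩ → q′ ∈⟨ B ⟩ → Any (B ≑_) (throughCase p′ q′ d′)
      go (yes (t , _)) d′ B∈ p′∈ q′∈ with ∈-map⁻ _ B∈
      ... | D , D∈ , refl with Scale.∈-mapFrame⁻ p D p′∈ | Scale.∈-mapFrame⁻ p D q′∈
      ... | y , y∈ , refl | z , z∈ , refl = again d′
        where
        y≢0 : y ≢ 0#
        y≢0 refl = p′≢0 (·-zeroˡ p)

        ratio : ∀ {t′} → z · p ≡ t′ · (y · p) → t′ ≡ y ⁻¹ * z
        ratio {t′} eq = trans (sym (*-cancel y≢0)) (cong (y ⁻¹ *_) (trans (*-comm y t′)
          (sym (Scale.f-injective p (scale-kernel p≢0) (trans eq (sym (·-assoc t′ y p)))))))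

        module Mult = MapFrame {space} {space} {y ⁻¹ *_} (distribˡ (y ⁻¹))

        -- D p = (y⁻¹ D)(y p): changing the reference vector from p to p′ = y p divides D by y, and
        -- `closed` provides y⁻¹ D as a pencil member.
        rescale : mapFrame (scale (y · p)) (mapFrame (y ⁻¹ *_) D) ≡ mapFrame (scale p) D
        rescale = cong (proj₁ D ,_) (trans (sym (Vec.map-∘ _ _ _)) (Vec.map-cong
          (λ x → trans (sym (·-assoc _ _ _)) (cong (_· p) (trans (*-assoc _ _ _)
            (trans (cong (y ⁻¹ *_) (*-comm x y)) (*-cancel y≢0))))) _))

        again : ∀ d′ → Any (mapFrame (scale p) D ≑_) (throughCase (y · p) (z · p) d′)
        again (no ¬dep) = contradiction (y ⁻¹ * z , trans (cong (_· p) (sym (trans (*-assoc _ _ _)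
          (trans (cong (y ⁻¹ *_) (*-comm z y)) (*-cancel y≢0))))) (·-assoc _ _ _)) ¬dep
        again (yes (t′ , eq)) with find (P.closed (proj₁ (∈-filter⁻ (λ B → SF.∈⟨⟩-dec B t) D∈)) y∈ y≢0)
        ... | D′ , D′∈ , D≑D′ = lose
          (∈-map⁺ (mapFrame (scale (y · p))) (∈-filter⁺ (λ B → SF.∈⟨⟩-dec B t′) D′∈
            (proj₁ D≑D′ (subst (SF._∈⟨ mapFrame (y ⁻¹ *_) D ⟩) (sym (ratio eq)) (Mult.∈-mapFrame⁺ D z∈)))))
          (subst (_≑ mapFrame (scale (y · p)) D′) rescale
            (Scale.mapFrame-≑ (y · p) {mapFrame (y ⁻¹ *_) D} {D′} D≑D′))
      go (no ¬dep) d′ B∈ p′∈ q′∈ with ∈-map⁻ (transversal p q) B∈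
      ... | ξ@(U , c , d) , ξ∈ , refl with Curve.∈-mapFrame⁻ (proj₁ (uv ξ)) (proj₂ (uv ξ))
          (3 , U) p′∈ | Curve.∈-mapFrame⁻ (proj₁ (uv ξ)) (proj₂ (uv ξ)) (3 , U) q′∈
        where
        uv : Vec Carrier 3 × Bits 3 × Bits 3 → V.Carrier × V.Carrier
        uv (U , c , d) = solveᵘ (comb c U) (comb d U) p q , solveᵛ (comb c U) (comb d U) p q
      ... | _ , (c′ , refl) , refl | _ , (d′₁ , refl) , refl = again d′
        where
        U∈ = proj₁ (∈-cartesianProduct⁻ C.cores flags ξ∈)
        cd∈ = proj₂ (∈-cartesianProduct⁻ C.cores flags ξ∈)
        u = solveᵘ (comb c U) (comb d U) p q
        v = solveᵛ (comb c U) (comb d U) p q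
        x = comb c′ U
        y = comb d′₁ U

        ind : Independent₂ u v
        ind = solve-independent (Flag.nonsingular U∈ cd∈) (independent-line p≢0 ¬dep)

        x≢0 : x ≢ 0#
        x≢0 eq = p′≢0 (trans (cong (curve u v) eq) (Curve.f-0 u v))
        y≢0 : y ≢ 0#
        y≢0 eq = q′≢0 (trans (cong (curve u v) eq) (Curve.f-0 u v))
        x≢y : x ≢ y
        x≢y eq = p′≢q′ (cong (curve u v) eq)

        -- Comparing coordinates gives y = t x and y² = t x², hence t² x² = t x² and t (t + 1) = 0.
        -- Since t ≠ 0 this leaves t = 1, that is y = x.
        still-independent : ¬ Dependent (curve u v x) (curve u v y)
        still-independent (t , eq) = x≢y (sym (begin
          y ≡⟨ y≡tx ⟩ t * x ≡⟨ cong (_* x) t≡1 ⟩ 1# * x ≡⟨ *-identityˡ x ⟩ x ∎))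
          where
          open ≡-Reasoning
          coordinates : y ≡ t * x × y * y ≡ t * (x * x)
          coordinates = independent₂-≡ ind (trans eq (trans (·-distribˡ t _ _)
            (sym (cong₂ V._+_ (·-assoc t x u) (·-assoc t (x * x) v)))))
          y≡tx = proj₁ coordinates
          t≢0 : t ≢ 0#
          t≢0 refl = y≢0 (trans y≡tx (zeroˡ x))
          t≡1 : t ≡ 1#
          t≡1 = x+y≡0⇒x≡y (xy≡0⇒y≡0 (xy≢0 t≢0 (xy≢0 x≢0 x≢0)) (trans
            (Solver.solve 2 (λ t x → t Solver.:* (x Solver.:* x) Solver.:* (t Solver.:+ Solver.con true) Solver.:=
               t Solver.:* x Solver.:* (t Solver.:* x) Solver.:+ t Solver.:* (x Solver.:* x)) refl t x)
            (trans (cong₂ _+_ (sym (cong₂ _*_ y≡tx y≡tx)) (sym (proj₂ coordinates))) (x+x≡0 _))))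

        again : ∀ d′ → Any (transversal p q ξ ≑_) (throughCase (curve u v x) (curve u v y) d′)
        again (yes dep) = contradiction dep still-independent
        again (no _) = lose
          (∈-map⁺ (transversal (curve u v x) (curve u v y)) (∈-cartesianProduct⁺ U∈
              (flag∈ {U} {c′} {d′₁} x≢0 y≢0 x≢y)))
          -- Solving the system for two points of the curve of u and v returns u and v, so the frame
          -- found at the new line is the old one.
          (subst₂ (λ u₁ v₁ → mapFrame (curve u v) (3 , U) ≑ mapFrame (curve u₁ v₁) (3 , U))
            (sym (solveᵘ-unique nonsingular u v)) (sym (solveᵛ-unique nonsingular u v))
                (SV.≑-refl {mapFrame (curve u v) (3 , U)}))
          where nonsingular = Δ≢0 x≢0 y≢0 x≢y

  -- The one-dimensional F-spaces form a Desarguesian spread of V, whence the name. The given basis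
  -- is one over F₂ and fixes the dimension of the design.
  desarguesianDesign : (basis : Frame V.Carrier) → SV.Independent basis → (∀ x → x ∈⟨ basis ⟩) →
    Σ (PBD GF2 (proj₁ basis) K (42 ℕ.* s)) Simple
  desarguesianDesign basis independent spanning =
    FromPencils.simpleDesign V.space V.elements V.complete basis independent spanning K (42 ℕ.* s) through
      valid contains distinct many consistent

-- Radix trees

data Trie (A : Set) : ℕ → Set where
  leaf : A → Trie A 0
  node : ∀ {n} → Trie A n → Trie A n → Trie A (suc n)

lookupTrie : ∀ {A n} → Trie A n → Bits n → A
lookupTrie (leaf x)   []          = x
lookupTrie (node l r) (false ∷ v) = lookupTrie l v
lookupTrie (node l r) (true ∷ v)  = lookupTrie r v

memo : ∀ {A : Set} {n} → (Bits n → A) → Trie A n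
memo {n = zero}  f = leaf (f [])
memo {n = suc n} f = node (memo (λ v → f (false ∷ v))) (memo (λ v → f (true ∷ v)))

lookup-memo : ∀ {A : Set} {n} (f : Bits n → A) v → lookupTrie (memo f) v ≡ f v
lookup-memo f []          = refl
lookup-memo f (false ∷ v) = lookup-memo (λ v → f (false ∷ v)) v
lookup-memo f (true ∷ v)  = lookup-memo (λ v → f (true ∷ v)) v

-- Applying memoized f to several arguments evaluates each entry of the table only once.
memoized : ∀ {A : Set} {n} → (Bits n → A) → Bits n → A
memoized f = share (memo f)
  where
  share : ∀ {A n} → Trie A n → Bits n → A
  share t = λ v → lookupTrie t v

memoized≡ : ∀ {A : Set} {n} (f : Bits n → A) v → memoized f v ≡ f v
memoized≡ = lookup-memo

-- Concrete spaces, their coordinates and enumerations.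

powerSpace : BinarySpace → ℕ → BinarySpace
powerSpace E n = record
  { Carrier = Vec Carrier n ; _+_ = zipWith _+_ ; 0# = replicate n 0#
  ; isAbelianGroup = record
    { isGroup = record
      { isMonoid = record
        { isSemigroup = record
          { isMagma = isMagma _ ; assoc = Vec.zipWith-assoc +-assoc }
        ; identity = Vec.zipWith-identityˡ +-identityˡ , Vec.zipWith-identityʳ +-identityʳ }
      ; inverse = self , self
      ; ⁻¹-cong = id }
    ; comm = Vec.zipWith-comm +-comm }
  ; _≟_ = Vec.≡-dec _≟_ }
  where
  open BinarySpace E
  self : ∀ {n} (v : Vec Carrier n) → zipWith _+_ v v ≡ replicate n 0#
  self []      = refl
  self (x ∷ v) = cong₂ _∷_ (x+x≡0 x) (self v)

bitSpace : ℕ → BinarySpace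
bitSpace n = record
  { Carrier = Bits n ; _+_ = _⊕_ ; 0# = 𝟘
  ; isAbelianGroup = record
    { isGroup = record
      { isMonoid = record
        { isSemigroup = record { isMagma = isMagma _ ; assoc = ⊕-assoc }
        ; identity = ⊕-identityˡ , λ a → trans (⊕-comm a 𝟘) (⊕-identityˡ a) }
      ; inverse = ⊕-inverse , ⊕-inverse
      ; ⁻¹-cong = id }
    ; comm = ⊕-comm }
  ; _≟_ = Vec.≡-dec Bool._≟_ }
  where
  ⊕-assoc : ∀ {n} (a b c : Bits n) → a ⊕ b ⊕ c ≡ a ⊕ (b ⊕ c)
  ⊕-assoc []       []       []       = refl
  ⊕-assoc (x ∷ as) (y ∷ bs) (z ∷ cs) = cong₂ _∷_ (Bool.xor-assoc x y z) (⊕-assoc as bs cs)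
  ⊕-comm : ∀ {n} (a b : Bits n) → a ⊕ b ≡ b ⊕ a
  ⊕-comm []       []       = refl
  ⊕-comm (x ∷ as) (y ∷ bs) = cong₂ _∷_ (Bool.xor-comm x y) (⊕-comm as bs)
  ⊕-identityˡ : ∀ {n} (a : Bits n) → 𝟘 ⊕ a ≡ a
  ⊕-identityˡ []       = refl
  ⊕-identityˡ (x ∷ as) = cong (x ∷_) (⊕-identityˡ as)
  ⊕-inverse : ∀ {n} (a : Bits n) → a ⊕ a ≡ 𝟘
  ⊕-inverse []       = refl
  ⊕-inverse (x ∷ as) = cong₂ _∷_ (Bool.xor-same x) (⊕-inverse as)

∀Bits? : ∀ {n} {P : Bits n → Set} → Decidable P → Dec (∀ c → P c)
∀Bits? P? = map′ (λ all c → All.lookup all (∈-allBits c)) (λ all → All.universal all _)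
    (All.all? P? (allBits _))

vectors : ∀ {A : Set} → List A → ∀ n → List (Vec A n)
vectors xs zero    = [] ∷ []
vectors xs (suc n) = cartesianProductWith _∷_ xs (vectors xs n)

∈-vectors : ∀ {A : Set} {xs : List A} → (∀ x → x ∈ xs) → ∀ {n} (v : Vec A n) → v ∈ vectors xs n
∈-vectors complete []      = here refl
∈-vectors complete (x ∷ v) = ∈-cartesianProductWith⁺ _∷_ (complete x) (∈-vectors complete v)

record Coordinates (E : BinarySpace) (k : ℕ) : Set where
  open BinarySpace E
  open Span E
  field
    frame      : Vec Carrier k
    coordinate : Carrier → Bits k
    comb∘coordinate : ∀ x → comb (coordinate x) frame ≡ x
    coordinate∘comb : ∀ c → coordinate (comb c frame) ≡ c

  frame-independent : Independent (k , frame)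
  frame-independent c eq = trans (sym (coordinate∘comb c))
    (trans (cong coordinate (trans eq (sym (comb-𝟘 frame)))) (coordinate∘comb 𝟘))

  frame-spanning : ∀ x → x ∈⟨ k , frame ⟩
  frame-spanning x = coordinate x , comb∘coordinate x

bitCoordinates : ∀ n → Coordinates (bitSpace n) n
bitCoordinates n = record
  { frame = units n ; coordinate = id ; comb∘coordinate = comb-units ; coordinate∘comb = comb-units }
  where
  open Span
  units : ∀ n → Vec (Bits n) n
  units zero    = []
  units (suc n) = (true ∷ 𝟘) ∷ Vec.map (false ∷_) (units n)
  comb-units : ∀ {n} (c : Bits n) → comb (bitSpace n) c (units n) ≡ c
  comb-units []      = refl
  comb-units {suc n} (b ∷ c) = trans
    (cong (λ v → _∙_ (bitSpace (suc n)) b (true ∷ 𝟘) ⊕ v) (trans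
      (MapFrame.f-comb {bitSpace n} {bitSpace (suc n)} {false ∷_} (λ _ _ → refl) c (units n))
      (cong (false ∷_) (comb-units c))))
    (head b)
    where
    head : ∀ b → _∙_ (bitSpace (suc n)) b (true ∷ 𝟘) ⊕ (false ∷ c) ≡ b ∷ c
    head true  = cong (true ∷_) (BinarySpace.+-identityˡ (bitSpace n) c)
    head false = cong (false ∷_) (BinarySpace.+-identityˡ (bitSpace n) c)

-- Restriction of scalars: a copy of the basis of E in each of the m places, which accounts for the
-- dimension m l over F₂.
powerCoordinates : ∀ {E k} → Coordinates E k → ∀ m → Coordinates (powerSpace E m) (m ℕ.* k)
powerCoordinates {E} {k} X zero = record
  { frame = [] ; coordinate = λ _ → [] ; comb∘coordinate = λ { [] → refl } ; coordinate∘comb = λ { [] → refl } }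
powerCoordinates {E} {k} X (suc m) = record
  { frame = blocks
  ; coordinate = coords
  ; comb∘coordinate = λ { (x ∷ v) → trans (comb-blocks (coordinate x) (Y.coordinate v))
      (cong₂ _∷_ (comb∘coordinate x) (Y.comb∘coordinate v)) }
  ; coordinate∘comb = λ c → let c₁ , c₂ , c≡ = Vec.splitAt k c in trans
      (cong coords (trans (cong (λ c → comb S c blocks) c≡) (comb-blocks c₁ c₂)))
      (trans (cong₂ Vec._++_ (coordinate∘comb c₁) (Y.coordinate∘comb c₂)) (sym c≡)) }
  where
  open BinarySpace E
  open Coordinates X
  module Y = Coordinates (powerCoordinates X m)
  open Span using (comb)
  S = powerSpace E (suc m)
  module S = BinarySpace S

  head : Carrier → Vec Carrier (suc m)
  head x = x ∷ replicate m 0#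

  blocks : Vec (Vec Carrier (suc m)) (k ℕ.+ m ℕ.* k)
  blocks = Vec.map head frame Vec.++ Vec.map (0# ∷_) Y.frame

  coords : Vec Carrier (suc m) → Bits (k ℕ.+ m ℕ.* k)
  coords (x ∷ v) = coordinate x Vec.++ Y.coordinate v

  comb-++ : ∀ {i j} (c : Bits i) (d : Bits j) vs ws → comb S (c Vec.++ d)
      (vs Vec.++ ws) ≡ comb S c vs S.+ comb S d ws
  comb-++ []      d []       ws = sym (S.+-identityˡ _)
  comb-++ (b ∷ c) d (v ∷ vs) ws = trans (cong (Span._∙_ S b v S.+_) (comb-++ c d vs ws))
      (sym (S.+-assoc (Span._∙_ S b v) _ _))

  comb-blocks : ∀ c d → comb S (c Vec.++ d) blocks ≡ comb E c frame ∷ comb (powerSpace E m) d Y.frame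
  comb-blocks c d = trans (comb-++ c d (Vec.map head frame) (Vec.map (0# ∷_) Y.frame)) (trans
    (cong₂ S._+_
      (MapFrame.f-comb {E} {S} {head} (λ x y → cong (x + y ∷_)
          (sym (BinarySpace.+-identityˡ (powerSpace E m) _))) c frame)
      (MapFrame.f-comb {powerSpace E m} {S} {0# ∷_} (λ v w → cong (_∷ zipWith _+_ v w)
          (sym (+-identityˡ 0#))) d Y.frame))
    (cong₂ _∷_ (+-identityʳ _) (BinarySpace.+-identityˡ (powerSpace E m) _)))

coordinateSpace : (F : BinaryField) → ℕ → VectorSpaceOver F
coordinateSpace F m = record
  { space = powerSpace space m ; _·_ = λ a → Vec.map (a *_)
  ; ·-distribˡ = λ a → distˡ a ; ·-distribʳ = distʳ
  ; ·-assoc = λ a b v → trans (Vec.map-cong (*-assoc a b) v) (Vec.map-∘ (a *_) (b *_) v)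
  ; ·-identity = λ v → trans (Vec.map-cong *-identityˡ v) (Vec.map-id v)
  ; elements = vectors elements m ; complete = ∈-vectors complete }
  where
  open BinaryField F
  distˡ : ∀ {n} a (v w : Vec Carrier n) → Vec.map (a *_) (zipWith _+_ v w) ≡ zipWith _+_ (Vec.map (a *_) v)
      (Vec.map (a *_) w)
  distˡ a []      []      = refl
  distˡ a (x ∷ v) (y ∷ w) = cong₂ _∷_ (distribˡ a x y) (distˡ a v w)
  distʳ : ∀ {n} (v : Vec Carrier n) a b → Vec.map ((a + b) *_) v ≡ zipWith _+_ (Vec.map (a *_) v)
      (Vec.map (b *_) v)
  distʳ []      a b = refl
  distʳ (x ∷ v) a b = cong₂ _∷_ (distribʳ x a b) (distʳ v a b)

-- Polynomials over F₂ modulo Xⁿ⁺¹ + modulus, listed by decreasing degree.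
module Quotient {n : ℕ} (modulus : Bits (suc n)) where

  private
    l = suc n
  open BinarySpace (bitSpace l) hiding (_+_; 0#; Carrier)

  timesX : Bits l → Bits l
  timesX (true ∷ a)  = modulus ⊕ (a Vec.∷ʳ false)
  timesX (false ∷ a) = a Vec.∷ʳ false

  -- Horner's rule, starting from the leading coefficient of the first factor. The length k is free
  -- because the inductions run over that factor alone.
  horner : ∀ {k} → Bits k → Bits l → Bits l → Bits l
  horner []          b acc = acc
  horner (false ∷ a) b acc = horner a b (timesX acc)
  horner (true ∷ a)  b acc = horner a b (b ⊕ timesX acc)

  infixl 7 _⊛_
  _⊛_ : Bits l → Bits l → Bits l
  a ⊛ b = horner a b 𝟘

  unit : ∀ n → Bits (suc n)
  unit zero    = true ∷ []
  unit (suc n) = false ∷ unit n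

  𝟙 : Bits l
  𝟙 = unit n

  𝟙≢𝟘 : 𝟙 ≢ 𝟘
  𝟙≢𝟘 = unit≢𝟘 n
    where
    unit≢𝟘 : ∀ n → unit n ≢ 𝟘
    unit≢𝟘 (suc n) eq = unit≢𝟘 n (Vec.∷-injectiveʳ eq)

  ∷ʳ-⊕ : ∀ {n} (a b : Bits n) → (a ⊕ b) Vec.∷ʳ false ≡ (a Vec.∷ʳ false) ⊕ (b Vec.∷ʳ false)
  ∷ʳ-⊕ []       []       = refl
  ∷ʳ-⊕ (x ∷ as) (y ∷ bs) = cong ((x xor y) ∷_) (∷ʳ-⊕ as bs)

  timesX-⊕ : ∀ a b → timesX (a ⊕ b) ≡ timesX a ⊕ timesX b
  timesX-⊕ (false ∷ a) (false ∷ b) = ∷ʳ-⊕ a b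
  timesX-⊕ (false ∷ a) (true ∷ b)  = trans (cong (modulus ⊕_) (trans (∷ʳ-⊕ a b) (+-comm _ _))) (trans (sym (+-assoc modulus _ _)) (+-comm _ (a Vec.∷ʳ false)))
  timesX-⊕ (true ∷ a)  (false ∷ b) = trans (cong (modulus ⊕_) (∷ʳ-⊕ a b)) (sym (+-assoc modulus _ _))
  timesX-⊕ (true ∷ a)  (true ∷ b)  = sym (trans (+-interchange modulus _ modulus _)
    (trans (cong₂ _⊕_ (x+x≡0 modulus) (sym (∷ʳ-⊕ a b))) (+-identityˡ _)))

  horner-⊕ : ∀ {k} (a : Bits k) b b′ c c′ → horner a (b ⊕ b′) (c ⊕ c′) ≡ horner a b c ⊕ horner a b′ c′
  horner-⊕ []          b b′ c c′ = refl
  horner-⊕ (false ∷ a) b b′ c c′ = trans (cong (horner a (b ⊕ b′)) (timesX-⊕ c c′))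
      (horner-⊕ a b b′ (timesX c) (timesX c′))
  horner-⊕ (true ∷ a)  b b′ c c′ = trans
    (cong (horner a (b ⊕ b′)) (trans (cong (b ⊕ b′ ⊕_) (timesX-⊕ c c′))
        (+-interchange b b′ (timesX c) (timesX c′))))
    (horner-⊕ a b b′ (b ⊕ timesX c) (b′ ⊕ timesX c′))

  horner-timesX : ∀ {k} (a : Bits k) b c → horner a (timesX b) (timesX c) ≡ timesX (horner a b c)
  horner-timesX []          b c = refl
  horner-timesX (false ∷ a) b c = horner-timesX a b (timesX c)
  horner-timesX (true ∷ a)  b c = trans (cong (horner a (timesX b)) (sym (timesX-⊕ b (timesX c))))
      (horner-timesX a b (b ⊕ timesX c))

  timesX-𝟘 : timesX 𝟘 ≡ 𝟘
  timesX-𝟘 = MapFrame.f-0 {bitSpace l} {bitSpace l} timesX-⊕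

  ⊛-distribˡ : ∀ a b c → a ⊛ (b ⊕ c) ≡ a ⊛ b ⊕ a ⊛ c
  ⊛-distribˡ a b c = trans (cong (horner a (b ⊕ c)) (sym (+-identityˡ 𝟘))) (horner-⊕ a b c 𝟘 𝟘)

  ⊛-timesX : ∀ a b → a ⊛ timesX b ≡ timesX (a ⊛ b)
  ⊛-timesX a b = trans (cong (horner a (timesX b)) (sym timesX-𝟘)) (horner-timesX a b 𝟘)

  ⊛-horner : ∀ {k} a (b : Bits k) c d → a ⊛ horner b c d ≡ horner b (a ⊛ c) (a ⊛ d)
  ⊛-horner a []          c d = refl
  ⊛-horner a (false ∷ b) c d = trans (⊛-horner a b c (timesX d)) (cong (horner b (a ⊛ c)) (⊛-timesX a d))
  ⊛-horner a (true ∷ b)  c d = trans (⊛-horner a b c (c ⊕ timesX d))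
    (cong (horner b (a ⊛ c)) (trans (⊛-distribˡ a c (timesX d)) (cong (a ⊛ c ⊕_) (⊛-timesX a d))))

  -- Multiplication by a is additive and commutes with `timesX`, while b ⊛ c is a polynomial in
  -- `timesX` applied to c; so the two multiplications commute. Together with the unit law this
  -- yields commutativity and associativity without any division of polynomials.
  ⊛-exchange : ∀ a b c → a ⊛ (b ⊛ c) ≡ b ⊛ (a ⊛ c)
  ⊛-exchange a b c = trans (⊛-horner a b c 𝟘) (cong (horner b (a ⊛ c))
      (MapFrame.f-0 {bitSpace l} {bitSpace l} {a ⊛_} (⊛-distribˡ a)))

  square : Bits l → Bits l
  square a = a ⊛ a

  -- The product with 1 never reaches the degree at which a reduction takes place. The law is
  -- checked by evaluation for each modulus.
  IsUnit : Set
  IsUnit = ∀ a → a ⊛ 𝟙 ≡ a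

  module _ (⊛-identityʳ : IsUnit) where

    ⊛-comm : ∀ a b → a ⊛ b ≡ b ⊛ a
    ⊛-comm a b = trans (cong (a ⊛_) (sym (⊛-identityʳ b))) (trans (⊛-exchange a b 𝟙)
        (cong (b ⊛_) (⊛-identityʳ a)))

    ⊛-assoc : ∀ a b c → a ⊛ b ⊛ c ≡ a ⊛ (b ⊛ c)
    ⊛-assoc a b c = trans (⊛-comm (a ⊛ b) c) (trans (⊛-exchange c a b) (cong (a ⊛_) (⊛-comm c b)))

    ⊛-identityˡ : ∀ a → 𝟙 ⊛ a ≡ a
    ⊛-identityˡ a = trans (⊛-comm 𝟙 a) (⊛-identityʳ a)

    ⊛-distribʳ : ∀ c a b → (a ⊕ b) ⊛ c ≡ a ⊛ c ⊕ b ⊛ c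
    ⊛-distribʳ c a b = trans (⊛-comm (a ⊕ b) c) (trans (⊛-distribˡ c a b) (cong₂ _⊕_ (⊛-comm c a) (⊛-comm c b)))

    -- The identity function keeps this record expression from being turned into copatterns, so that
    -- memoized fields are shared.
    quotientField : (inverse : Bits l → Bits l) → (∀ a → a ≡ 𝟘 ⊎ a ⊛ inverse a ≡ 𝟙) → BinaryField
    quotientField inverse invertible = id record
      { Carrier = Bits l ; _+_ = _⊕_ ; _*_ = _⊛_ ; 0# = 𝟘 ; 1# = 𝟙
      ; isCommutativeRing = record
        { isRing = record
          { +-isAbelianGroup = isAbelianGroup
          ; *-cong = cong₂ _⊛_
          ; *-assoc = ⊛-assoc
          ; *-identity = ⊛-identityˡ , ⊛-identityʳ
          ; distrib = ⊛-distribˡ , ⊛-distribʳ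
          }
        ; *-comm = ⊛-comm
        }
      ; 1≢0 = 𝟙≢𝟘 ; _⁻¹ = inverse
      ; inverseʳ = λ {a} a≢0 → [ (λ a≡0 → contradiction a≡0 a≢0) , id ]′ (invertible a)
      ; _≟_ = _≟_ ; elements = allBits l ; complete = ∈-allBits }

-- Radix methods on bit vectors: counting and distinctness.

tails : ∀ {n} → Bool → List (Bits (suc n)) → List (Bits n)
tails b []                        = []
tails false ((false ∷ v) ∷ xs) = v ∷ tails false xs
tails false ((true ∷ v) ∷ xs)  = tails false xs
tails true ((false ∷ v) ∷ xs)  = tails true xs
tails true ((true ∷ v) ∷ xs)   = v ∷ tails true xs

_≟ᵇ_ : ∀ {n} (v w : Bits n) → Dec (v ≡ w)
_≟ᵇ_ = Vec.≡-dec Bool._≟_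

-- Strict application keeps the counts and subtrees evaluated while the histogram grows; otherwise
-- chains of suspended insertions would pile up. In the proofs `force-≡` removes it.
insert : ∀ {n} → Bits n → Trie ℕ n → Trie ℕ n
insert []          (leaf c)   = leaf $! suc c
insert (false ∷ v) (node l r) = (λ l → node l r) $! insert v l
insert (true ∷ v)  (node l r) = (λ r → node l r) $! insert v r

lookup-insert-same : ∀ {n} (v : Bits n) t → lookupTrie (insert v t) v ≡ suc (lookupTrie t v)
lookup-insert-same []          (leaf c)   rewrite force-≡ (suc c) (leaf {ℕ}) = refl
lookup-insert-same (false ∷ v) (node l r) rewrite force-≡ (insert v l) (λ l → node l r) = lookup-insert-same v l
lookup-insert-same (true ∷ v)  (node l r) rewrite force-≡ (insert v r) (λ r → node l r) = lookup-insert-same v r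

lookup-insert-other : ∀ {n} {v w : Bits n} t → w ≢ v → lookupTrie (insert v t) w ≡ lookupTrie t w
lookup-insert-other {v = []}        {[]}        t          w≢v = contradiction refl w≢v
lookup-insert-other {v = false ∷ v} {false ∷ w} (node l r) w≢v rewrite force-≡ (insert v l) (λ l → node l r) =
    lookup-insert-other l (w≢v ∘ cong (false ∷_))
lookup-insert-other {v = false ∷ v} {true ∷ w}  (node l r) w≢v rewrite force-≡ (insert v l) (λ l → node l r) =
    refl
lookup-insert-other {v = true ∷ v}  {false ∷ w} (node l r) w≢v rewrite force-≡ (insert v r) (λ r → node l r) =
    refl
lookup-insert-other {v = true ∷ v}  {true ∷ w}  (node l r) w≢v rewrite force-≡ (insert v r) (λ r → node l r) =
    lookup-insert-other r (w≢v ∘ cong (true ∷_))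

insertAll : ∀ {n} → List (Bits n) → Trie ℕ n → Trie ℕ n
insertAll []       t = t
insertAll (v ∷ vs) t = insertAll vs $! insert v t

histogram : ∀ {n} → List (Bits n) → Trie ℕ n
histogram xs = insertAll xs (memo (λ _ → 0))

occurrences : ∀ {n} → Bits n → List (Bits n) → ℕ
occurrences v xs = length (filter (v ≟ᵇ_) xs)

lookup-insertAll : ∀ {n} v (xs : List (Bits n)) t → lookupTrie
    (insertAll xs t) v ≡ occurrences v xs ℕ.+ lookupTrie t v
lookup-insertAll v []       t = refl
lookup-insertAll v (x ∷ xs) t rewrite force-≡ (insert x t) (insertAll xs) with v ≟ᵇ x
... | yes refl = trans (lookup-insertAll v xs (insert v t))
                   (trans (cong (occurrences v xs ℕ.+_) (lookup-insert-same v t)) (ℕ.+-suc _ _))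
... | no v≢x   = trans (lookup-insertAll v xs (insert x t)) (cong (occurrences v xs ℕ.+_)
    (lookup-insert-other t v≢x))

lookup-histogram : ∀ {n} v (xs : List (Bits n)) → lookupTrie (histogram xs) v ≡ occurrences v xs
lookup-histogram v xs = trans (lookup-insertAll v xs _) (trans
    (cong (occurrences v xs ℕ.+_) (lookup-memo (λ _ → 0) v)) (ℕ.+-identityʳ _))

-- Splitting by the first bit, with an early stop at lists of at most one entry, avoids comparing
-- all pairs of the many keys. Two entries that survive all bits are equal, hence `false`.
distinctᵇ : ∀ {n} → List (Bits n) → Bool
distinctᵇ []                 = true
distinctᵇ (_ ∷ [])           = true
distinctᵇ {zero}  (_ ∷ _ ∷ _) = false
distinctᵇ {suc n} xs@(_ ∷ _ ∷ _) = distinctᵇ (tails false xs) ∧ distinctᵇ (tails true xs)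

∈-tails : ∀ {n} b (v : Bits n) xs → (b ∷ v) ∈ xs → v ∈ tails b xs
∈-tails false v (_ ∷ xs) (here refl) = here refl
∈-tails true v (_ ∷ xs) (here refl)  = here refl
∈-tails false v ((false ∷ _) ∷ xs) (there v∈) = there (∈-tails false v xs v∈)
∈-tails false v ((true ∷ _) ∷ xs) (there v∈)  = ∈-tails false v xs v∈
∈-tails true v ((false ∷ _) ∷ xs) (there v∈)  = ∈-tails true v xs v∈
∈-tails true v ((true ∷ _) ∷ xs) (there v∈)   = there (∈-tails true v xs v∈)

unique-tails : ∀ {n} (xs : List (Bits (suc n))) → Unique (tails false xs) → Unique (tails true xs) → Unique xs
unique-tails [] _ _ = []
unique-tails ((false ∷ v) ∷ xs) (v∉ ∷ f) t =
  All.tabulate (λ w∈ → λ { refl → All.lookup v∉ (∈-tails false v xs w∈) refl }) ∷ unique-tails xs f t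
unique-tails ((true ∷ v) ∷ xs) f (v∉ ∷ t) =
  All.tabulate (λ w∈ → λ { refl → All.lookup v∉ (∈-tails true v xs w∈) refl }) ∷ unique-tails xs f t

distinctᵇ-unique : ∀ {n} (xs : List (Bits n)) → distinctᵇ xs ≡ true → Unique xs
distinctᵇ-unique []           eq = []
distinctᵇ-unique (_ ∷ [])     eq = [] ∷ []
distinctᵇ-unique {suc n} xs@(_ ∷ _ ∷ _) eq = unique-tails xs
  (distinctᵇ-unique (tails false xs) (Bool.∧-conicalˡ _ _ eq))
  (distinctᵇ-unique (tails true xs) (Bool.∧-conicalʳ (distinctᵇ (tails false xs)) _ eq))

-- Lists

length-filter-map : ∀ {A B : Set} {P : A → Set} {Q : B → Set} (P? : Decidable P) (Q? : Decidable Q)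
    (f : A → B) →
  (∀ {x} → P x → Q (f x)) → (∀ {x} → Q (f x) → P x) →
  ∀ xs → length (filter Q? (map f xs)) ≡ length (filter P? xs)
length-filter-map P? Q? f to from [] = refl
length-filter-map P? Q? f to from (x ∷ xs) with P? x | Q? (f x)
... | yes _ | yes _ = cong suc (length-filter-map P? Q? f to from xs)
... | no _  | no _  = length-filter-map P? Q? f to from xs
... | yes p | no ¬q = contradiction (to p) ¬q
... | no ¬p | yes q = contradiction (from q) ¬p

filter-map : ∀ {A B : Set} {P : A → Set} {Q : B → Set} (P? : Decidable P) (Q? : Decidable Q) (f : A → B) →
  (∀ {x} → P x → Q (f x)) → (∀ {x} → Q (f x) → P x) →
  ∀ xs → filter Q? (map f xs) ≡ map f (filter P? xs)
filter-map P? Q? f to from [] = refl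
filter-map P? Q? f to from (x ∷ xs) with P? x | Q? (f x)
... | yes _ | yes _ = cong (f x ∷_) (filter-map P? Q? f to from xs)
... | no _  | no _  = filter-map P? Q? f to from xs
... | yes p | no ¬q = contradiction (to p) ¬q
... | no ¬p | yes q = contradiction (from q) ¬p

length-filter-++ : ∀ {A : Set} {P : A → Set} (P? : Decidable P) xs ys →
  length (filter P? (xs ++ ys)) ≡ length (filter P? xs) ℕ.+ length (filter P? ys)
length-filter-++ P? xs ys = trans (cong length (filter-++ P? xs ys)) (length-++ (filter P? xs))

allPairs-⊑ : ∀ {A : Set} {R : A → A → Set} {xs ys} → xs ⊑ ys → AllPairs R ys → AllPairs R xs
allPairs-⊑ []         []       = []
allPairs-⊑ (_ ∷ʳ p)   (_ ∷ r)  = allPairs-⊑ p r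
allPairs-⊑ (refl ∷ p) (x ∷ r)  = Sublist.All-resp-⊆ p x ∷ allPairs-⊑ p r

concatMap-⊑ : ∀ {A B : Set} (f : A → List B) {xs ys} → xs ⊑ ys → concatMap f xs ⊑ concatMap f ys
concatMap-⊑ f []         = []
concatMap-⊑ f (y ∷ʳ p)   = Sublist.++⁺ˡ (f y) (concatMap-⊑ f p)
concatMap-⊑ f (refl ∷ p) = Sublist.++⁺ Sublist.⊆-refl (concatMap-⊑ f p)

unique-map-injective : ∀ {A B : Set} (f : A → B) {xs} → Unique (map f xs) →
  ∀ {x y} → x ∈ xs → y ∈ xs → f x ≡ f y → x ≡ y
unique-map-injective f u          (here refl) (here refl) eq = refl
unique-map-injective f (x∉ ∷ u)   (here refl) (there y∈)  eq = contradiction eq (All.lookup x∉ (∈-map⁺ f y∈))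
unique-map-injective f (x∉ ∷ u)   (there x∈)  (here refl) eq =
    contradiction (sym eq) (All.lookup x∉ (∈-map⁺ f x∈))
unique-map-injective f (_ ∷ u)    (there x∈)  (there y∈)  eq = unique-map-injective f u x∈ y∈ eq

unique-map⁻ : ∀ {A B : Set} (f : A → B) {xs} → Unique (map f xs) → Unique xs
unique-map⁻ f u = AllPairs.map (λ ne eq → ne (cong f eq)) (AllPairs.map⁻ u)

+-interchangeℕ : ∀ a b c d → (a ℕ.+ b) ℕ.+ (c ℕ.+ d) ≡ (a ℕ.+ c) ℕ.+ (b ℕ.+ d)
+-interchangeℕ = CommutativeSemigroup.interchange ℕ.+-commutativeSemigroup

orbit : ∀ {A : Set} → (A → A) → ℕ → List A → List A
orbit g zero    xs = []
orbit g (suc i) xs = xs ++ orbit g i (map g xs)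

map-orbit : ∀ {A B : Set} {g : A → A} {g′ : B → B} (f : A → B) → (∀ x → f (g x) ≡ g′ (f x)) →
            ∀ i xs → map f (orbit g i xs) ≡ orbit g′ i (map f xs)
map-orbit f comm zero    xs = refl
map-orbit {g = g} {g′} f comm (suc i) xs = trans (map-++ f xs _)
    (cong (map f xs ++_) (trans (map-orbit f comm i (map g xs))
  (cong (orbit g′ i) (trans (sym (map-∘ xs)) (trans (map-cong comm xs) (map-∘ xs))))))

all-orbit : ∀ {A : Set} {g : A → A} {P : A → Set} → (∀ {x} → P x → P (g x)) → ∀ i {xs} → All P xs →
    All P (orbit g i xs)
all-orbit step zero    ps = []
all-orbit step (suc i) ps = All.++⁺ ps (all-orbit step i (All.map⁺ (All.map step ps)))

-- Encoding and selection of base blocks.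

bits : ∀ n → ℕ → Bits n
bits zero    m = []
bits (suc n) m = (m ℕ.% 2 ℕ.≡ᵇ 1) ∷ bits n (m ℕ./ 2)

-- A block is written as the number whose digits to the base 1000 encode its generators; the bits of
-- a digit are the coefficients of a polynomial, the constant term being the most significant one.
digits : ℕ → ℕ → List ℕ
digits zero    m = []
digits (suc k) m = if m ℕ.≡ᵇ 0 then [] else m ℕ.% 1000 ∷ digits k (m ℕ./ 1000)

-- Base blocks of a design on F of index 42 weight. The regular ones stand for all their Frobenius
-- conjugates. Those with a nontrivial stabilizer in F* are replaced by all their multiples that
-- contain 1, the extra blocks.
record Batch : Set where
  constructor batch
  field
    weight              : ℕ
    regular single extra : List ℕ

-- Greedy in the listed order, each batch at most once. That the chosen weights add up to s is not
-- proved in general but tested for every s up to the bound.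
select : List Batch → ℕ → List Batch
select []       s = []
select (g ∷ gs) s = if Batch.weight g ℕ.≤ᵇ s then g ∷ select gs (s ℕ.∸ Batch.weight g) else select gs s

select-⊑ : ∀ gs s → select gs s ⊑ gs
select-⊑ []       s = []
select-⊑ (g ∷ gs) s with Batch.weight g ℕ.≤ᵇ s
... | true  = refl ∷ select-⊑ gs (s ℕ.∸ Batch.weight g)
... | false = g ∷ʳ select-⊑ gs s

-- The `powers` are the maps x ↦ xᵉ, known here only as multiplicative maps that fix 1 and send
-- nothing else to 1. The `code` allows elements to index tries.
record Setting : Set₁ where
  field
    binaryField : BinaryField
  open BinaryField binaryField
  field
    degree                 : ℕ
    coordinates            : Coordinates space degree
    code                   : Carrier → Bits degree
    uncode                 : Bits degree → Carrier
    uncode∘code            : ∀ x → uncode (code x) ≡ x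
    frobenius unfrobenius  : Carrier → Carrier
    frobenius-square       : ∀ x → frobenius x ≡ x * x
    frobenius∘unfrobenius  : ∀ x → frobenius (unfrobenius x) ≡ x
    rank                   : ℕ
    powers                 : Vec (Carrier → Carrier) rank
    powers-*               : VecAll.All (λ f → ∀ x y → f (x * y) ≡ f x * f y) powers
    powers-kernel          : VecAll.All (λ f → ∀ x → f x ≡ 1# → x ≡ 1#) powers
    powers-1               : VecAll.All (λ f → f 1# ≡ 1#) powers

-- Orbits of base blocks under F* and the Frobenius map.

module Families (S : Setting) where
  open Setting S
  open BinaryField binaryField
  open Span space

  code-injective : ∀ {x y} → code x ≡ code y → x ≡ y
  code-injective {x} {y} eq = trans (sym (uncode∘code x)) (trans (cong uncode eq) (uncode∘code y))

  frobenius-+ : Additive space space frobenius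
  frobenius-+ x y = trans (frobenius-square (x + y)) (trans
    (Solver.solve 2 (λ x y → (x Solver.:+ y) Solver.:* (x Solver.:+ y) Solver.:= x Solver.:* x Solver.:+ y Solver.:* y) refl x y)
    (sym (cong₂ _+_ (frobenius-square x) (frobenius-square y))))

  frobenius-* : ∀ x y → frobenius (x * y) ≡ frobenius x * frobenius y
  frobenius-* x y = trans (frobenius-square (x * y)) (trans
    (Solver.solve 2 (λ x y → (x Solver.:* y) Solver.:* (x Solver.:* y) Solver.:= x Solver.:* x Solver.:*
        (y Solver.:* y)) refl x y)
    (sym (cong₂ _*_ (frobenius-square x) (frobenius-square y))))

  frobenius-kernel : ∀ {x} → frobenius x ≡ 0# → x ≡ 0#
  frobenius-kernel {x} eq = xx≡0⇒x≡0 (trans (sym (frobenius-square x)) eq)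

  module Frobenius = MapFrame {space} {space} {frobenius} frobenius-+

  frobenius-0 : frobenius 0# ≡ 0#
  frobenius-0 = Frobenius.f-0

  frobenius-⁻¹ : ∀ {x} → x ≢ 0# → frobenius x ⁻¹ ≡ frobenius (x ⁻¹)
  frobenius-⁻¹ {x} x≢0 = trans (sym (*-identityʳ _)) (trans
    (cong (frobenius x ⁻¹ *_) (trans (sym (trans (frobenius-square 1#) (*-identityˡ 1#)))
      (trans (cong frobenius (sym (inverseʳ x≢0))) (frobenius-* x (x ⁻¹)))))
    (*-cancel (λ eq → x≢0 (frobenius-kernel eq))))

  conjugate : Frame Carrier → Frame Carrier
  conjugate = mapFrame frobenius

  module Times c = MapFrame {space} {space} {c *_} (distribˡ c)

  span-map : ∀ {f} → Additive space space f → ∀ {k} (vs : Vec Carrier k) → span (Vec.map f vs) ≡ map f (span vs)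
  span-map {f} f-+ vs = trans (span≡map-comb (Vec.map f vs)) (trans
    (map-cong (λ c → MapFrame.f-comb {space} {space} {f} f-+ c vs) (allBits _))
    (trans (map-∘ (allBits _)) (cong (map f) (sym (span≡map-comb vs)))))

  nonzero : Frame Carrier → List Carrier
  nonzero B = filter (λ x → ¬? (x ≟ 0#)) (span (proj₂ B))

  pointed : List (Frame Carrier) → List (Frame Carrier × Carrier)
  pointed = concatMap (λ B → map (B ,_) (nonzero B))

  normalized : Frame Carrier × Carrier → Frame Carrier
  normalized (B , x) = mapFrame (x ⁻¹ *_) B

  -- All multiples of the members of E that contain 1#.
  multiples : List (Frame Carrier) → List (Frame Carrier)
  multiples E = map normalized (pointed E)

  multiples-++ : ∀ E E′ → multiples (E ++ E′) ≡ multiples E ++ multiples E′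
  multiples-++ E E′ = trans (cong (map normalized) (concatMap-++ _ E E′)) (map-++ normalized (pointed E) _)

  ∈-nonzero⁻ : ∀ B {x} → x ∈ nonzero B → x ∈⟨ B ⟩ × x ≢ 0#
  ∈-nonzero⁻ B x∈ = let x∈B , x≢0 = ∈-filter⁻ (λ x → ¬? (x ≟ 0#)) {xs = span
                          (proj₂ B)} x∈ in ∈-span⁻ B x∈B , x≢0

  ∈-nonzero⁺ : ∀ B {x} → x ∈⟨ B ⟩ → x ≢ 0# → x ∈ nonzero B
  ∈-nonzero⁺ B x∈ x≢0 = ∈-filter⁺ (λ x → ¬? (x ≟ 0#)) (∈-span⁺ B x∈) x≢0

  ∈-pointed⁻ : ∀ E {B x} → (B , x) ∈ pointed E → B ∈ E × x ∈ nonzero B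
  ∈-pointed⁻ E Bx∈ with find (∈-concatMap⁻ _ {xs = E} Bx∈)
  ... | B′ , B′∈ , Bx∈′ with ∈-map⁻ (B′ ,_) Bx∈′
  ... | x , x∈ , refl = B′∈ , x∈

  ∈-pointed⁺ : ∀ {E B x} → B ∈ E → x ∈ nonzero B → (B , x) ∈ pointed E
  ∈-pointed⁺ {E} B∈ x∈ = ∈-concatMap⁺ _ {xs = E} (lose B∈ (∈-map⁺ _ x∈))

  pointed-unique : ∀ {E} → All Independent E → Unique E → Unique (pointed E)
  pointed-unique []          []       = []
  pointed-unique {B ∷ E} (ind ∷ inds) (B∉ ∷ u) = Unique.++⁺
    (Unique.map⁺ (λ { refl → refl }) (Unique.filter⁺ (λ x → ¬? (x ≟ 0#)) (span-unique B ind)))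
    (pointed-unique inds u)
    (λ { (Bx∈ , ∈E) → apart Bx∈ ∈E })
    where
    apart : ∀ {p} → p ∈ map (B ,_) (nonzero B) → ¬ p ∈ pointed E
    apart p∈ p∈E with ∈-map⁻ (B ,_) p∈
    ... | x , _ , refl = All.lookup B∉ (proj₁ (∈-pointed⁻ E p∈E)) refl

  multiplicity : Carrier → List (Frame Carrier) → ℕ
  multiplicity t L = length (filter (λ B → ∈⟨⟩-dec B t) L)

  points : List (Frame Carrier) → List Carrier
  points = concatMap (span ∘ proj₂)

  occurrencesOf : Carrier → List Carrier → ℕ
  occurrencesOf t xs = length (filter (t ≟_) xs)

  occurrences-none : ∀ {t xs} → ¬ t ∈ xs → occurrencesOf t xs ≡ 0
  occurrences-none {t} {[]}     t∉ = refl
  occurrences-none {t} {x ∷ xs} t∉ with t ≟ x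
  ... | yes refl = contradiction (here refl) t∉
  ... | no _     = occurrences-none (t∉ ∘ there)

  occurrences-once : ∀ {t xs} → Unique xs → t ∈ xs → occurrencesOf t xs ≡ 1
  occurrences-once {t} {x ∷ xs} (x∉ ∷ u) t∈ with t ≟ x
  ... | yes refl = cong suc (occurrences-none (λ t∈′ → All.lookup x∉ t∈′ refl))
  occurrences-once {t} {x ∷ xs} (x∉ ∷ u) (here eq)   | no t≢x = contradiction eq t≢x
  occurrences-once {t} {x ∷ xs} (x∉ ∷ u) (there t∈) | no t≢x = occurrences-once u t∈

  -- An independent frame lists every vector of its span once, so blocks containing t correspond to
  -- occurrences of t among all the points. One histogram then answers for all t.
  multiplicity≡occurrences : ∀ t {L} → All Independent L → multiplicity t L ≡ occurrencesOf t (points L)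
  multiplicity≡occurrences t []                 = refl
  multiplicity≡occurrences t {B ∷ L} (ind ∷ inds) =
    trans (split (∈⟨⟩-dec B t)) (sym (length-filter-++ (t ≟_) (span (proj₂ B)) (points L)))
    where
    split : Dec (t ∈⟨ B ⟩) → multiplicity t (B ∷ L) ≡ occurrencesOf t (span (proj₂ B)) ℕ.+ occurrencesOf t
        (points L)
    split (yes t∈) = trans (cong length (filter-accept (λ B → ∈⟨⟩-dec B t) t∈))
      (cong₂ ℕ._+_ (sym (occurrences-once (span-unique B ind) (∈-span⁺ B t∈)))
          (multiplicity≡occurrences t inds))
    split (no t∉)  = trans (cong length (filter-reject (λ B → ∈⟨⟩-dec B t) t∉))
      (cong₂ ℕ._+_ (sym (occurrences-none (λ t∈ → t∉ (∈-span⁻ B t∈)))) (multiplicity≡occurrences t inds))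

  multiples-independent : ∀ {E} → All Independent E → All Independent (multiples E)
  multiples-independent {E} inds = All.map⁺ (All.tabulate λ { {B , x} Bx∈ →
    let B∈ , x∈ = ∈-pointed⁻ E Bx∈
    in Times.mapFrame-independent (x ⁻¹) (xy≡0⇒y≡0 (⁻¹≢0 (proj₂ (∈-nonzero⁻ B x∈)))) {B} (All.lookup inds B∈) })

  pointed-conjugate : ∀ E → pointed (map conjugate E) ≡ map (λ (B , x) → conjugate B , frobenius x) (pointed E)
  pointed-conjugate []      = refl
  pointed-conjugate (B ∷ E) = begin
    map (conjugate B ,_) (nonzero (conjugate B)) ++ pointed (map conjugate E)
      ≡⟨ cong₂ _++_ (cong (map (conjugate B ,_)) (trans (cong (filter _) (span-map frobenius-+ (proj₂ B)))
           (filter-map (λ x → ¬? (x ≟ 0#)) (λ x → ¬? (x ≟ 0#)) frobenius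
             (λ x≢0 eq → x≢0 (frobenius-kernel eq)) (λ fx≢0 → λ { refl → fx≢0 frobenius-0 }) (span (proj₂ B)))))
         (pointed-conjugate E) ⟩
    map (conjugate B ,_) (map frobenius (nonzero B)) ++ map both (pointed E)
      ≡⟨ cong (_++ map both (pointed E)) (trans (sym (map-∘ (nonzero B))) (map-∘ (nonzero B))) ⟩
    map both (map (B ,_) (nonzero B)) ++ map both (pointed E)
      ≡⟨ map-++ both (map (B ,_) (nonzero B)) (pointed E) ⟨
    map both (map (B ,_) (nonzero B) ++ pointed E) ∎
    where
    open ≡-Reasoning
    both : Frame Carrier × Carrier → Frame Carrier × Carrier
    both (B , x) = conjugate B , frobenius x

  multiples-conjugate : ∀ E → multiples (map conjugate E) ≡ map conjugate (multiples E)
  multiples-conjugate E = trans (cong (map normalized) (pointed-conjugate E)) (trans (sym (map-∘ (pointed E)))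
    (trans (map-cong-local (All.tabulate λ { {B , x} Bx∈ →
      cong (proj₁ B ,_) (commute x (proj₂ (∈-nonzero⁻ B (proj₂ (∈-pointed⁻ E Bx∈)))) (proj₂ B)) }))
          (map-∘ (pointed E))))
    where
    commute : ∀ x → x ≢ 0# → ∀ {k} (vs : Vec Carrier k) →
              Vec.map (frobenius x ⁻¹ *_) (Vec.map frobenius vs) ≡ Vec.map frobenius (Vec.map (x ⁻¹ *_) vs)
    commute x x≢0 vs = trans (sym (Vec.map-∘ _ _ vs)) (trans
      (Vec.map-cong (λ v → trans (cong (_* frobenius v) (frobenius-⁻¹ x≢0)) (sym (frobenius-* _ v))) vs)
          (Vec.map-∘ _ _ vs))

  multiplicity-conjugate : ∀ t L → multiplicity t (map conjugate L) ≡ multiplicity (unfrobenius t) L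
  multiplicity-conjugate t L = length-filter-map (λ B → ∈⟨⟩-dec B (unfrobenius t)) (λ B → ∈⟨⟩-dec B t) conjugate
    (λ {B} t∈ → subst (_∈⟨ conjugate B ⟩) (frobenius∘unfrobenius t) (Frobenius.∈-mapFrame⁺ B t∈))
    (λ {B} t∈ → let x , x∈ , eq = Frobenius.∈-mapFrame⁻ B t∈ in
      subst (_∈⟨ B ⟩) (Frobenius.f-injective frobenius-kernel
          (trans (sym eq) (sym (frobenius∘unfrobenius t)))) x∈) L

  orbitSum : ℕ → (Carrier → ℕ) → Carrier → ℕ
  orbitSum zero    h t = 0
  orbitSum (suc i) h t = h t ℕ.+ orbitSum i h (unfrobenius t)

  orbitSum-cong : ∀ {h h′} → (∀ t → h t ≡ h′ t) → ∀ i t → orbitSum i h t ≡ orbitSum i h′ t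
  orbitSum-cong eq zero    t = refl
  orbitSum-cong eq (suc i) t = cong₂ ℕ._+_ (eq t) (orbitSum-cong eq i (unfrobenius t))

  orbitSum-shift : ∀ h i t → orbitSum i (h ∘ unfrobenius) t ≡ orbitSum i h (unfrobenius t)
  orbitSum-shift h zero    t = refl
  orbitSum-shift h (suc i) t = cong (h (unfrobenius t) ℕ.+_) (orbitSum-shift h i (unfrobenius t))

  -- A conjugate of B contains t exactly when B contains the corresponding inverse conjugate of t.
  -- So the counts for all conjugates are read from the histogram of the representatives.
  multiplicity-orbit : ∀ i E t → multiplicity t (multiples (orbit conjugate i E)) ≡ orbitSum i
      (λ t → multiplicity t (multiples E)) t
  multiplicity-orbit zero    E t = refl
  multiplicity-orbit (suc i) E t = begin
    multiplicity t (multiples (E ++ orbit conjugate i (map conjugate E)))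
      ≡⟨ cong (multiplicity t) (multiples-++ E _) ⟩
    multiplicity t (multiples E ++ multiples (orbit conjugate i (map conjugate E)))
      ≡⟨ length-filter-++ (λ B → ∈⟨⟩-dec B t) (multiples E) _ ⟩
    multiplicity t (multiples E) ℕ.+ multiplicity t (multiples (orbit conjugate i (map conjugate E)))
      ≡⟨ cong (multiplicity t (multiples E) ℕ.+_) (trans (multiplicity-orbit i (map conjugate E) t)
           (trans (orbitSum-cong (λ t → trans (cong (multiplicity t) (multiples-conjugate E))
               (multiplicity-conjugate t (multiples E))) i t)
                    (orbitSum-shift (λ t → multiplicity t (multiples E)) i t))) ⟩
    orbitSum (suc i) (λ t → multiplicity t (multiples E)) t ∎
    where open ≡-Reasoning

  sum-↭ : ∀ {xs ys} → xs ↭ ys → foldr _+_ 0# xs ≡ foldr _+_ 0# ys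
  sum-↭ Permutation.refl         = refl
  sum-↭ (Permutation.prep x p)   = cong (x +_) (sum-↭ p)
  sum-↭ {_} {_ ∷ _ ∷ ys} (Permutation.swap x y p) = trans (cong (λ s → x + (y + s)) (sum-↭ p))
    (trans (sym (+-assoc x y _)) (trans (cong (_+ foldr _+_ 0# ys) (+-comm x y)) (+-assoc y x _)))
  sum-↭ (Permutation.trans p q)  = trans (sum-↭ p) (sum-↭ q)

  span-↭ : ∀ {B B′} → Independent B → Independent B′ → B ≑ B′ → span (proj₂ B) ↭ span (proj₂ B′)
  span-↭ {B} {B′} ind ind′ (⊆ , ⊇) = ∼bag⇒↭ (unique∧set⇒bag (span-unique B ind) (span-unique B′ ind′)
    (mk⇔ (∈-span⁺ B′ ∘ ⊆ ∘ ∈-span⁻ B) (∈-span⁺ B ∘ ⊇ ∘ ∈-span⁻ B′)))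

  powerSum : (Carrier → Carrier) → Frame Carrier → Carrier
  powerSum f B = foldr _+_ 0# (map f (span (proj₂ B)))

  -- The sum runs over the whole span rather than the generators: two independent frames of one
  -- space list the same vectors in different orders.
  powerSum-≑ : ∀ f {B B′} → Independent B → Independent B′ → B ≑ B′ → powerSum f B ≡ powerSum f B′
  powerSum-≑ f {B} {B′} ind ind′ eq = sum-↭ (Permutation.map⁺ f (span-↭ {B} {B′} ind ind′ eq))

  powerSum-map : ∀ {f g h} → Additive space space g → Additive space space h → (∀ x → f (g x) ≡ h (f x)) →
    ∀ B → powerSum f (mapFrame g B) ≡ h (powerSum f B)
  powerSum-map {f} {g} {h} g-+ h-+ comm B = trans (cong (λ xs → foldr _+_ 0# (map f xs))
      (span-map g-+ (proj₂ B))) (go (span (proj₂ B)))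
    where
    go : ∀ xs → foldr _+_ 0# (map f (map g xs)) ≡ h (foldr _+_ 0# (map f xs))
    go []       = sym (MapFrame.f-0 {space} {space} {h} h-+)
    go (x ∷ xs) = trans (cong₂ _+_ (comm x) (go xs)) (sym (h-+ _ _))

  powerSum-scale : ∀ {f} → (∀ x y → f (x * y) ≡ f x * f y) → ∀ c B →
      powerSum f (mapFrame (c *_) B) ≡ f c * powerSum f B
  powerSum-scale {f} f-* c = powerSum-map (distribˡ c) (distribˡ (f c)) (f-* c)

  powerSum-conjugate : ∀ {f} → (∀ x y → f (x * y) ≡ f x * f y) → ∀ B →
      powerSum f (conjugate B) ≡ frobenius (powerSum f B)
  powerSum-conjugate {f} f-* = powerSum-map frobenius-+ frobenius-+
    (λ x → trans (cong f (frobenius-square x)) (trans (f-* x x) (sym (frobenius-square (f x)))))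

  Key : Set
  Key = Vec Carrier rank

  key : Frame Carrier → Key
  key B = Vec.map (λ f → powerSum f B) powers

  key-≑ : ∀ {B B′} → Independent B → Independent B′ → B ≑ B′ → key B ≡ key B′
  key-≑ {B} {B′} ind ind′ eq = Vec.map-cong (λ f → powerSum-≑ f {B} {B′} ind ind′ eq) powers

  key-conjugate : ∀ B → key (conjugate B) ≡ Vec.map frobenius (key B)
  key-conjugate B = go powers-*
    where
    go : ∀ {m} {fs : Vec (Carrier → Carrier) m} → VecAll.All (λ f → ∀ x y → f (x * y) ≡ f x * f y) fs →
         Vec.map (λ f → powerSum f (conjugate B)) fs ≡ Vec.map frobenius (Vec.map (λ f → powerSum f B) fs)
    go []         = refl
    go (f-* ∷ fs) = cong₂ _∷_ (powerSum-conjugate f-* B) (go fs)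

  -- The power sums of c B are cᵉ times those of B, so a monic key determines the multiple.
  Monic : ∀ {m} → Vec Carrier m → Set
  Monic []       = ⊥
  Monic (x ∷ xs) = (x ≡ 0# × Monic xs) ⊎ x ≡ 1#

  monic? : ∀ {m} (xs : Vec Carrier m) → Dec (Monic xs)
  monic? []       = no id
  monic? (x ∷ xs) = ((x ≟ 0#) ×-dec monic? xs) ⊎-dec (x ≟ 1#)

  ¬monic-0 : ∀ {m} → ¬ Monic (Vec.replicate m 0#)
  ¬monic-0 {suc m} (inj₁ (_ , p)) = ¬monic-0 p
  ¬monic-0 {suc m} (inj₂ 0≡1)     = 1≢0 (sym 0≡1)

  powers≢0 : ∀ {f : Carrier → Carrier} {c} → (∀ x y → f (x * y) ≡ f x * f y) → f 1# ≡ 1# → c ≢ 0# → f c ≢ 0#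
  powers≢0 {f} {c} f-* f-1 c≢0 eq = 1≢0 (trans (sym f-1) (trans (cong f (sym (inverseʳ c≢0)))
    (trans (f-* c (c ⁻¹)) (trans (cong (_* f (c ⁻¹)) eq) (zeroˡ _)))))

  -- Each entry of the key of B′ is that of B times f c, which is nonzero, so both keys have their
  -- first nonzero entry at the same place. Both entries are 1 there, hence f c = 1 and c = 1.
  key-scale : ∀ {c B B′} → c ≢ 0# → Independent B → Independent B′ → mapFrame (c *_) B ≑ B′ →
              Monic (key B) → Monic (key B′) → c ≡ 1#
  key-scale {c} {B} {B′} c≢0 ind ind′ eq = go powers-* powers-1 powers-kernel
    where
    scaled : ∀ {f} → (∀ x y → f (x * y) ≡ f x * f y) → powerSum f B′ ≡ f c * powerSum f B
    scaled {f} f-* = trans (sym (powerSum-≑ f {mapFrame (c *_) B} {B′}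
      (Times.mapFrame-independent c (xy≡0⇒y≡0 c≢0) {B} ind) ind′ eq)) (powerSum-scale f-* c B)
    go : ∀ {m} {fs : Vec (Carrier → Carrier) m} → VecAll.All (λ f → ∀ x y → f (x * y) ≡ f x * f y) fs →
         VecAll.All (λ f → f 1# ≡ 1#) fs → VecAll.All (λ f → ∀ x → f x ≡ 1# → x ≡ 1#) fs →
         Monic (Vec.map (λ f → powerSum f B) fs) → Monic (Vec.map (λ f → powerSum f B′) fs) → c ≡ 1#
    go (h ∷ hs) (o ∷ os) (k ∷ ks) (inj₁ (_ , p)) (inj₁ (_ , p′)) = go hs os ks p p′
    go (h ∷ hs) (o ∷ os) (k ∷ ks) (inj₁ (x≡0 , _)) (inj₂ x′≡1) = contradiction
      (trans (sym x′≡1) (trans (scaled h) (trans (cong (_ *_) x≡0) (zeroʳ _)))) 1≢0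
    go (h ∷ hs) (o ∷ os) (k ∷ ks) (inj₂ x≡1) (inj₁ (x′≡0 , _)) = contradiction
      (trans (sym (*-identityʳ _)) (trans (cong (_ *_) (sym x≡1)) (trans (sym (scaled h)) x′≡0)))
          (powers≢0 h o c≢0)
    go (h ∷ hs) (o ∷ os) (k ∷ ks) (inj₂ x≡1) (inj₂ x′≡1) = k c
      (trans (sym (*-identityʳ _)) (trans (cong (_ *_) (sym x≡1)) (trans (sym (scaled h)) x′≡1)))

  1*frame : ∀ B → mapFrame (1# *_) B ≡ B
  1*frame (k , vs) = cong (k ,_) (trans (Vec.map-cong *-identityˡ vs) (Vec.map-id vs))

  record Rigid (E : List (Frame Carrier)) : Set where
    field
      independent : All Independent E
      keys-unique : Unique (map key E)
      monic       : All (Monic ∘ key) E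

    unique : Unique E
    unique = unique-map⁻ key keys-unique

    -- Monic keys force c = 1; then B and B′ span the same space and have the same key, and keys do
    -- not repeat in E. For B = B′ this is regularity of the orbit, for different B and B′
    -- disjointness.
    rigid : ∀ {B B′ c} → B ∈ E → B′ ∈ E → c ≢ 0# → mapFrame (c *_) B ≑ B′ → c ≡ 1# × B ≡ B′
    rigid {B} {B′} {c} B∈ B′∈ c≢0 eq = c≡1 , unique-map-injective key keys-unique B∈ B′∈
      (key-≑ {B} {B′} ind ind′ (subst (_≑ B′) (trans (cong (λ c → mapFrame (c *_) B) c≡1) (1*frame B)) eq))
      where
      ind = All.lookup independent B∈
      ind′ = All.lookup independent B′∈
      c≡1 : c ≡ 1#
      c≡1 = key-scale {c} {B} {B′} c≢0 ind ind′ eq (All.lookup monic B∈) (All.lookup monic B′∈)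

  -- This lets a single check of all batches together serve every selection of them.
  rigid-⊑ : ∀ {E E′} → E ⊑ E′ → Rigid E′ → Rigid E
  rigid-⊑ p R = record
    { independent = Sublist.All-resp-⊆ p independent
    ; keys-unique = AllPairs.map⁺ (allPairs-⊑ p (AllPairs.map⁻ keys-unique))
    ; monic = Sublist.All-resp-⊆ p monic }
    where open Rigid R

  -- If x⁻¹ B and x′⁻¹ B′ coincide, then x′ x⁻¹ carries B to B′, so rigidity gives B = B′ and x =
  -- x′.
  multiples-distinct : ∀ {E} → Rigid E → AllPairs (λ B B′ → ¬ B ≑ B′) (multiples E)
  multiples-distinct {E} R = map-distinct _≑_ injective (pointed-unique independent unique)
    where
    open Rigid R
    injective : ∀ {p p′} → p ∈ pointed E → p′ ∈ pointed E → normalized p ≑ normalized p′ → p ≡ p′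
    injective {B , x} {B′ , x′} p∈ p′∈ eq with ∈-pointed⁻ E p∈ | ∈-pointed⁻ E p′∈
    ... | B∈ , x∈ | B′∈ , x′∈ = conclude (rigid B∈ B′∈ (xy≢0 x′≢0 (⁻¹≢0 x≢0))
        (subst₂ _≑_ (frames (x ⁻¹) B) (trans (frames (x′ ⁻¹) B′)
            (trans (cong (λ c → mapFrame (c *_) B′) (inverseʳ x′≢0)) (1*frame B′)))
          (Times.mapFrame-≑ x′ {normalized (B , x)} {normalized (B′ , x′)} eq)))
      where
      x≢0 = proj₂ (∈-nonzero⁻ B x∈)
      x′≢0 = proj₂ (∈-nonzero⁻ B′ x′∈)
      frames : ∀ y B → mapFrame (x′ *_) (mapFrame (y *_) B) ≡ mapFrame (x′ * y *_) B
      frames y (k , vs) = cong (k ,_) (trans (sym (Vec.map-∘ _ _ vs))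
          (Vec.map-cong (λ v → sym (*-assoc x′ y v)) vs))
      conclude : x′ * x ⁻¹ ≡ 1# × B ≡ B′ → (B , x) ≡ (B′ , x′)
      conclude (q , refl) = cong (B ,_) (sym (trans (sym (*-identityʳ x′))
          (trans (cong (x′ *_) (sym (inverseˡ x≢0)))
        (trans (sym (*-assoc x′ (x ⁻¹) x)) (trans (cong (_* x) q) (*-identityˡ x))))))

  multiples-one : ∀ {E B} → B ∈ multiples E → 1# ∈⟨ B ⟩
  multiples-one {E} B∈ with ∈-map⁻ normalized B∈
  ... | (B , x) , p∈ , refl = let x∈ , x≢0 = ∈-nonzero⁻ B (proj₂ (∈-pointed⁻ E p∈)) in
    subst (_∈⟨ mapFrame (x ⁻¹ *_) B ⟩) (inverseˡ x≢0) (Times.∈-mapFrame⁺ (x ⁻¹) B x∈)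

  -- A nonzero y in x⁻¹ B is x⁻¹ z with z in B, and dividing x⁻¹ B by y gives z⁻¹ B.
  multiples-closed : ∀ {E B y} → B ∈ multiples E → y ∈⟨ B ⟩ → y ≢ 0# → mapFrame (y ⁻¹ *_) B ∈ multiples E
  multiples-closed {E} {_} {y} B∈ y∈ y≢0 with ∈-map⁻ normalized B∈
  ... | (B , x) , p∈ , refl with Times.∈-mapFrame⁻ (x ⁻¹) B y∈
  ... | z , z∈ , refl = subst (_∈ multiples E) frames
          (∈-map⁺ normalized (∈-pointed⁺ {E} (proj₁ (∈-pointed⁻ E p∈)) (∈-nonzero⁺ B z∈ z≢0)))
    where
    x≢0 = proj₂ (∈-nonzero⁻ B (proj₂ (∈-pointed⁻ E p∈)))
    z≢0 : z ≢ 0#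
    z≢0 refl = y≢0 (zeroʳ _)
    w = x ⁻¹ * z
    frames : mapFrame (z ⁻¹ *_) B ≡ mapFrame (w ⁻¹ *_) (mapFrame (x ⁻¹ *_) B)
    frames = cong (proj₁ B ,_) (trans (Vec.map-cong (λ v → step v) (proj₂ B)) (Vec.map-∘ _ _ (proj₂ B)))
      where
      coefficient : w ⁻¹ * x ⁻¹ ≡ z ⁻¹
      coefficient = begin
        w ⁻¹ * x ⁻¹              ≡⟨ *-identityʳ _ ⟨
        w ⁻¹ * x ⁻¹ * 1#         ≡⟨ cong (w ⁻¹ * x ⁻¹ *_) (inverseʳ z≢0) ⟨
        w ⁻¹ * x ⁻¹ * (z * z ⁻¹) ≡⟨ Solver.solve 4 (λ a b c d → a Solver.:* b Solver.:*
            (c Solver.:* d) Solver.:= a Solver.:* (b Solver.:* c) Solver.:* d) refl (w ⁻¹) (x ⁻¹) z (z ⁻¹) ⟩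
        w ⁻¹ * w * z ⁻¹          ≡⟨ cong (_* z ⁻¹) (inverseˡ y≢0) ⟩
        1# * z ⁻¹                ≡⟨ *-identityˡ _ ⟩
        z ⁻¹                     ∎
        where open ≡-Reasoning
      step : ∀ v → z ⁻¹ * v ≡ w ⁻¹ * (x ⁻¹ * v)
      step v = trans (cong (_* v) (sym coefficient)) (*-assoc _ _ v)

  -- Decidable checks of the data.

  toFrame : List ℕ → Frame Carrier
  toFrame ns = length ns , Vec.map (uncode ∘ bits degree) (Vec.fromList ns)

  -- 5 is the greatest block dimension in use; `digits` stops earlier for smaller blocks, whose
  -- generators are nonzero.
  read : ℕ → Frame Carrier
  read m = toFrame (digits 5 m)

  regulars singles extras entries : Batch → List (Frame Carrier)
  regulars g = map read (Batch.regular g)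
  singles g  = map read (Batch.single g)
  extras g   = map read (Batch.extra g)
  entries g  = orbit conjugate degree (regulars g) ++ singles g

  -- The keys of the entries, but with power sums computed only for the listed blocks: the Frobenius
  -- map is applied to the finished keys instead of the blocks.
  keys : Batch → List Key
  keys g = orbit (Vec.map frobenius) degree (map key (regulars g)) ++ map key (singles g)

  map-key-entries : ∀ g → map key (entries g) ≡ keys g
  map-key-entries g = trans (map-++ key (orbit conjugate degree (regulars g)) (singles g))
    (cong (_++ map key (singles g)) (map-orbit key key-conjugate degree (regulars g)))

  keyCode : Key → Bits (rank ℕ.* degree)
  keyCode = Vec.concat ∘ Vec.map code

  Valid : List ℕ → Frame Carrier → Set
  Valid K B = proj₁ B ∈ K × Independent B

  valid? : ∀ K → Decidable (Valid K)
  valid? K (k , vs) = (k ∈? K) ×-dec ∀Bits? (λ c → (comb c vs ≟ 0#) →-dec (c ≟ᵇ 𝟘))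

  -- The histograms are arguments, so that they are built once and not for each t. The values 0 and
  -- 1 are exempt because they span no line together with 1.
  Balanced : Trie ℕ degree → Trie ℕ degree → Trie ℕ degree → ℕ → Set
  Balanced hr hs hx w = All (λ t → t ≡ 0# ⊎ t ≡ 1# ⊎
    orbitSum degree (λ u → lookupTrie hr (code u)) t ℕ.+ lookupTrie hs (code t) ℕ.+ lookupTrie hx
        (code t) ≡ 42 ℕ.* w) elements

  balanced? : ∀ hr hs hx w → Dec (Balanced hr hs hx w)
  balanced? hr hs hx w = All.all? (λ t → (t ≟ 0#) ⊎-dec ((t ≟ 1#) ⊎-dec (_ ℕ.≟ 42 ℕ.* w))) elements

  pointHistogram : List (Frame Carrier) → Trie ℕ degree
  pointHistogram L = histogram (map code (points L))

  Closed : List (Frame Carrier) → Set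
  Closed L = All (λ B → All (λ y → Any (mapFrame (y ⁻¹ *_) B ≑_) L) (nonzero B)) L

  record CheckedBatch (K : List ℕ) (g : Batch) : Set where
    constructor checkedBatch
    field
      regulars-valid : All (Valid K) (regulars g)
      singles-valid  : All (Valid K) (singles g)
      -- If c B = B with c ≠ 1, each power sum satisfies S = cᵉ S with cᵉ ≠ 1 and is therefore 0. A
      -- zero key keeps the extra blocks apart from all multiples of blocks with monic keys.
      extras-valid   : All (λ B → Valid K B × 1# ∈⟨ B ⟩ × key B ≡ Vec.replicate rank 0#) (extras g)
      extras-closed  : Closed (extras g)
      balanced       : Balanced (pointHistogram (multiples (regulars g)))
          (pointHistogram (multiples (singles g)))
                         (pointHistogram (extras g)) (Batch.weight g)

  checkedBatch? : ∀ K g → Dec (CheckedBatch K g)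
  checkedBatch? K g = map′ (λ (a , b , c , d , e) → checkedBatch a b c d e)
    (λ (checkedBatch a b c d e) → a , b , c , d , e)
    (All.all? (valid? K) (regulars g) ×-dec All.all? (valid? K) (singles g) ×-dec
     All.all? (λ B → valid? K B ×-dec ∈⟨⟩-dec B 1# ×-dec Vec.≡-dec _≟_ (key B) _) (extras g) ×-dec
     All.all? (λ B → All.all? (λ y → Any.any? (≑-dec (mapFrame (y ⁻¹ *_) B)) (extras g)) (nonzero B))
         (extras g) ×-dec
     balanced? (pointHistogram (multiples (regulars g))) (pointHistogram (multiples (singles g)))
               (pointHistogram (extras g)) (Batch.weight g))

  record CheckedKeys (gs : List Batch) : Set where
    constructor checkedKeys
    field
      distinct        : distinctᵇ (map keyCode (concatMap keys gs)) ≡ true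
      monic           : All Monic (concatMap keys gs)
      extras-distinct : AllPairs (λ B B′ → ¬ B ≑ B′) (concatMap extras gs)

  checkedKeys? : ∀ gs → Dec (CheckedKeys gs)
  checkedKeys? gs = map′ (λ (a , b , c) → checkedKeys a b c) (λ (checkedKeys a b c) → a , b , c)
    ((_ Bool.≟ true) ×-dec All.all? monic? (concatMap keys gs) ×-dec
     AllPairs.allPairs? (λ B B′ → ¬? (≑-dec B B′)) (concatMap extras gs))

  -- From checked data to pencils and cores.

  module _ {K : List ℕ} where

    entries-valid : ∀ {g} → CheckedBatch K g → All (Valid K) (entries g)
    entries-valid G = All.++⁺ (all-orbit (λ {B} (k∈ , ind) →
        k∈ , Frobenius.mapFrame-independent frobenius-kernel {B} ind)
      degree regulars-valid) singles-valid
      where open CheckedBatch G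

    lookup-pointHistogram : ∀ {L} → All Independent L → ∀ t →
        lookupTrie (pointHistogram L) (code t) ≡ multiplicity t L
    lookup-pointHistogram {L} inds t = trans (lookup-histogram (code t) (map code (points L))) (trans
      (length-filter-map (t ≟_) (code t ≟ᵇ_) code (cong code) code-injective (points L))
      (sym (multiplicity≡occurrences t inds)))

    batch-multiplicity : ∀ {g} → CheckedBatch K g → ∀ {t} → t ≢ 0# → t ≢ 1# →
      multiplicity t (multiples (entries g)) ℕ.+ multiplicity t (extras g) ≡ 42 ℕ.* Batch.weight g
    batch-multiplicity {g} G {t} t≢0 t≢1 = trans (cong (ℕ._+ multiplicity t (extras g)) (trans
        (cong (multiplicity t) (multiples-++ (orbit conjugate degree (regulars g)) (singles g)))
        (trans (length-filter-++ (λ B → ∈⟨⟩-dec B t) (multiples (orbit conjugate degree (regulars g)))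
            (multiples (singles g)))
          (cong (ℕ._+ multiplicity t (multiples (singles g))) (trans (multiplicity-orbit degree (regulars g) t)
            (orbitSum-cong (λ t → sym (lookup-pointHistogram
                (multiples-independent (All.map proj₂ regulars-valid)) t)) degree t))))))
      (trans (cong₂ (λ a b → orbitSum degree _ t ℕ.+ a ℕ.+ b)
        (sym (lookup-pointHistogram (multiples-independent (All.map proj₂ singles-valid)) t))
        (sym (lookup-pointHistogram (All.map (proj₂ ∘ proj₁) extras-valid) t)))
      (total (All.lookup balanced (complete t))))
      where
      open CheckedBatch G
      total : ∀ {n} → t ≡ 0# ⊎ t ≡ 1# ⊎ n → n
      total (inj₁ t≡0)        = contradiction t≡0 t≢0
      total (inj₂ (inj₁ t≡1)) = contradiction t≡1 t≢1
      total (inj₂ (inj₂ p))   = p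

    batches-multiplicity : ∀ {gs} → All (CheckedBatch K) gs → ∀ {t} → t ≢ 0# → t ≢ 1# →
      multiplicity t (multiples (concatMap entries gs)) ℕ.+ multiplicity t (concatMap extras gs) ≡ 42 ℕ.* sum
          (map Batch.weight gs)
    batches-multiplicity []                     t≢0 t≢1 = refl
    batches-multiplicity {g ∷ gs} (G ∷ Gs) {t} t≢0 t≢1 = begin
      multiplicity t (multiples (entries g ++ concatMap entries gs)) ℕ.+ multiplicity t
          (extras g ++ concatMap extras gs)
        ≡⟨ cong₂ ℕ._+_ (trans (cong (multiplicity t) (multiples-++ (entries g) _))
            (length-filter-++ (λ B → ∈⟨⟩-dec B t) (multiples (entries g)) _))
                       (length-filter-++ (λ B → ∈⟨⟩-dec B t) (extras g) _) ⟩
      (multiplicity t (multiples (entries g)) ℕ.+ multiplicity t (multiples (concatMap entries gs)))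
        ℕ.+ (multiplicity t (extras g) ℕ.+ multiplicity t (concatMap extras gs))
        ≡⟨ +-interchangeℕ (multiplicity t (multiples (entries g))) _ _ _ ⟩
      (multiplicity t (multiples (entries g)) ℕ.+ multiplicity t (extras g))
        ℕ.+ (multiplicity t (multiples (concatMap entries gs)) ℕ.+ multiplicity t (concatMap extras gs))
        ≡⟨ cong₂ ℕ._+_ (batch-multiplicity G t≢0 t≢1) (batches-multiplicity Gs t≢0 t≢1) ⟩
      42 ℕ.* Batch.weight g ℕ.+ 42 ℕ.* sum (map Batch.weight gs)
        ≡⟨ ℕ.*-distribˡ-+ 42 (Batch.weight g) _ ⟨
      42 ℕ.* sum (map Batch.weight (g ∷ gs)) ∎
      where open ≡-Reasoning

    module _ {gs : List Batch} (G : All (CheckedBatch K) gs) (C : CheckedKeys gs) where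
      private module C = CheckedKeys C

      all-rigid : Rigid (concatMap entries gs)
      all-rigid = record
        { independent = All.concat⁺ (All.map⁺ (All.map (All.map proj₂ ∘ entries-valid) G))
        ; keys-unique = unique-map⁻ keyCode (subst (λ ks → Unique (map keyCode ks)) (sym all-keys)
            (distinctᵇ-unique _ C.distinct))
        ; monic = All.map⁻ (subst (All Monic) (sym all-keys) C.monic) }
        where
        all-keys : map key (concatMap entries gs) ≡ concatMap keys gs
        all-keys = trans (map-concatMap key entries gs) (concatMap-cong map-key-entries gs)

      pencil : ∀ s → sum (map Batch.weight (select gs s)) ≡ s → Pencil binaryField K (42 ℕ.* s)
      pencil s weights = record
        { members = multiples E ++ X
        ; valid = λ B∈ → [ multiples-valid , (λ B∈ → proj₁ (All.lookup X-valid B∈)) ]′ (∈-++⁻ (multiples E) B∈)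
        ; one = λ B∈ → [ multiples-one {E} , (λ B∈ → proj₁ (proj₂ (All.lookup X-valid B∈))) ]′
            (∈-++⁻ (multiples E) B∈)
        ; distinct = AllPairs.++⁺ (multiples-distinct R) (allPairs-⊑ (concatMap-⊑ extras sub) C.extras-distinct)
            (All.tabulate λ B∈ → All.tabulate λ X∈ → apart B∈ X∈)
        ; closed = λ B∈ y∈ y≢0 → [ (λ B∈ → lose (∈-++⁺ˡ (multiples-closed {E} B∈ y∈ y≢0))
            (≑-refl {mapFrame (_ *_) _}))
                                 , (λ B∈ → Any.++⁺ʳ (multiples E) (X-closed B∈ y∈ y≢0)) ]′
                                     (∈-++⁻ (multiples E) B∈)
        ; many = λ {t} t≢0 t≢1 → trans (length-filter-++ (λ B → ∈⟨⟩-dec B t) (multiples E) X)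
            (trans (batches-multiplicity G′ t≢0 t≢1) (cong (42 ℕ.*_) weights)) }
        where
        sub = select-⊑ gs s
        G′ : All (CheckedBatch K) (select gs s)
        G′ = Sublist.All-resp-⊆ sub G
        E = concatMap entries (select gs s)
        X = concatMap extras (select gs s)
        R : Rigid E
        R = rigid-⊑ (concatMap-⊑ entries sub) all-rigid

        X-valid : All (λ B → Valid K B × 1# ∈⟨ B ⟩ × key B ≡ Vec.replicate rank 0#) X
        X-valid = All.concat⁺ (All.map⁺ (All.map CheckedBatch.extras-valid G′))

        multiples-valid : ∀ {B} → B ∈ multiples E → Valid K B
        multiples-valid B∈ = dimension (∈-map⁻ normalized B∈) , All.lookup
            (multiples-independent (Rigid.independent R)) B∈
          where
          dimension : ∀ {B} → (∃ λ p → p ∈ pointed E × B ≡ normalized p) → proj₁ B ∈ K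
          dimension ((B , x) , p∈ , refl) = proj₁ (All.lookup
            (All.concat⁺ (All.map⁺ (All.map entries-valid G′))) (proj₁ (∈-pointed⁻ E p∈)))

        X-closed : ∀ {B y} → B ∈ X → y ∈⟨ B ⟩ → y ≢ 0# → Any (mapFrame (y ⁻¹ *_) B ≑_) X
        X-closed {B} {y} B∈ y∈ y≢0 with find (∈-concatMap⁻ extras {xs = select gs s} B∈)
        ... | g , g∈ , B∈g with find (All.lookup (All.lookup
            (CheckedBatch.extras-closed (All.lookup G′ g∈)) B∈g) (∈-nonzero⁺ B y∈ y≢0))
        ... | B′ , B′∈ , eq = lose (∈-concatMap⁺ extras {xs = select gs s} (lose g∈ B′∈)) eq

        -- Scaling by x⁻¹ multiplies the power sums by nonzero factors. So if a multiple of B were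
        -- an extra block, the key of B itself would be zero, which is not monic.
        apart : ∀ {B B′} → B ∈ multiples E → B′ ∈ X → ¬ B ≑ B′
        apart {_} {B′} B∈ B′∈ eq with ∈-map⁻ normalized B∈
        ... | (B , x) , p∈ , refl = ¬monic-0 (subst Monic zero-key (All.lookup (Rigid.monic R) B∈E))
          where
          B∈E = proj₁ (∈-pointed⁻ E p∈)
          x≢0 = proj₂ (∈-nonzero⁻ B (proj₂ (∈-pointed⁻ E p∈)))
          normalized-0 : key (normalized (B , x)) ≡ Vec.replicate rank 0#
          normalized-0 = trans (key-≑ {normalized (B , x)} {B′} (proj₂ (multiples-valid B∈))
              (proj₂ (proj₁ (All.lookup X-valid B′∈))) eq)
            (proj₂ (proj₂ (All.lookup X-valid B′∈)))
          zero-key : key B ≡ Vec.replicate rank 0#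
          zero-key = go powers-* powers-1 normalized-0
            where
            go : ∀ {m} {fs : Vec (Carrier → Carrier) m} → VecAll.All (λ f → ∀ x y → f (x * y) ≡ f x * f y) fs →
                VecAll.All (λ f → f 1# ≡ 1#) fs →
                 Vec.map (λ f → powerSum f (normalized (B , x))) fs ≡ Vec.replicate m 0# →
                     Vec.map (λ f → powerSum f B) fs ≡ Vec.replicate m 0#
            go []         []         eq = refl
            go (f-* ∷ fs) (f-1 ∷ os) eq = cong₂ _∷_
              (xy≡0⇒y≡0 (powers≢0 f-* f-1 (⁻¹≢0 x≢0)) (trans (sym (powerSum-scale f-* (x ⁻¹) B))
                  (Vec.∷-injectiveˡ eq)))
              (go fs os (Vec.∷-injectiveʳ eq))

  triple : Vec ℕ 3 → Vec Carrier 3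
  triple = Vec.map (uncode ∘ bits degree)

  coreOrbit : List (Vec ℕ 3) → List (Vec Carrier 3)
  coreOrbit ts = orbit (Vec.map frobenius) degree (map triple ts)

  record CheckedCores (ts : List (Vec ℕ 3)) : Set where
    constructor checkedCores
    field
      valid    : All (λ t → Valid (3 ∷ []) (3 , triple t)) ts
      distinct : distinctᵇ (map keyCode (orbit (Vec.map frobenius) degree
          (map (λ t → key (3 , triple t)) ts))) ≡ true
      monic    : All Monic (orbit (Vec.map frobenius) degree (map (λ t → key (3 , triple t)) ts))

  checkedCores? : ∀ ts → Dec (CheckedCores ts)
  checkedCores? ts = map′ (λ (a , b , c) → checkedCores a b c) (λ (checkedCores a b c) → a , b , c)
    (All.all? (λ t → valid? _ (3 , triple t)) ts ×-dec (_ Bool.≟ true) ×-dec All.all? monic? _)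

  -- Rigidity passes to sublists, so the first s conjugates of the listed cores serve for every s up
  -- to their number.
  coreFamily : ∀ {ts} → CheckedCores ts → ∀ {s} → s ℕ.≤ length (coreOrbit ts) → Cores binaryField s
  coreFamily {ts} C {s} s≤ = record
    { cores = List.take s (coreOrbit ts)
    ; independent = λ B∈ → All.lookup (Rigid.independent R) (∈-map⁺ (3 ,_) B∈)
    ; unique = unique-map⁻ (3 ,_) (Rigid.unique R)
    ; rigid = λ B∈ B′∈ c≢0 eq → let c≡1 , B≡ = Rigid.rigid R (∈-map⁺ (3 ,_) B∈)
                                      (∈-map⁺ (3 ,_) B′∈) c≢0 eq in c≡1 , frame-injective B≡
    ; many = trans (length-take s (coreOrbit ts)) (ℕ.m≤n⇒m⊓n≡m s≤) }
    where
    open CheckedCores C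
    frame-injective : ∀ {B B′ : Vec Carrier 3} → _≡_ {A = Frame Carrier} (3 , B) (3 , B′) → B ≡ B′
    frame-injective refl = refl

    frames : List (Frame Carrier)
    frames = orbit conjugate degree (map (λ t → 3 , triple t) ts)
    frames≡ : map (3 ,_) (coreOrbit ts) ≡ frames
    frames≡ = trans (map-orbit (3 ,_) (λ _ → refl) degree (map triple ts))
        (cong (orbit conjugate degree) (sym (map-∘ ts)))
    frame-keys : map key frames ≡ orbit (Vec.map frobenius) degree (map (λ t → key (3 , triple t)) ts)
    frame-keys = trans (map-orbit key key-conjugate degree (map (λ t → 3 , triple t) ts))
        (cong (orbit (Vec.map frobenius) degree) (sym (map-∘ ts)))

    R-all : Rigid frames
    R-all = record
      { independent = all-orbit (λ {B} → Frobenius.mapFrame-independent frobenius-kernel {B}) degree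
          (All.map⁺ (All.map proj₂ valid))
      ; keys-unique = unique-map⁻ keyCode (subst (λ ks → Unique (map keyCode ks)) (sym frame-keys)
          (distinctᵇ-unique _ distinct))
      ; monic = All.map⁻ (subst (All Monic) (sym frame-keys) monic) }

    R : Rigid (map (3 ,_) (List.take s (coreOrbit ts)))
    R = rigid-⊑ (Sublist.map⁺ (3 ,_) (Sublist.take-⊆ s (coreOrbit ts))) (subst Rigid (sym frames≡) R-all)

-- Quotient fields as settings.

module QuotientSetting {n : ℕ} (modulus : Bits (suc n)) where
  open Quotient modulus

  -- Squaring is a parameter so that it can be evaluated through a table.
  module Powers (sq : Bits (suc n) → Bits (suc n)) where

    power : ∀ {k} → Bits k → Bits (suc n) → Bits (suc n)
    power []          a = 𝟙
    power (false ∷ e) a = sq (power e a)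
    power (true ∷ e)  a = a ⊛ sq (power e a)

    iterate : ℕ → Bits (suc n) → Bits (suc n)
    iterate zero    a = a
    iterate (suc i) a = sq (iterate i a)

    -- a ^ (2 ^ (k + 1) - 2)
    inverse : ℕ → Bits (suc n) → Bits (suc n)
    inverse zero    a = 𝟙
    inverse (suc k) a = sq (a ⊛ inverse k a)

    PowerKernel : ℕ → Set
    PowerKernel e = ∀ a → power (bits (suc n) e) a ≡ 𝟙 → a ≡ 𝟙

    -- With l = n + 1: the second condition makes the quotient a field, with a^(2ˡ - 2) as inverse;
    -- the third is a^(2ˡ) = a, so that n squarings invert the Frobenius map; the last holds for
    -- exponents prime to 2ˡ - 1.
    Admissible : ∀ {r} → Vec ℕ r → Set
    Admissible es = IsUnit × (∀ a → a ≡ 𝟘 ⊎ a ⊛ inverse n a ≡ 𝟙) ×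
        (∀ a → sq (iterate n a) ≡ a) × VecAll.All PowerKernel es

    admissible? : ∀ {r} (es : Vec ℕ r) → Dec (Admissible es)
    admissible? es = ∀Bits? (λ a → (a ⊛ 𝟙) ≟ᵇ a) ×-dec ∀Bits?
        (λ a → (a ≟ᵇ 𝟘) ⊎-dec ((a ⊛ inverse n a) ≟ᵇ 𝟙)) ×-dec
      ∀Bits? (λ a → sq (iterate n a) ≟ᵇ a) ×-dec
      VecAll.all? (λ e → ∀Bits? (λ a → (power (bits (suc n) e) a ≟ᵇ 𝟙) →-dec (a ≟ᵇ 𝟙))) es

  module _ (sq : Bits (suc n) → Bits (suc n)) (sq≡square : ∀ a → sq a ≡ square a) {r} (es : Vec ℕ r) where
    open Powers sq

    settingFrom : Admissible es → Setting
    settingFrom (identity , invertible , fermat , kernels) = id record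
      { binaryField = F
      ; degree = suc n ; coordinates = bitCoordinates (suc n) ; code = id ; uncode = id ; uncode∘code =
          λ _ → refl
      ; frobenius = sq ; unfrobenius = memoized (λ a → iterate n a)
      ; frobenius-square = sq≡square
      ; frobenius∘unfrobenius = λ a → trans (cong sq (memoized≡ (iterate n) a)) (fermat a)
      ; rank = r
      ; powers = Vec.map table es
      ; powers-* = VecAll.map⁺ (VecAll.universal (λ e a b → trans (table≡ e (a ⊛ b))
          (trans (power-⊛ (exponent e) a b) (sym (cong₂ _⊛_ (table≡ e a) (table≡ e b))))) es)
      ; powers-kernel = VecAll.map⁺ (VecAll.map (λ {e} kernel a eq → kernel a
          (trans (sym (table≡ e a)) eq)) kernels)
      ; powers-1 = VecAll.map⁺ (VecAll.universal (λ e → trans (table≡ e 𝟙) (power-𝟙 (exponent e))) es)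
      }
      where
      F = quotientField identity (memoized (λ a → inverse n a))
        (λ a → Sum.map₂ (trans (cong (a ⊛_) (memoized≡ (inverse n) a))) (invertible a))
      open CommutativeSemigroup (CommutativeRing.*-commutativeSemigroup (BinaryField.commutativeRing F)) using
          (interchange)
      exponent : ℕ → Bits (suc n)
      exponent = bits (suc n)
      table : ℕ → Bits (suc n) → Bits (suc n)
      table e = memoized (λ a → power (exponent e) a)
      table≡ : ∀ e a → table e a ≡ power (exponent e) a
      table≡ e = memoized≡ (power (exponent e))

      sq-⊛ : ∀ a b → sq (a ⊛ b) ≡ sq a ⊛ sq b
      sq-⊛ a b = trans (sq≡square (a ⊛ b)) (trans (interchange a b a b)
          (sym (cong₂ _⊛_ (sq≡square a) (sq≡square b))))

      power-⊛ : ∀ {k} (e : Bits k) a b → power e (a ⊛ b) ≡ power e a ⊛ power e b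
      power-⊛ []          a b = sym (⊛-identityˡ identity 𝟙)
      power-⊛ (false ∷ e) a b = trans (cong sq (power-⊛ e a b)) (sq-⊛ (power e a) (power e b))
      power-⊛ (true ∷ e)  a b = trans (cong (a ⊛ b ⊛_) (trans (cong sq (power-⊛ e a b))
          (sq-⊛ (power e a) (power e b))))
        (interchange a b (sq (power e a)) (sq (power e b)))

      sq-𝟙 : sq 𝟙 ≡ 𝟙
      sq-𝟙 = trans (sq≡square 𝟙) (identity 𝟙)

      power-𝟙 : ∀ {k} (e : Bits k) → power e 𝟙 ≡ 𝟙
      power-𝟙 []          = refl
      power-𝟙 (false ∷ e) = trans (cong sq (power-𝟙 e)) sq-𝟙
      power-𝟙 (true ∷ e)  = trans (⊛-identityˡ identity _) (trans (cong sq (power-𝟙 e)) sq-𝟙)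

  Admissible : ∀ {r} → Vec ℕ r → Set
  Admissible es = Powers.Admissible (memoized square) es

  admissible? : ∀ {r} (es : Vec ℕ r) → Dec (Admissible es)
  admissible? es = Powers.admissible? (memoized square) es

  quotientSetting : ∀ {r} (es : Vec ℕ r) → Admissible es → Setting
  quotientSetting es = settingFrom (memoized square) (memoized≡ square) es

-- Certificates and the designs they yield.

record Certificate (S : Setting) (K : List ℕ) (gs : List Batch) (ts : List (Vec ℕ 3)) (bound : ℕ) : Set where
  constructor certificate
  open Families S
  field
    batches     : All (CheckedBatch K) gs
    keysValid  : CheckedKeys gs
    coresValid : CheckedCores ts
    -- The list `upTo (suc bound)` is 0, ..., `bound`, so every s up to and including the bound is
    -- tested.
    selectable : All (λ s → sum (map Batch.weight (select gs s)) ≡ s) (upTo (suc bound))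
    enough     : bound ℕ.≤ length (coreOrbit ts)

certificate? : ∀ S K gs ts bound → Dec (Certificate S K gs ts bound)
certificate? S K gs ts bound = map′ (λ (a , b , c , d , e) → certificate a b c d e)
  (λ (certificate a b c d e) → a , b , c , d , e)
  (All.all? (checkedBatch? K) gs ×-dec checkedKeys? gs ×-dec checkedCores? ts ×-dec
   All.all? (λ s → sum (map Batch.weight (select gs s)) ℕ.≟ s) (upTo (suc bound)) ×-dec
       (bound ℕ.≤? length (coreOrbit ts)))
  where open Families S

certifiedDesign : ∀ {S K gs ts bound} → Certificate S K gs ts bound → 3 ∈ K → ∀ m {s} → s ℕ.≤ bound →
  Σ (PBD GF2 (m ℕ.* Setting.degree S) K (42 ℕ.* s)) Simple
certifiedDesign {S} cert 3∈K m {s} s≤ =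
  desarguesianDesign (coordinateSpace binaryField m) 3∈K
    (pencil batches keysValid s (All.lookup selectable (∈-upTo⁺ (ℕ.s≤s s≤))))
    (coreFamily coresValid (ℕ.≤-trans s≤ enough))
    (m ℕ.* Setting.degree S , frame) frame-independent frame-spanning
  where
  open Setting S using (binaryField; coordinates)
  open Families S
  open Certificate cert
  open Coordinates (powerCoordinates coordinates m)

-- Base blocks and cores found by computer search

-- The sizes fit: a block of dimension k yields (2ᵏ - 1)(2ᵏ - 2) ratios t ≠ 1, and 12 blocks of
-- dimension 3 with 10 of dimension 4 yield 12 · 42 + 10 · 210 = 42 · 62, that is 42 for each of the
-- 62 values of t.
batch₆-1 : Batch
batch₆-1 = batch 1
  []
  (9010052 ∷ 50052040 ∷ 27028032 ∷ 49058028 ∷ 17034012 ∷ 18020008 ∷ 1022024 ∷ 17058028 ∷ 25026032 ∷ 5026032 ∷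
   1028032 ∷ 33004016 ∷ 7008016032 ∷ 1010028032 ∷ 9018012032 ∷ 1018004032 ∷ 17026028032 ∷ 17006024032 ∷
   3004016032 ∷ 25002012032 ∷ 21002008032 ∷ 25026020032 ∷ [])
  []

cores₆ : List (Vec ℕ 3)
cores₆ =
  (36 ∷ 18 ∷ 41 ∷ []) ∷ []

-- Two of the regular blocks have five generators, so this batch serves only for block dimensions 3,
-- 4, 5.
batch₇-3 : Batch
batch₇-3 = batch 3
  (65082068088032 ∷ 81082084088096 ∷ 89018084 ∷ 68016096 ∷ 9066076048 ∷ 115036040 ∷ [])
  (4016032 ∷ 25058060064 ∷ 4016032064 ∷ 25058060 ∷ [])
  []

batch₇-2 : Batch
batch₇-2 = batch 2
  (65004040048 ∷ 17002100 ∷ 1034016 ∷ 1114068120 ∷ 17018024096 ∷ 25028032064 ∷ 57122124 ∷ 101102072112 ∷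
   69110080 ∷ 49098052056 ∷ 18052104 ∷ 16032064 ∷ [])
  []
  []

batch₇-1 : Batch
batch₇-1 = batch 1
  (89090116 ∷ 21002056 ∷ 1036072 ∷ 113098116024 ∷ 65002104080 ∷ 65002100072 ∷ [])
  []
  []

cores₇ : List (Vec ℕ 3)
cores₇ =
  (64 ∷ 32 ∷ 16 ∷ []) ∷ []

batch₈-8 : Batch
batch₈-8 = batch 8
  (169236144 ∷ 33074156 ∷ 171076240 ∷ 53018128 ∷ 41010144 ∷ 225002068 ∷ 218220160 ∷ 181242248 ∷ 129200144 ∷
   41134048 ∷ 249146004 ∷ 133082056 ∷ 65114132 ∷ 131132136112 ∷ 33050020064 ∷ 83036088128 ∷ 36168016192 ∷
   131152032064 ∷ 161196168080 ∷ 137196016032 ∷ 81098196056 ∷ 33002100152 ∷ 169074100080 ∷ 45014144192 ∷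
   130068024160 ∷ 193084200032 ∷ 130228040240 ∷ 194136208096 ∷ 42044016128 ∷ 34004072208 ∷ 69102088128 ∷
   97162228104 ∷ 49242100024 ∷ 138004016160 ∷ 17066212200 ∷ 113002212232 ∷ 193114036024 ∷ 161018212216 ∷
   21082024160 ∷ 241178164088 ∷ 113178116232 ∷ 17146156160 ∷ 197070016160 ∷ 19020008032 ∷ 193130212232 ∷
   201034228208 ∷ 161162236112 ∷ 65018132056 ∷ 193038008112 ∷ 169004016064 ∷ 129002028032 ∷ 1194020216 ∷
   153018020160 ∷ 1066148216 ∷ 161138172176 ∷ 3196104176 ∷ 49002116024 ∷ 65098228208 ∷ 209114212136 ∷ [])
  (235044208 ∷ 201162060 ∷ 235076208 ∷ 201162020 ∷ 107044208 ∷ 73162060 ∷ 107204080 ∷ 201034020 ∷ 25146096 ∷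
   49114040 ∷ 41194176 ∷ 225242120 ∷ 25114128 ∷ 81114128 ∷ 25106128 ∷ 114072128 ∷ 1024128 ∷ 1072128 ∷ 72080128 ∷
   34024128 ∷ 1058128 ∷ 233162108112 ∷ 17242148216 ∷ 201202172208 ∷ 9162108208 ∷ 161228232080 ∷ 34164016064 ∷
   153002132032 ∷ 65242084008 ∷ 169066100080 ∷ 177034036248 ∷ 133142208224 ∷ 97162196168 ∷ [])
  (13038064128 ∷ 21094032128 ∷ 19024096128 ∷ 107004016128 ∷ 1106048128 ∷ 107012112128 ∷ 99100008128 ∷
   97066072128 ∷ 81018040128 ∷ 3116104128 ∷ 117070088128 ∷ 85006056128 ∷ 89050068128 ∷ 33074036128 ∷ 9098084128 ∷
   17122052128 ∷ 113026076128 ∷ 105002044128 ∷ 57082092128 ∷ 65042060128 ∷ 73034080128 ∷ [])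

batch₈-4 : Batch
batch₈-4 = batch 4
  (185138052 ∷ 193042048 ∷ 97018084088 ∷ 37130240 ∷ 97162108176 ∷ 201074100176 ∷ 133230200176 ∷ 1146196056 ∷
   33130248 ∷ 165230136176 ∷ 97210088 ∷ 5198040240 ∷ 29198096 ∷ 177226004248 ∷ 210212008096 ∷ 137006144224 ∷
   129194132144 ∷ 17018036192 ∷ 65034008080 ∷ 33028064 ∷ 130212056 ∷ 17148008160 ∷ 129002004176 ∷ 17226084104 ∷
   33018244104 ∷ 49002036 ∷ 65018156096 ∷ 85230008 ∷ 169122252 ∷ 225066068152 ∷ 165098232080 ∷ 13010160192 ∷
   129202140016 ∷ 19044064 ∷ 129170012176 ∷ [])
  []
  []

batch₈-2 : Batch
batch₈-2 = batch 2
  (65118040 ∷ 17042052 ∷ 145034052136 ∷ 1044144192 ∷ 177098252 ∷ 169010020064 ∷ 97114036 ∷ 41014080 ∷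
   201138204032 ∷ 131068232144 ∷ 65122044128 ∷ 165226040080 ∷ 197070168144 ∷ 25210156160 ∷ 145210008 ∷ [])
  (161194136048 ∷ 33050056064 ∷ 153146032192 ∷ 145082008160 ∷ 1034036128 ∷ 85038072128 ∷ 81068024128 ∷
   106100080128 ∷ 73034048128 ∷ 97010080128 ∷ 73066096128 ∷ 67040080128 ∷ 34044080128 ∷ 25034060128 ∷
   73114028128 ∷ 73068080128 ∷ 25034108128 ∷ 73114076128 ∷ 73102080128 ∷ 101034080128 ∷ [])
  []

batch₈-2′ : Batch
batch₈-2′ = batch 2
  (33210140 ∷ 225166184 ∷ 229194104144 ∷ 234044016 ∷ 17034228008 ∷ 129196008176 ∷ 133038072240 ∷ 9080224 ∷
   129134048 ∷ 161210108 ∷ 18060064 ∷ 195068144096 ∷ 105106028128 ∷ 161098084152 ∷ 81002216096 ∷ 98148024 ∷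
   130228008208 ∷ [])
  (201034036048 ∷ 97010044208 ∷ 73066220224 ∷ 195100168080 ∷ 1066040128 ∷ 35072048128 ∷ 97018024128 ∷
   81090096128 ∷ 34108128 ∷ 5062128 ∷ 73102128 ∷ 101080128 ∷ 193034164208 ∷ 113162004104 ∷ 73226204144 ∷
   201130228080 ∷ 49034116120 ∷ 41194004080 ∷ 65098016128 ∷ 113002104128 ∷ [])
  []

batch₈-1 : Batch
batch₈-1 = batch 1
  (145066156 ∷ 21062064 ∷ 201194124 ∷ 129052024 ∷ 129052024192 ∷ 81066036024 ∷ 225242020200 ∷ 49098228168 ∷
   209018212216 ∷ 209034052 ∷ [])
  (81114072128 ∷ 1114024128 ∷ 25034028 ∷ 201114148 ∷ 73172208 ∷ 162236080 ∷ [])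
  []

cores₈ : List (Vec ℕ 3)
cores₈ =
  (144 ∷ 236 ∷ 169 ∷ []) ∷ (156 ∷ 74 ∷ 33 ∷ []) ∷ (108 ∷ 210 ∷ 161 ∷ []) ∷ []

batch₉-24 : Batch
batch₉-24 = batch 24
  (305038280 ∷ 481322020 ∷ 441386060 ∷ 497162212 ∷ 425274252 ∷ 289194332 ∷ 257502424 ∷ 129308488 ∷ 338036088 ∷
   458140096 ∷ 458404160 ∷ 19088480 ∷ 1378452 ∷ 269038320 ∷ 465438136 ∷ 357162056 ∷ 97506228 ∷ 81098228 ∷
   489402316 ∷ 421322016 ∷ 293462176 ∷ 50344128 ∷ 121306364 ∷ 241306172 ∷ 210212232 ∷ 290028384 ∷ 33246024 ∷
   281306028 ∷ 377434004 ∷ 36304128 ∷ 417394164016 ∷ 17434340200 ∷ 387040144064 ∷ 401052024448 ∷ 401386292376 ∷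
   109294112128 ∷ 97290484240 ∷ 417418260400 ∷ 65098128256 ∷ 69134072400 ∷ 129362332336 ∷ 225018020376 ∷
   73162460432 ∷ 193456144096 ∷ 131016032064 ∷ 193322244376 ∷ 65484360432 ∷ 161010292192 ∷ 177162164232 ∷
   329290036240 ∷ 113114180200 ∷ 353034164392 ∷ 137226108144 ∷ 85278328416 ∷ 241354180104 ∷ 257194148008 ∷
   337226356456 ∷ 17314020064 ∷ 449150136288 ∷ 65138140272 ∷ 137218060256 ∷ 273354116040 ∷ 17098500376 ∷
   281130476032 ∷ 161282300192 ∷ 17178260136 ∷ 353086280384 ∷ 129066236240 ∷ 433418276408 ∷ 33038008448 ∷
   233426268208 ∷ 209050484472 ∷ 387140272096 ∷ 73026276416 ∷ 451356360272 ∷ 130260072464 ∷ 401466260184 ∷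
   129396400096 ∷ 449290036312 ∷ 401466068344 ∷ 53006056384 ∷ 322420168432 ∷ 131084136160 ∷ 101198080256 ∷
   273450468408 ∷ 273130148344 ∷ 257034012080 ∷ 321242132408 ∷ 481322324208 ∷ 329138388432 ∷ 129226324248 ∷
   449322148168 ∷ 481362452240 ∷ 389462400160 ∷ 201098012256 ∷ 193024160256 ∷ 393018452032 ∷ 3036040064 ∷
   17482308168 ∷ 345450332096 ∷ 65114180456 ∷ 1002468152 ∷ 289082260040 ∷ 85338216480 ∷ 233386100112 ∷
   497034436008 ∷ 69166136016 ∷ 393066172432 ∷ 290264320384 ∷ 229354456368 ∷ 37386456304 ∷ 51164120256 ∷
   193100040208 ∷ 353082020408 ∷ 209178292104 ∷ 225322164488 ∷ 289034012432 ∷ 105066140016 ∷ 241050436024 ∷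
   233170076400 ∷ 17370164248 ∷ 465386324480 ∷ 329402340288 ∷ 433418436320 ∷ 57138028320 ∷ 321204080224 ∷
   321266036272 ∷ 313418180448 ∷ 225386468360 ∷ 481098180376 ∷ 225042324368 ∷ 25138156160 ∷ 161066152256 ∷
   457010452016 ∷ 3340072160 ∷ 473138404288 ∷ 161018212152 ∷ 241306228216 ∷ 433306356168 ∷ 129322364400 ∷
   138068144288 ∷ 9458196304 ∷ 1338260128 ∷ 337338196424 ∷ 1114100392 ∷ 385006280320 ∷ 451276472096 ∷
   385498340040 ∷ 81450028032 ∷ 177466468344 ∷ 322004232016 ∷ 489450068048 ∷ 449338264032 ∷ 105458388208 ∷
   69390072048 ∷ 49450036328 ∷ 129466436216 ∷ 21006088384 ∷ 386424272320 ∷ 1298012128 ∷ 177498420264 ∷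
   33098292216 ∷ 113482324296 ∷ 345074148032 ∷ 161082052088 ∷ 261038400448 ∷ 465210468120 ∷ 145324136416 ∷
   449260104144 ∷ 133002072144 ∷ 233138132496 ∷ 65226484152 ∷ 201450228176 ∷ 345474156224 ∷ 325290104368 ∷
   433146244344 ∷ 321050148152 ∷ 1066004360 ∷ 241034404072 ∷ 257410020448 ∷ 97262296304 ∷ 146020424448 ∷
   497034244248 ∷ 65362228464 ∷ 225098468408 ∷ 225258244440 ∷ 1074420496 ∷ 133022184192 ∷ 313042164320 ∷
   193418232080 ∷ 117246136256 ∷ 433290276488 ∷ 7456336224 ∷ 185130148192 ∷ 397458272032 ∷ 73458340288 ∷
   193450464352 ∷ 497290084472 ∷ 265140016448 ∷ 165006392432 ∷ 209138156224 ∷ 161082084504 ∷ 257130228232 ∷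
   169194204176 ∷ 97290104208 ∷ 345450348160 ∷ 305082212280 ∷ 193322308424 ∷ 3260232112 ∷ 97402260264 ∷
   371292072384 ∷ 385050180104 ∷ 425010204048 ∷ 225146260360 ∷ 169130396320 ∷ 481130004216 ∷ 261390392272 ∷
   177290084360 ∷ 321458212032 ∷ 257450436248 ∷ 113290260392 ∷ 465162484008 ∷ 389142464032 ∷ 185010012064 ∷
   391328272032 ∷ 481146180440 ∷ 263072208096 ∷ 385282428448 ∷ 457462336160 ∷ 161330076176 ∷ 161418228248 ∷
   385234492112 ∷ 99100104208 ∷ 269166176064 ∷ 129402196232 ∷ 1326328352 ∷ 321458028224 ∷ 485290008432 ∷
   385202092352 ∷ 193082468136 ∷ 353354484024 ∷ 193130196480 ∷ 33038168320 ∷ 385166232176 ∷ 273006408064 ∷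
   265106364432 ∷ 161258324072 ∷ 201418204016 ∷ 1454072272 ∷ 161002500296 ∷ 197422392048 ∷ 354452072112 ∷
   161196136304 ∷ 81354468168 ∷ 137002356304 ∷ 385042268464 ∷ 65466392480 ∷ 193098008016 ∷ 33074260464 ∷
   459460144096 ∷ 213326280032 ∷ 161274228344 ∷ 481418276376 ∷ 65418500440 ∷ 377338044128 ∷ 425170436448 ∷
   193410460032 ∷ 329466260160 ∷ 257066324128 ∷ 305194500248 ∷ 129082476480 ∷ 417466308216 ∷ 197066024352 ∷
   33082356456 ∷ 97482164488 ∷ 1170484240 ∷ 19148408160 ∷ 417114308472 ∷ 449290148088 ∷ 98116264128 ∷
   297282420192 ∷ 9154324160 ∷ 449098164232 ∷ 481326040112 ∷ 17386420024 ∷ 417130196328 ∷ 258100296208 ∷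
   449066468504 ∷ 241322308504 ∷ 65130428048 ∷ 114052056384 ∷ 25130148448 ∷ 217274076288 ∷ 145018340328 ∷
   257036200272 ∷ 163260104080 ∷ [])
  []
  []

batch₉-18 : Batch
batch₉-18 = batch 18
  (53034072128 ∷ 161226164336 ∷ 179164280192 ∷ 195068408416 ∷ 162100488176 ∷ 65290076400 ∷ 469450288 ∷
   217010260160 ∷ 113226148424 ∷ 225482332080 ∷ 449138172144 ∷ 101264464 ∷ 98196392080 ∷ 321298196208 ∷
   1086072352 ∷ 241130436008 ∷ 213470088352 ∷ 401386132408 ∷ 161418276232 ∷ 69010016288 ∷ 77390208096 ∷
   193482364432 ∷ 265490076144 ∷ 9066460432 ∷ 1322212312 ∷ 145402484120 ∷ 401434020440 ∷ 29326352128 ∷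
   49274392064 ∷ 1426268496 ∷ 385034308008 ∷ 200144032256 ∷ 194004264048 ∷ 309162312 ∷ 401162228136 ∷ 225266188 ∷
   65210292040 ∷ 385290016448 ∷ 261214072224 ∷ 385178148392 ∷ 131420392496 ∷ 193354452400 ∷ 305130052312 ∷
   389008288320 ∷ 353366496 ∷ 81098100344 ∷ 33136256 ∷ 273186300192 ∷ 65298324176 ∷ 169482076400 ∷ 133482040432 ∷
   289194004176 ∷ 89394156 ∷ 466388280480 ∷ 449498468456 ∷ 385354008144 ∷ 57188064256 ∷ 418136176320 ∷ 105116128 ∷
   449210484088 ∷ 2324480 ∷ 162180448 ∷ 75132080032 ∷ 449018292072 ∷ 137002208096 ∷ 291100200400 ∷ 353002324248 ∷
   449194196048 ∷ 133454008048 ∷ 18068456096 ∷ 353282364128 ∷ 25074356128 ∷ 497066212392 ∷ 225106204432 ∷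
   81138220256 ∷ 321234292368 ∷ 353386132456 ∷ 49370276200 ∷ 81450276416 ∷ 409218012480 ∷ 465402244264 ∷
   289314388064 ∷ 225482356016 ∷ 129202012240 ∷ 341258216 ∷ 449194116184 ∷ 113210020184 ∷ 269294272448 ∷
   497274500008 ∷ 329426036016 ∷ 449452464032 ∷ 267076096 ∷ 162116088256 ∷ 17418244168 ∷ 233394084 ∷
   289386484344 ∷ 1392016096 ∷ 129148440192 ∷ 289290292392 ∷ 9386388096 ∷ 49190064 ∷ 497354420392 ∷ 341038360128 ∷
   361202228368 ∷ 33162008208 ∷ 65234004048 ∷ 345146204480 ∷ 37262200240 ∷ 341006328352 ∷ 49450440 ∷
   453354072368 ∷ 482164392400 ∷ 265490292432 ∷ 1082372040 ∷ 185002404 ∷ 4168304320 ∷ 83404024224 ∷ 193330464032 ∷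
   217194020352 ∷ 465090220352 ∷ 145354244168 ∷ 409338012416 ∷ 177466372472 ∷ 154084480 ∷ 357470024 ∷
   129036040336 ∷ 411012032 ∷ 225290452408 ∷ 161002404448 ∷ 309262344 ∷ 177258068504 ∷ 393266460480 ∷ 138012288 ∷
   17258452184 ∷ 65322388400 ∷ 17042340128 ∷ 385394196400 ∷ 257202396144 ∷ 41370324128 ∷ 3036152320 ∷
   137198048256 ∷ 465082052072 ∷ 51260056064 ∷ 33258420296 ∷ 321322204144 ∷ 65258180056 ∷ 113450292184 ∷
   193210152416 ∷ 449162332400 ∷ 1086152160 ∷ 449098168240 ∷ 69278328160 ∷ 9098132336 ∷ 435292168448 ∷
   89402068480 ∷ 1322224 ∷ 483132264368 ∷ 261482360368 ∷ 289482004200 ∷ 449066452136 ∷ 417294296080 ∷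
   129482488496 ∷ 41282428320 ∷ 69458144160 ∷ 281162012064 ∷ 129162484360 ∷ 193226140048 ∷ 162308168192 ∷
   345010308384 ∷ 465130072416 ∷ 481002404408 ∷ 65042300016 ∷ 353458100240 ∷ 81290180 ∷ 387140144448 ∷ 422200272 ∷
   257038104432 ∷ 241242292328 ∷ 169162076 ∷ 449004264080 ∷ 162228056256 ∷ 97198104272 ∷ 261198144224 ∷
   457194484048 ∷ 50308440 ∷ 497418260120 ∷ 129290140448 ∷ 281058284064 ∷ 337452216 ∷ 401194100040 ∷ 357050232 ∷
   273066404392 ∷ 473018460480 ∷ 49086312 ∷ 225354232400 ∷ 177130148504 ∷ 1182424064 ∷ 385454200304 ∷
   465450500312 ∷ 130324360464 ∷ 273242164344 ∷ 49146100216 ∷ 137202324480 ∷ 197198488208 ∷ 2260272192 ∷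
   65420488144 ∷ 419036168112 ∷ 133226080 ∷ 33010300192 ∷ 17162052280 ∷ 297042420144 ∷ 331260016416 ∷
   177434452264 ∷ 7264464224 ∷ 393130236208 ∷ 129498292184 ∷ 273290020392 ∷ 449242100296 ∷ 197486344 ∷ 489026356 ∷
   449130336032 ∷ 305082308184 ∷ 97322460048 ∷ 241450372504 ∷ 489458132464 ∷ 449002180248 ∷ 497450104 ∷
   371004280 ∷ 261130264416 ∷ 225010460048 ∷ 273018404424 ∷ 497266348 ∷ [])
  []
  []

batch₉-12 : Batch
batch₉-12 = batch 12
  (339260136352 ∷ 65322340136 ∷ 1404152416 ∷ 49386484472 ∷ 285130416 ∷ 33066468 ∷ 66324008 ∷ 197214136096 ∷
   354356168336 ∷ 465146212072 ∷ 33196104304 ∷ 329202144160 ∷ 57002132 ∷ 65482076 ∷ 289068136016 ∷ 113066036040 ∷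
   386452264496 ∷ 275148072096 ∷ 493334432 ∷ 97290180488 ∷ 337114052184 ∷ 357274376128 ∷ 161050260056 ∷
   389146072 ∷ 417198488464 ∷ 305098324424 ∷ 193338052504 ∷ 33036104400 ∷ 370068296384 ∷ 401066068008 ∷
   178084232 ∷ 329258492336 ∷ 393450132096 ∷ 41354236208 ∷ 145266396096 ∷ 41290236496 ∷ 273074404352 ∷
   265006048064 ∷ 241354328 ∷ 129018260088 ∷ 305178132248 ∷ 321210472 ∷ 369114388184 ∷ 417194276424 ∷
   353170140048 ∷ 261136432064 ∷ 329386108240 ∷ 481130324200 ∷ 21086344096 ∷ 417354356312 ∷ 273038344384 ∷
   417434276248 ∷ 217140096256 ∷ 433426300192 ∷ 497034276040 ∷ 81182376 ∷ 1132008416 ∷ 453134088160 ∷ 385308192 ∷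
   293194296208 ∷ 241386280 ∷ 354100360080 ∷ 273466264096 ∷ 481002420072 ∷ 234300368 ∷ 7008016032 ∷ 393426048192 ∷
   353034148088 ∷ 369402292344 ∷ 337202076224 ∷ 161002396192 ∷ 69462208416 ∷ 97178356312 ∷ 161386340376 ∷
   241322452168 ∷ 1402308040 ∷ 325422040240 ∷ 241306452120 ∷ 465114116200 ∷ 497466452504 ∷ 65130344096 ∷
   129450468488 ∷ 65130148104 ∷ 34484296208 ∷ 391152160192 ∷ 353338452472 ∷ 349394032 ∷ 449162212328 ∷
   73162356144 ∷ 387020224 ∷ 145082308360 ∷ 407072032 ∷ 225386324088 ∷ 457076464416 ∷ 149210264416 ∷
   145322460224 ∷ 337066404296 ∷ 401090076096 ∷ 321082132488 ∷ 209242100376 ∷ 129390168208 ∷ 138300304064 ∷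
   193466004224 ∷ 321338356408 ∷ 101230392400 ∷ 305306308384 ∷ 393290164240 ∷ 65008208288 ∷ 25450156 ∷
   49082388504 ∷ 337386004296 ∷ 17410416192 ∷ 66068328016 ∷ 81354244248 ∷ 89026116384 ∷ 177102440 ∷ 69074400096 ∷
   353178452216 ∷ 441002292192 ∷ 137098492496 ∷ 257162420088 ∷ 417290024064 ∷ 129386488464 ∷ 161242404376 ∷
   385338452344 ∷ 137274508 ∷ 402308264064 ∷ 185138316320 ∷ 209402452312 ∷ 387084216352 ∷ 51020024 ∷
   129082328032 ∷ 497242260040 ∷ 473010132096 ∷ 34388008 ∷ 81450404 ∷ 145154388224 ∷ 197290136016 ∷ 273018500488 ∷
   361042228272 ∷ 65482020424 ∷ 281014032448 ∷ 337290404504 ∷ 81146028416 ∷ 225450180120 ∷ 354484296 ∷ 273042436 ∷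
   417098212 ∷ 217178204 ∷ 425420176 ∷ 36136064 ∷ 457450204 ∷ 297242308 ∷ 259208288 ∷ 229200336 ∷ 185402484 ∷
   489386284 ∷ 81002200224 ∷ 419360496 ∷ 357374248 ∷ 130372296 ∷ 5134096 ∷ 301368384 ∷ 36392144 ∷ 178500392 ∷
   185050380 ∷ 137206432 ∷ 465034440 ∷ 21066256 ∷ 388232432 ∷ 337166296 ∷ 129002224 ∷ 353050196344 ∷ 235172112 ∷
   389066072336 ∷ 385482452360 ∷ [])
  []
  []

batch₉-6 : Batch
batch₉-6 = batch 6
  (257034084168 ∷ 433354340360 ∷ 203140144352 ∷ 369258244248 ∷ 81034420232 ∷ 209178308024 ∷ 385338392288 ∷
   145162292064 ∷ 449332016032 ∷ 65132072160 ∷ 417388392064 ∷ 233450388208 ∷ 161258180024 ∷ 113194292056 ∷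
   257274452312 ∷ 21008160192 ∷ 73018108 ∷ 113194420136 ∷ 99100488 ∷ 465134008160 ∷ 289106076432 ∷ 1150392448 ∷
   449102456464 ∷ 209418068248 ∷ 81066284352 ∷ 385402372248 ∷ 193474276288 ∷ 331076208032 ∷ 289306324392 ∷
   389358104048 ∷ 49034164360 ∷ 193370484008 ∷ 385134488368 ∷ 421008016320 ∷ 467068104 ∷ 385210452056 ∷ 9306092 ∷
   257438136064 ∷ 73418012176 ∷ 1498212376 ∷ 386012144480 ∷ 193146264160 ∷ 353050100056 ∷ 146196392224 ∷
   386260400416 ∷ 321136144224 ∷ 233410052 ∷ 225100328432 ∷ 97090068128 ∷ 225498388088 ∷ 401146132160 ∷
   97130156256 ∷ 329194420176 ∷ 17262288384 ∷ 145290500168 ∷ 25092160 ∷ 289298300400 ∷ 161106140256 ∷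
   129170172240 ∷ 41298140496 ∷ 453330464480 ∷ 385082260168 ∷ 113146084072 ∷ 449466420472 ∷ 291132168240 ∷
   281082384 ∷ 129132152 ∷ 33386228008 ∷ 323236176 ∷ 345354348 ∷ 466468104 ∷ 249506260 ∷ 353202468 ∷ 185346340 ∷
   33392368 ∷ 499068104 ∷ 153282044 ∷ 245054232 ∷ 289130176 ∷ 323388264416 ∷ 17066060384 ∷ 147156416192 ∷
   145210440 ∷ [])
  (21066200256 ∷ 101008208256 ∷ 33136112256 ∷ 65162112256 ∷ 73010092256 ∷ 101078144256 ∷ 37006048320 ∷
   5074272096 ∷ 257100112384 ∷ [])
  []

batch₉-3 : Batch
batch₉-3 = batch 3
  (385202452080 ∷ 33484200048 ∷ 274148192 ∷ 299044272 ∷ 73138180 ∷ 33066380384 ∷ 338276392352 ∷ 417402148264 ∷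
   97418356504 ∷ 83148136224 ∷ 321074068016 ∷ 33356424400 ∷ 258028288448 ∷ 132216416 ∷ 177274436504 ∷
   305002388216 ∷ 273258152320 ∷ 321210004184 ∷ 387492496 ∷ 389450200160 ∷ 385498052168 ∷ 33454168080 ∷
   385010364368 ∷ 145180184 ∷ 265490420496 ∷ 49370092128 ∷ 481354484240 ∷ 193390080416 ∷ 1042036304 ∷
   391008336288 ∷ 289410172320 ∷ 61030320384 ∷ 129338132424 ∷ 489122244 ∷ 21146280288 ∷ 233292016 ∷ 67460160 ∷
   459196112 ∷ 361210436 ∷ 201466348352 ∷ 417010060064 ∷ 201002500 ∷ 105226108464 ∷ [])
  (165034176 ∷ 345284032 ∷ 427004112 ∷ 49162292 ∷ 57122348 ∷ 389334368 ∷ 357008208 ∷ 289136368 ∷ 277322200 ∷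
   109208256 ∷ 81248256 ∷ 221138256 ∷ 129196296208 ∷ 81114116504 ∷ 269394208096 ∷ [])
  []

batch₉-2 : Batch
batch₉-2 = batch 2
  (193362036080 ∷ 1162484168 ∷ 273098164440 ∷ 451196360368 ∷ 433226388472 ∷ 337162084344 ∷ 433410052320 ∷
   2388136016 ∷ 465386068344 ∷ 273090096 ∷ 499100072 ∷ 177162052008 ∷ 411068032 ∷ 321130264160 ∷ 485418312 ∷
   137002260240 ∷ 387172304 ∷ 179292408 ∷ 265426172368 ∷ 290148152064 ∷ 49482452088 ∷ 273418020472 ∷ 401386492 ∷
   290324040016 ∷ 425156064 ∷ 395356304 ∷ 249138092 ∷ 257082100280 ∷ 83260088224 ∷ 49354232 ∷ 305114372488 ∷ [])
  (1020128 ∷ 37006064 ∷ 330016096 ∷ 225426132112 ∷ 193098164112 ∷ 361362268112 ∷ 49162340 ∷ 67044368 ∷ 277334480 ∷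
   [])
  []

batch₉-1 : Batch
batch₉-1 = batch 1
  (353230136496 ∷ 267272480 ∷ 101358296464 ∷ 417426492368 ∷ 337034420248 ∷ 465058428 ∷ 497306260008 ∷ 165294040 ∷
   153330012288 ∷ 169402468 ∷ 41346212 ∷ 281202252 ∷ 161324144 ∷ 369130004248 ∷ 289010276384 ∷ 297330204016 ∷
   233298432 ∷ [])
  (421290176192 ∷ 9076080288 ∷ 353458260368 ∷ 33392112 ∷ 21066456 ∷ 101264208 ∷ 2140112256 ∷ 21242024256 ∷
   161196040256 ∷ [])
  []

cores₉ : List (Vec ℕ 3)
cores₉ =
  (256 ∷ 136 ∷ 33 ∷ []) ∷ (280 ∷ 38 ∷ 305 ∷ []) ∷ (52 ∷ 410 ∷ 233 ∷ []) ∷ (64 ∷ 156 ∷ 425 ∷ []) ∷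
  (24 ∷ 20 ∷ 51 ∷ []) ∷ (344 ∷ 486 ∷ 197 ∷ []) ∷ (204 ∷ 178 ∷ 217 ∷ []) ∷ (156 ∷ 394 ∷ 89 ∷ []) ∷ []

-- Exponents prime to 2ˡ - 1 for which the power sums separate all base blocks.
exponents₆ : Vec ℕ 3
exponents₆ = 11 ∷ 23 ∷ 31 ∷ []
exponents₇ : Vec ℕ 3
exponents₇ = 31 ∷ 43 ∷ 47 ∷ []
exponents₈ exponents₉ : Vec ℕ 4
exponents₈ = 23 ∷ 29 ∷ 31 ∷ 43 ∷ []
exponents₉ = 15 ∷ 31 ∷ 55 ∷ 93 ∷ []

-- X⁶ + X + 1, X⁷ + X + 1, X⁸ + X⁴ + X³ + X² + 1 and X⁹ + X⁴ + 1
modulus₆ : Bits 6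
modulus₆ = bits 6 48
modulus₇ : Bits 7
modulus₇ = bits 7 96
modulus₈ : Bits 8
modulus₈ = bits 8 184
modulus₉ : Bits 9
modulus₉ = bits 9 272

abstract
  -- The decision procedure is evaluated by type checking the trivial argument of `toWitness`, and
  -- `abstract` keeps the result from being unfolded later. Only proofs in the settings depend on
  -- it, so their arithmetic still computes.
  admissible₆ : QuotientSetting.Admissible modulus₆ exponents₆
  admissible₆ = toWitness {a? = QuotientSetting.admissible? modulus₆ exponents₆} _
  admissible₇ : QuotientSetting.Admissible modulus₇ exponents₇
  admissible₇ = toWitness {a? = QuotientSetting.admissible? modulus₇ exponents₇} _
  admissible₈ : QuotientSetting.Admissible modulus₈ exponents₈
  admissible₈ = toWitness {a? = QuotientSetting.admissible? modulus₈ exponents₈} _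
  admissible₉ : QuotientSetting.Admissible modulus₉ exponents₉
  admissible₉ = toWitness {a? = QuotientSetting.admissible? modulus₉ exponents₉} _

setting₆ setting₇ setting₈ setting₉ : Setting
setting₆ = QuotientSetting.quotientSetting modulus₆ exponents₆ admissible₆
setting₇ = QuotientSetting.quotientSetting modulus₇ exponents₇ admissible₇
setting₈ = QuotientSetting.quotientSetting modulus₈ exponents₈ admissible₈
setting₉ = QuotientSetting.quotientSetting modulus₉ exponents₉ admissible₉

-- The weights are 1; 2, 1; 3, 2, 1; 8, 4, 2, 2, 1; and 24, 18, 12, 6, 3, 2, 1. Their sums 1, 3, 6,
-- 17 and 66 are the greatest s of each case, and the decreasing order suits the greedy `select`.
batches₆ batches₇ batches₇′ batches₈ batches₉ : List Batch
batches₆  = batch₆-1 ∷ []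
batches₇  = batch₇-2 ∷ batch₇-1 ∷ []
batches₇′ = batch₇-3 ∷ batches₇
batches₈  = batch₈-8 ∷ batch₈-4 ∷ batch₈-2 ∷ batch₈-2′ ∷ batch₈-1 ∷ []
batches₉  = batch₉-24 ∷ batch₉-18 ∷ batch₉-12 ∷ batch₉-6 ∷ batch₉-3 ∷ batch₉-2 ∷ batch₉-1 ∷ []

K₃₄ K₃₄₅ : List ℕ
K₃₄  = 3 ∷ 4 ∷ []
K₃₄₅ = 3 ∷ 4 ∷ 5 ∷ []

abstract
  certificate₆ : Certificate setting₆ K₃₄₅ batches₆ cores₆ 1
  certificate₆ = toWitness {a? = certificate? setting₆ K₃₄₅ batches₆ cores₆ 1} _
  certificate₇ : Certificate setting₇ K₃₄ batches₇ cores₇ 3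
  certificate₇ = toWitness {a? = certificate? setting₇ K₃₄ batches₇ cores₇ 3} _
  certificate₇′ : Certificate setting₇ K₃₄₅ batches₇′ cores₇ 6
  certificate₇′ = toWitness {a? = certificate? setting₇ K₃₄₅ batches₇′ cores₇ 6} _
  certificate₈ : Certificate setting₈ K₃₄ batches₈ cores₈ 17
  certificate₈ = toWitness {a? = certificate? setting₈ K₃₄ batches₈ cores₈ 17} _
  certificate₉ : Certificate setting₉ K₃₄ batches₉ cores₉ 66
  certificate₉ = toWitness {a? = certificate? setting₉ K₃₄ batches₉ cores₉ 66} _

open import Data.Nat.Base using (_*_; _≤_)

theorem5p5 : (m l s : ℕ) (K : List ℕ) → 2 ≤ m →
    ( ( K ≡ 3 ∷ 4 ∷ [] ×
    ( (l ≡ 7 × s ∈ 1 ∷ 2 ∷ 3 ∷ [])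
    ⊎ (l ≡ 8 × 1 ≤ s × s ≤ 17)
    ⊎ (l ≡ 9 × 1 ≤ s × s ≤ 66 × s ≢ 33) ) )
    ⊎ ( K ≡ 3 ∷ 4 ∷ 5 ∷ [] ×
    ( (l ≡ 6 × s ≡ 1)
    ⊎ (l ≡ 7 × s ∈ 3 ∷ 4 ∷ 5 ∷ 6 ∷ []) ) ) ) →
    Σ (PBD GF2 (m * l) K (42 * s)) Simple
theorem5p5 m l s K 2≤m (inj₁ (refl , inj₁ (refl , s∈))) = certifiedDesign certificate₇ (here refl) m
  (All.lookup (toWitness {a? = All.all? (ℕ._≤? 3) (1 ∷ 2 ∷ 3 ∷ [])} _) s∈)
theorem5p5 m l s K 2≤m (inj₁ (refl , inj₂ (inj₁ (refl , _ , s≤17)))) =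
    certifiedDesign certificate₈ (here refl) m s≤17
theorem5p5 m l s K 2≤m (inj₁ (refl , inj₂ (inj₂ (refl , _ , s≤66 , _)))) =
    certifiedDesign certificate₉ (here refl) m s≤66
theorem5p5 m l s K 2≤m (inj₂ (refl , inj₁ (refl , refl))) = certifiedDesign certificate₆ (here refl) m ℕ.≤-refl
theorem5p5 m l s K 2≤m (inj₂ (refl , inj₂ (refl , s∈))) = certifiedDesign certificate₇′ (here refl) m
  (All.lookup (toWitness {a? = All.all? (ℕ._≤? 6) (3 ∷ 4 ∷ 5 ∷ 6 ∷ [])} _) s∈)
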